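{- There exists a function $f:\mathbb{N}\to\mathbb{N}$ such that for every $t\in\mathbb{N}$, every graph of rank-depth at least $f(t)$ has a pivot-minor isomorphic to $P_t$ or to the graph obtained from two disjoint copies of $K_t$, with vertices $u_1,\dots,u_t$ and $v_1,\dots,v_t$ respectively, by adding the edges $u_iv_j$ for all $i,j\in[t]$ with $i\geq j$ (that is, two disjoint cliques of size $t$ joined by a half graph).
   Context: Graphs are finite, simple and undirected. $P_t$ denotes a path on $t$ vertices and $K_t$ the complete graph on $t$ vertices. For a vertex $v$ of $G$, local complementation $G\ast v$ complements the edge relation among the neighbours of $v$; for an edge $uv$, pivoting is $G\wedge uv:=G\ast u\ast v\ast u$. A pivot-minor of $G$ is a graph obtained from $G$ by a sequence of vertex deletions and pivotings. For $S\subseteq V(G)$, $\rho_G(S)$ is the rank (over GF(2)) of the $S\times(V(G)\setminus S)$ submatrix of the adjacency matrix. A decomposition of $G$ is a pair $(T,\sigma)$ of a tree $T$ and a bijection $\sigma$ from $V(G)$ to the leaves of $T$; the width of a non-leaf node $v$ is the maximum of $\rho_G$ over unions of parts of the partition of $V(G)$ induced by the components of $T-v$, and the width of the decomposition is the maximum width of a non-leaf node. The rank-depth of $G$ is the minimum $k$ such that $G$ has a decomposition of width at most $k$ whose tree has radius at most $k$ (and is $0$ if $G$ has at most one vertex). -}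

module Defs where

open import Data.Bool using (Bool; true; false; not; _∧_; _∨_; _xor_; if_then_else_)
open import Data.Bool.Properties using (∧-comm; ∨-comm)
open import Data.Nat as ℕ using (ℕ; zero; suc; _<_; _≤_; _+_)
import Data.Nat.Properties as ℕP
open import Data.Fin as Fin using (Fin; zero; suc; toℕ; punchIn; splitAt; inject₁; fromℕ)
import Data.Fin.Properties as FinP
open import Data.Sum using (_⊎_; inj₁; inj₂)
open import Data.Product using (Σ; _×_; _,_; ∃)
open import Data.Unit using (⊤)
open import Relation.Nullary using (¬_; does; yes; no)
open import Relation.Binary.PropositionalEquality using (_≡_; refl; sym; _≢_)
open import Function using (_∘_)

record Graph (n : ℕ) : Set where
  field
    adj    : Fin n → Fin n → Bool
    adj-sym : ∀ x y → adj x y ≡ adj y x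
    adj-irrefl : ∀ x → adj x x ≡ false
open Graph public

_==_ : ∀ {n} → Fin n → Fin n → Bool
x == y = does (x FinP.≟ y)

==-sym : ∀ {n} (x y : Fin n) → (x == y) ≡ (y == x)
==-sym x y with x FinP.≟ y | y FinP.≟ x
... | yes _ | yes _ = refl
... | no _  | no _  = refl
... | yes p | no q  = Data.Empty.⊥-elim (q (sym p)) where import Data.Empty
... | no p  | yes q = Data.Empty.⊥-elim (p (sym q)) where import Data.Empty

==-refl : ∀ {n} (x : Fin n) → (x == x) ≡ true
==-refl x with x FinP.≟ x
... | yes _ = refl
... | no p  = Data.Empty.⊥-elim (p refl) where import Data.Empty

lcAdj : ∀ {n} → Graph n → Fin n → Fin n → Fin n → Bool
lcAdj G v x y = if x == y then false else (adj G x y xor (adj G v x ∧ adj G v y))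

localComp : ∀ {n} → Graph n → Fin n → Graph n
localComp G v = record { adj = lcAdj G v ; adj-sym = s ; adj-irrefl = i }
  where
  s : ∀ x y → lcAdj G v x y ≡ lcAdj G v y x
  s x y rewrite ==-sym x y | adj-sym G x y | ∧-comm (adj G v x) (adj G v y) = refl
  i : ∀ x → lcAdj G v x x ≡ false
  i x rewrite ==-refl x = refl

-- Pivoting G ∧ uv := G * u * v * u  (applied only along an edge uv)
pivot : ∀ {n} → Graph n → Fin n → Fin n → Graph n
pivot G u v = localComp (localComp (localComp G u) v) u

delete : ∀ {n} → Graph (suc n) → Fin (suc n) → Graph n
delete G v = record
  { adj = λ x y → adj G (punchIn v x) (punchIn v y)
  ; adj-sym = λ x y → adj-sym G (punchIn v x) (punchIn v y)
  ; adj-irrefl = λ x → adj-irrefl G (punchIn v x) }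

data PivotReach : ∀ {n m} → Graph n → Graph m → Set where
  done : ∀ {n} {G : Graph n} → PivotReach G G
  del  : ∀ {n m} {G : Graph (suc n)} {H : Graph m} (v : Fin (suc n)) →
         PivotReach (delete G v) H → PivotReach G H
  piv  : ∀ {n m} {G : Graph n} {H : Graph m} (u v : Fin n) → adj G u v ≡ true →
         PivotReach (pivot G u v) H → PivotReach G H

record Iso {n m : ℕ} (H : Graph n) (G : Graph m) : Set where
  field
    to      : Fin n → Fin m
    from    : Fin m → Fin n
    from∘to : ∀ x → from (to x) ≡ x
    to∘from : ∀ y → to (from y) ≡ y
    preserves : ∀ x y → adj H x y ≡ adj G (to x) (to y)

PivotMinor : ∀ {n m} → Graph n → Graph m → Set
PivotMinor {n} H G = Σ ℕ λ k → Σ (Graph k) λ G' → PivotReach G G' × Iso H G'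

xorSum : ∀ {m} → (Fin m → Bool) → Bool
xorSum {zero}  f = false
xorSum {suc m} f = f zero xor xorSum (f ∘ suc)

Subset : ℕ → Set
Subset n = Fin n → Bool

-- ρ_G(S) ≤ k : the S × (V∖S) submatrix of the adjacency matrix has
-- GF(2)-rank ≤ k, i.e. every family of k+1 of its rows is linearly dependent
-- (some nontrivial GF(2)-combination of them is the zero row).
CutRankLe : ∀ {n} → Graph n → Subset n → ℕ → Set
CutRankLe {n} G S k =
  (r : Fin (suc k) → Fin n) → (∀ i → S (r i) ≡ true) →
  Σ (Fin (suc k) → Bool) λ c →
    (Σ (Fin (suc k)) λ i → c i ≡ true) ×
    (∀ y → S y ≡ false → xorSum (λ i → c i ∧ adj G (r i) y) ≡ false)

data Conn {N : ℕ} (T : Graph N) (P : Fin N → Set) : Fin N → Fin N → Set where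
  here  : ∀ {x} → P x → Conn T P x x
  there : ∀ {x z y} → P x → adj T x z ≡ true → Conn T P z y → Conn T P x y

Within : ∀ {N} → Graph N → ℕ → Fin N → Fin N → Set
Within T zero    x y = x ≡ y
Within T (suc k) x y = x ≡ y ⊎ Σ _ λ z → adj T x z ≡ true × Within T k z y

record Cycle {N : ℕ} (T : Graph N) : Set where
  field
    len   : ℕ
    c     : Fin (suc (suc (suc len))) → Fin N
    inj   : ∀ i j → c i ≡ c j → i ≡ j
    edges : ∀ (i : Fin (suc (suc len))) → adj T (c (inject₁ i)) (c (suc i)) ≡ true
    close : adj T (c (fromℕ (suc (suc len)))) (c zero) ≡ true

IsTree : ∀ {N} → Graph N → Set
IsTree {N} T = (∀ x y → Conn T (λ _ → ⊤) x y) × ¬ Cycle T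

IsLeaf : ∀ {N} → Graph N → Fin N → Set
IsLeaf T v = Σ _ λ u → adj T v u ≡ true × (∀ w → adj T v w ≡ true → w ≡ u)

RadiusLe : ∀ {N} → Graph N → ℕ → Set
RadiusLe T k = Σ _ λ c → ∀ x → Within T k c x

record Decomposition {n : ℕ} (G : Graph n) : Set where
  field
    N      : ℕ
    T      : Graph N
    isTree : IsTree T
    σ      : Fin n → Fin N
    σ-inj  : ∀ x y → σ x ≡ σ y → x ≡ y
    σ-leaf : ∀ x → IsLeaf T (σ x)
    σ-onto : ∀ v → IsLeaf T v → Σ (Fin n) λ x → σ x ≡ v

  -- width of the node v is ≤ k: every union S of parts of the partition of
  -- V(G) induced by the components of T - v has ρ_G(S) ≤ k
  NodeWidthLe : Fin N → ℕ → Set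
  NodeWidthLe v k = (S : Subset n) →
    (∀ x y → Conn T (λ w → w ≢ v) (σ x) (σ y) → S x ≡ S y) →
    CutRankLe G S k

  WidthLe : ℕ → Set
  WidthLe k = ∀ v → ¬ IsLeaf T v → NodeWidthLe v k

RankDepthLe : ∀ {n} → Graph n → ℕ → Set
RankDepthLe {n} G k =
  n ≤ 1 ⊎ Σ (Decomposition G) λ D →
    Decomposition.WidthLe D k × RadiusLe (Decomposition.T D) k

RankDepthGe : ∀ {n} → Graph n → ℕ → Set
RankDepthGe G m = ∀ k → k < m → ¬ RankDepthLe G k

sucEq : ℕ → ℕ → Bool
sucEq i j = suc i ℕ.≡ᵇ j

sucEq-irr : ∀ i → sucEq i i ≡ false
sucEq-irr zero    = refl
sucEq-irr (suc i) = sucEq-irr i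

pathAdj : ∀ {t} → Fin t → Fin t → Bool
pathAdj i j = sucEq (toℕ i) (toℕ j) ∨ sucEq (toℕ j) (toℕ i)

path : (t : ℕ) → Graph t
path t = record
  { adj = pathAdj
  ; adj-sym = λ i j → ∨-comm (sucEq (toℕ i) (toℕ j)) (sucEq (toℕ j) (toℕ i))
  ; adj-irrefl = λ i → irr i }
  where
  irr : (i : Fin t) → pathAdj i i ≡ false
  irr i rewrite sucEq-irr (toℕ i) = refl

-- inj₁ i = u_i, inj₂ j = v_j
halfAdj' : ∀ {t} → Fin t ⊎ Fin t → Fin t ⊎ Fin t → Bool
halfAdj' (inj₁ i) (inj₁ i') = not (i == i')
halfAdj' (inj₂ j) (inj₂ j') = not (j == j')
halfAdj' (inj₁ i) (inj₂ j)  = does (j FinP.≤? i)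
halfAdj' (inj₂ j) (inj₁ i)  = does (j FinP.≤? i)

halfAdj'-sym : ∀ {t} (a b : Fin t ⊎ Fin t) → halfAdj' a b ≡ halfAdj' b a
halfAdj'-sym (inj₁ i) (inj₁ i') rewrite ==-sym i i' = refl
halfAdj'-sym (inj₂ j) (inj₂ j') rewrite ==-sym j j' = refl
halfAdj'-sym (inj₁ i) (inj₂ j) = refl
halfAdj'-sym (inj₂ j) (inj₁ i) = refl

halfAdj'-irr : ∀ {t} (a : Fin t ⊎ Fin t) → halfAdj' a a ≡ false
halfAdj'-irr (inj₁ i) rewrite ==-refl i = refl
halfAdj'-irr (inj₂ j) rewrite ==-refl j = refl

cliqueHalf : (t : ℕ) → Graph (t + t)
cliqueHalf t = record
  { adj = λ x y → halfAdj' (splitAt t x) (splitAt t y)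
  ; adj-sym = λ x y → halfAdj'-sym (splitAt t x) (splitAt t y)
  ; adj-irrefl = λ x → halfAdj'-irr (splitAt t x) }

-- A symmetric matrix is low if it has a tree-model of bounded depth with boundedly many labels. Such a model of a graph is turned
-- into a decomposition, so graphs of large rank-depth are high. A minimal high set has bounded size: otherwise some node of a model
-- has many isomorphic children, and one of them can be pumped. Hence, when many vertices are given, two of them have the
-- same neighbours in a suitable high bag.
--
-- In a high graph we grow a handle, that is, an induced path of which only the end w sees a connected high bag. Nest many handles
-- in each other's bags. If the ends of two of them have the same trace on the last bag and are non-adjacent, then a pivot makes
-- one trace vanish and the outer handle gets longer. So we may assume that the ends v, T₁, T₂, … form a clique of twins. Then one
-- works with the matrix S = g * v, looped at the neighbours of v: pivoting on T i b is the principal pivot of S at its loop b, and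
-- consumes one twin. Handles of S that contain a loop are grown in the same way; by nesting two such families one gets the first
-- looped vertex for free. Two handles of S with equal traces merge into a longer one, after repairing the parity of the later end by
-- its own handle, unless the end w of the outer one sees the first loop ℓ of the inner one. If no two handles merge, the vertices
-- w and ℓ induce two cliques joined by a half graph. Otherwise the handles of S get arbitrarily long, and pivots at loops shorten
-- a long handle to an unlooped path, which is an induced path of a pivot-equivalent graph.
module Submission where

open import Defs
open import Data.Bool using (Bool; true; false; not; _∧_; _∨_; _xor_; if_then_else_)
import Data.Bool.Properties as BP
open import Data.Nat using (ℕ; zero; suc; _+_; _*_; _∸_; _^_; _≤_; _<_; z≤n; s≤s; _≤′_; ≤′-refl; ≤′-step; _⊔_; pred)
import Data.Nat.Properties as NP
open import Data.Fin as Fin using (Fin; zero; suc; toℕ; punchOut; combine; remQuot; splitAt; inject₁; fromℕ; _↑ˡ_; _↑ʳ_)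
import Data.Fin.Properties as FP
open import Data.Maybe using (Maybe; just; nothing)
import Data.Maybe.Properties as MP
open import Data.List using (List; []; _∷_; _++_; length; replicate)
import Data.List.Properties as LP
import Data.List as DL
open import Data.List.Relation.Unary.All as All using (All; []; _∷_)
import Data.List.Relation.Unary.All.Properties as AllP
open import Data.Vec as Vec using (Vec; []; _∷_; lookup; tabulate)
import Data.Vec.Properties as VP
open import Data.Product using (Σ; _×_; _,_; proj₁; proj₂; ∃)
open import Data.Sum using (_⊎_; inj₁; inj₂)
open import Data.Unit using (⊤; tt)
open import Data.Empty using (⊥; ⊥-elim)
open import Relation.Nullary using (¬_; Dec; yes; no; does)
open import Relation.Nullary.Decidable using (_→-dec_; _×-dec_; map′; ¬?)
open import Relation.Binary.PropositionalEquality using (_≡_; _≢_; refl; sym; trans; cong; cong₂; subst; subst₂)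
open import Relation.Binary.Definitions using (tri<; tri≈; tri>)
open import Function using (_∘_; id)

-- Subsets, finite searches

-- Let `w₁` be the end of an outer handle and `w₂` that of an inner one, with equal traces. They
-- merge if a pivot adds the row of `w₂` to that of `w₁`. For a looped `w₂` this needs `S w₁ w₂` to
-- be 1; for an unlooped one, pivoted together with a vertex `c` of the bag that both see, it needs
-- `S w₁ w₂` to be 0. So the whole obstacle is one parity, `S w₁ w₂` against `S w₂ w₂`. In a graph
-- the diagonal is zero, so adjacency is the obstacle and ends that do not merge form cliques. In
-- the looped matrix the diagonal can be changed: a pivot at a loop next to `w₂` toggles `S w₂ w₂`.
-- Edge pivots keep the diagonal, whence the demand that every handle of `S` contain a loop. Bags
-- are measured by the height `k` of `Hi k` instead of their size: a two-bit update of the entries,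
-- the deletion of a vertex and the passage to a connected part cost one unit each, and the
-- thresholds are sums of such units. The induction on the length `i` of handles runs over
-- statements for all heights, because each step nests many handles of the previous length.

infix 4 _∈_ _∉_ _⊆_
infixl 6 _∩_ _∪_ _⊝_

_∈_ _∉_ : ∀ {n} → Fin n → Subset n → Set
x ∈ A = A x ≡ true
x ∉ A = A x ≡ false

_⊆_ : ∀ {n} → Subset n → Subset n → Set
A ⊆ B = ∀ {x} → x ∈ A → x ∈ B

_∩_ _∪_ : ∀ {n} → Subset n → Subset n → Subset n
(A ∩ B) x = A x ∧ B x
(A ∪ B) x = A x ∨ B x

｛_｝ : ∀ {n} → Fin n → Subset n
｛ v ｝ x = x == v

_⊝_ : ∀ {n} → Subset n → Fin n → Subset n
(A ⊝ v) x = A x ∧ not (x == v)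

tf : ∀ {ℓ} {X : Set ℓ} {b : Bool} → b ≡ true → b ≡ false → X
tf refl ()

bool : ∀ b → (b ≡ true) ⊎ (b ≡ false)
bool true  = inj₁ refl
bool false = inj₂ refl

≢true : ∀ {b} → ¬ (b ≡ true) → b ≡ false
≢true {true}  h = ⊥-elim (h refl)
≢true {false} h = refl

≢false : ∀ {b} → ¬ (b ≡ false) → b ≡ true
≢false {true}  h = refl
≢false {false} h = ⊥-elim (h refl)

∧-i : ∀ {a b} → a ≡ true → b ≡ true → a ∧ b ≡ true
∧-i refl refl = refl

∧-l : ∀ {a b} → a ∧ b ≡ true → a ≡ true
∧-l {true} h = refl

∧-r : ∀ {a b} → a ∧ b ≡ true → b ≡ true
∧-r {true} h = h

∨-l : ∀ {a b} → a ≡ true → a ∨ b ≡ true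
∨-l refl = refl

∨-r : ∀ {a b} → b ≡ true → a ∨ b ≡ true
∨-r {true}  h = refl
∨-r {false} h = h

∨-e : ∀ {a b} → a ∨ b ≡ true → (a ≡ true) ⊎ (b ≡ true)
∨-e {true}  h = inj₁ refl
∨-e {false} h = inj₂ h

not-i : ∀ {a} → a ≡ false → not a ≡ true
not-i refl = refl

not-e : ∀ {a} → not a ≡ true → a ≡ false
not-e {false} h = refl

==-yes : ∀ {n} {x y : Fin n} → (x == y) ≡ true → x ≡ y
==-yes {x = x} {y} h with x FP.≟ y
... | yes p = p

==-no : ∀ {n} {x y : Fin n} → (x == y) ≡ false → x ≢ y
==-no {x = x} h refl = tf (==-refl x) h

==-t : ∀ {n} {x y : Fin n} → x ≡ y → (x == y) ≡ true
==-t {x = x} refl = ==-refl x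

==-f : ∀ {n} {x y : Fin n} → x ≢ y → (x == y) ≡ false
==-f h = ≢true (λ e → h (==-yes e))

eq? : ∀ {n} (x y : Fin n) → (x ≡ y) ⊎ (x ≢ y)
eq? x y with x FP.≟ y
... | yes p = inj₁ p
... | no p  = inj₂ p

⊝-i : ∀ {n} {A : Subset n} {v x} → x ∈ A → x ≢ v → x ∈ (A ⊝ v)
⊝-i a h = ∧-i a (not-i (==-f h))

⊝-r : ∀ {n} {A : Subset n} {v x} → x ∈ (A ⊝ v) → x ≢ v
⊝-r {A = A} {v} {x} h = ==-no (not-e (∧-r {A x} h))

∈∉ : ∀ {n} {A : Subset n} {x y} → x ∈ A → y ∉ A → x ≢ y
∈∉ a b refl = tf a b

∃? : ∀ {n} (f : Fin n → Bool) → (Σ (Fin n) λ x → f x ≡ true) ⊎ (∀ x → f x ≡ false)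
∃? f with FP.any? (λ x → f x BP.≟ true)
... | yes p = inj₁ p
... | no p  = inj₂ (λ x → ≢true (λ e → p (x , e)))

does-yes : ∀ {X : Set} (D : Dec X) → does D ≡ true → X
does-yes (yes x) _ = x

does-no : ∀ {X : Set} (D : Dec X) → does D ≡ false → ¬ X
does-no (no x) _ = x

does-y : ∀ {X : Set} (D : Dec X) → X → does D ≡ true
does-y (yes x) _ = refl
does-y (no nx) x = ⊥-elim (nx x)

any₂? : ∀ {n m} (P : Fin n → Fin m → Set) → (∀ i j → Dec (P i j)) → (∃ λ i → ∃ λ j → P i j) ⊎ (∀ i j → ¬ P i j)
any₂? P d with FP.any? (λ i → FP.any? (d i))
... | yes p = inj₁ p
... | no p  = inj₂ (λ i j q → p (i , j , q))

card : ∀ {n} → Subset n → ℕ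
card {zero}  A = 0
card {suc n} A = (if A zero then 1 else 0) + card (A ∘ suc)

bit-mono : ∀ {a b} → (a ≡ true → b ≡ true) → (if a then 1 else 0) ≤ (if b then 1 else 0)
bit-mono {true}  {b} h with b | h refl
... | true | _ = NP.≤-refl
bit-mono {false} h = z≤n

card-mono : ∀ {n} {A B : Subset n} → A ⊆ B → card A ≤ card B
card-mono {zero}  h = z≤n
card-mono {suc n} h = NP.+-mono-≤ (bit-mono h) (card-mono (λ {x} → h {suc x}))

card-strict : ∀ {n} {A B : Subset n} → A ⊆ B → ∀ y → y ∈ B → y ∉ A → card A < card B
card-strict {suc n} {A} {B} h zero b a rewrite a | b = s≤s (card-mono (λ {x} → h {suc x}))
card-strict {suc n} h (suc y) b a = NP.+-mono-≤-< (bit-mono h) (card-strict (λ {x} → h {suc x}) y b a)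

zeroOf : ∀ {n} → Fin n → Fin n
zeroOf zero    = zero
zeroOf (suc _) = zero

zeroOf-const : ∀ {n} (x y : Fin n) → zeroOf x ≡ zeroOf y
zeroOf-const zero    zero    = refl
zeroOf-const zero    (suc y) = refl
zeroOf-const (suc x) zero    = refl
zeroOf-const (suc x) (suc y) = refl

Mat : ℕ → Set
Mat n = Fin n → Fin n → Bool

Sym : ∀ {n} → Mat n → Set
Sym S = ∀ x y → S x y ≡ S y x

-- Increasing subsequences and pigeonhole principles

record _↪_ (M N : ℕ) : Set where
  field
    at   : Fin M → Fin N
    mono : ∀ {i j} → i Fin.< j → at i Fin.< at j
open _↪_ public

idₑ : ∀ {N} → N ↪ N
idₑ = record { at = id ; mono = id }

_∘ₑ_ : ∀ {L M N} → M ↪ N → L ↪ M → L ↪ N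
f ∘ₑ g = record { at = at f ∘ at g ; mono = mono f ∘ mono g }

sucₑ : ∀ {M N} → M ↪ N → M ↪ suc N
sucₑ e = record { at = suc ∘ at e ; mono = λ p → s≤s (mono e p) }

consₑ : ∀ {M N} → M ↪ N → suc M ↪ suc N
consₑ {M} {N} e = record { at = f ; mono = m }
  where
  f : Fin (suc M) → Fin (suc N)
  f zero = zero
  f (suc i) = suc (at e i)
  m : ∀ {i j} → i Fin.< j → f i Fin.< f j
  m {zero}  {suc j} p = s≤s z≤n
  m {suc i} {suc j} (s≤s p) = s≤s (mono e p)

emptyₑ : ∀ {N} → 0 ↪ N
emptyₑ = record { at = λ () ; mono = λ {} }

at-inj : ∀ {M N} (e : M ↪ N) {i j} → i ≢ j → at e i ≢ at e j
at-inj e {i} {j} i≢j eq with NP.<-cmp (toℕ i) (toℕ j)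
... | tri< a _ _ = NP.<-irrefl (cong toℕ eq) (mono e a)
... | tri≈ _ b _ = i≢j (FP.toℕ-injective b)
... | tri> _ _ c = NP.<-irrefl (cong toℕ (sym eq)) (mono e c)

split : ∀ a b (f : Fin (a + b) → Bool) →
  (Σ (a ↪ (a + b)) λ e → ∀ i → f (at e i) ≡ true) ⊎ (Σ (b ↪ (a + b)) λ e → ∀ i → f (at e i) ≡ false)
split a b f = go (a + b) a b (NP.≤-refl) f
  where
  -- The ambient size `N` is detached from `a + b`, since the recursion lowers `a` or `b` while the
  -- sum does not reduce by computation.
  go : ∀ N a b → a + b ≤ N → (f : Fin N → Bool) →
    (Σ (a ↪ N) λ e → ∀ i → f (at e i) ≡ true) ⊎ (Σ (b ↪ N) λ e → ∀ i → f (at e i) ≡ false)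
  go N zero b p f = inj₁ (emptyₑ , λ ())
  go N (suc a) zero p f = inj₂ (emptyₑ , λ ())
  go (suc N) (suc a) (suc b) (s≤s p) f with bool (f zero)
  ... | inj₁ t with go N a (suc b) p (f ∘ suc)
  ...   | inj₁ (e , h) = inj₁ (consₑ e , λ { zero → t ; (suc i) → h i })
  ...   | inj₂ (e , h) = inj₂ (sucₑ e , h)
  go (suc N) (suc a) (suc b) (s≤s p) f | inj₂ t
    with go N (suc a) b (NP.≤-trans (NP.≤-reflexive (sym (NP.+-suc a b))) p) (f ∘ suc)
  ...   | inj₁ (e , h) = inj₁ (sucₑ e , h)
  ...   | inj₂ (e , h) = inj₂ (consₑ e , λ { zero → t ; (suc i) → h i })

Const : ∀ {M} {X : Set} → (Fin M → X) → Set
Const f = ∀ i j → f i ≡ f j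

Inj : ∀ {M} {X : Set} → (Fin M → X) → Set
Inj f = ∀ i j → i ≢ j → f i ≢ f j

pigeon : ∀ m M → Σ ℕ λ N → (f : Fin N → Fin m) → Σ (M ↪ N) λ e → Const (f ∘ at e)
pigeon zero    M = 1 , λ f → ⊥-elim (FP.¬Fin0 (f zero))
pigeon (suc m) M = M + N' , λ f → body f (split M N' (λ i → f i == zero))
  where
  N' = proj₁ (pigeon m M)
  body : (f : Fin (M + N') → Fin (suc m)) →
    (Σ (M ↪ (M + N')) λ e → ∀ i → (f (at e i) == zero) ≡ true) ⊎ (Σ (N' ↪ (M + N')) λ e → ∀ i → (f (at e i) == zero) ≡ false) →
    Σ (M ↪ (M + N')) λ e → Const (f ∘ at e)
  body f (inj₁ (e , h)) = e , λ i j → trans (==-yes (h i)) (sym (==-yes (h j)))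
  body f (inj₂ (e , h)) =
    let g : Fin N' → Fin m
        g i = punchOut {i = zero} {j = f (at e i)} (λ q → ==-no (h i) (sym q))
        (e' , c) = proj₂ (pigeon m M) g
    in e ∘ₑ e' , λ i j → FP.punchOut-injective (λ q → ==-no (h (at e' i)) (sym q)) (λ q → ==-no (h (at e' j)) (sym q)) (c i j)

pigeons : ∀ c m M → Σ ℕ λ N → (F : Fin c → Fin N → Fin m) → Σ (M ↪ N) λ e → ∀ i → Const (F i ∘ at e)
pigeons zero    m M = M , λ F → idₑ , λ ()
pigeons (suc c) m M =
  let (N₁ , p) = pigeon m M ; (N₂ , q) = pigeons c m N₁ in
  N₂ , λ F → let (e₂ , h₂) = q (F ∘ suc) ; (e₁ , h₁) = p (F zero ∘ at e₂) in
    e₂ ∘ₑ e₁ , λ { zero → h₁ ; (suc i) x y → h₂ i (at e₁ x) (at e₁ y) }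

-- The bound must not depend on the size of the target. Either the value at `zero` recurs `M` times,
-- or `N'` later values differ from it and the recursion on `r` continues among them.
const-or-inj : ∀ M r → Σ ℕ λ N → ∀ {n} (f : Fin N → Fin n) →
  (Σ (M ↪ N) λ e → Const (f ∘ at e)) ⊎ (Σ (r ↪ N) λ e → Inj (f ∘ at e))
const-or-inj M zero    = 0 , λ f → inj₂ (emptyₑ , λ ())
const-or-inj M (suc r) = suc (M + N') , λ f → body f (split M N' (λ i → f (suc i) == f zero))
  where
  N' = proj₁ (const-or-inj M r)
  body : ∀ {n} (f : Fin (suc (M + N')) → Fin n) →
    (Σ (M ↪ (M + N')) λ e → ∀ i → (f (suc (at e i)) == f zero) ≡ true) ⊎ (Σ (N' ↪ (M + N')) λ e → ∀ i → (f (suc (at e i)) == f zero) ≡ false) →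
    (Σ (M ↪ suc (M + N')) λ e → Const (f ∘ at e)) ⊎ (Σ (suc r ↪ suc (M + N')) λ e → Inj (f ∘ at e))
  body f (inj₁ (e , h)) = inj₁ (sucₑ e , λ i j → trans (==-yes (h i)) (sym (==-yes (h j))))
  body f (inj₂ (e , h)) with proj₂ (const-or-inj M r) (f ∘ suc ∘ at e)
  ... | inj₁ (e' , c) = inj₁ (sucₑ (e ∘ₑ e') , c)
  ... | inj₂ (e' , d) = inj₂ (consₑ (e ∘ₑ e') , λ
    { zero zero p → ⊥-elim (p refl)
    ; zero (suc j) p q → ==-no (h (at e' j)) (sym q)
    ; (suc i) zero p q → ==-no (h (at e' i)) q
    ; (suc i) (suc j) p → d i j (λ { refl → p refl }) })

consts-or-injs : ∀ k M → Σ ℕ λ N → ∀ {n} (F : Fin k → Fin N → Fin n) →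
  Σ (M ↪ N) λ e → ∀ i → Const (F i ∘ at e) ⊎ Inj (F i ∘ at e)
consts-or-injs zero    M = M , λ F → idₑ , λ ()
consts-or-injs (suc k) M =
  let (N₁ , p) = const-or-inj M M ; (N₂ , q) = consts-or-injs k N₁ in
  N₂ , λ {n} F → let (e₂ , h₂) = q (F ∘ suc) in
    fin F e₂ h₂ (p (F zero ∘ at e₂))
  where
  fin : ∀ {n N₁ N₂} (F : Fin (suc k) → Fin N₂ → Fin n) (e₂ : N₁ ↪ N₂) →
    (∀ i → Const (F (suc i) ∘ at e₂) ⊎ Inj (F (suc i) ∘ at e₂)) →
    (Σ (M ↪ N₁) λ e → Const (F zero ∘ at e₂ ∘ at e)) ⊎ (Σ (M ↪ N₁) λ e → Inj (F zero ∘ at e₂ ∘ at e)) →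
    Σ (M ↪ N₂) λ e → ∀ i → Const (F i ∘ at e) ⊎ Inj (F i ∘ at e)
  rest : ∀ {n N₁ N₂} {f : Fin N₂ → Fin n} (e₂ : N₁ ↪ N₂) (e₁ : M ↪ N₁) →
    Const (f ∘ at e₂) ⊎ Inj (f ∘ at e₂) → Const (f ∘ at e₂ ∘ at e₁) ⊎ Inj (f ∘ at e₂ ∘ at e₁)
  rest e₂ e₁ (inj₁ c) = inj₁ (λ x y → c _ _)
  rest e₂ e₁ (inj₂ d) = inj₂ (λ x y p → d _ _ (at-inj e₁ p))
  fin F e₂ h₂ (inj₁ (e₁ , c)) = e₂ ∘ₑ e₁ , λ { zero → inj₁ c ; (suc i) → rest {f = F (suc i)} e₂ e₁ (h₂ i) }
  fin F e₂ h₂ (inj₂ (e₁ , d)) = e₂ ∘ₑ e₁ , λ { zero → inj₂ d ; (suc i) → rest {f = F (suc i)} e₂ e₁ (h₂ i) }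

-- Low matrices

cls : ∀ {n m} → (Fin n → Fin m) → Fin m → Subset n
cls p c x = p x == c

Cons : ∀ {n m} → Mat n → Subset n → (Fin n → Fin n) → (Fin n → Fin m) → Set
Cons S A p lab = ∀ x y x' y' → x ∈ A → y ∈ A → x' ∈ A → y' ∈ A →
  p x ≢ p y → p x' ≢ p y' → lab x ≡ lab x' → lab y ≡ lab y' → S x y ≡ S x' y'

-- A tree-model of depth d of S restricted to A: p names the part of a vertex, and an entry between
-- different parts only depends on the labels. Diagonal entries are irrelevant.
TM : (ℓ d : ℕ) → ∀ {n} → Mat n → Subset n → Set
TM ℓ zero    S A = ∀ x y → x ∈ A → y ∈ A → x ≡ y
TM ℓ (suc d) {n} S A = Σ (Fin n → Fin n) λ p → Σ (Fin n → Fin (2 ^ ℓ)) λ lab →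
  Cons S A p lab × (∀ c → TM ℓ d S (A ∩ cls p c))

TM-iso : ∀ ℓ d {n} {S S' : Mat n} {A B : Subset n} (f : Fin n → Fin n) → (∀ x → x ∈ B → f x ∈ A) →
  (∀ x y → x ∈ B → y ∈ B → f x ≡ f y → x ≡ y) → (∀ x y → x ∈ B → y ∈ B → x ≢ y → S (f x) (f y) ≡ S' x y) →
  TM ℓ d S A → TM ℓ d S' B
TM-iso ℓ zero f m i s t x y a b = i x y a b (t (f x) (f y) (m x a) (m y b))
TM-iso ℓ (suc d) {S = S} {S'} {A} {B} f m i s (p , lab , co , ch) =
  p ∘ f , lab ∘ f ,
  (λ x y x' y' a b a' b' q q' l l' →
    trans (sym (s x y a b (λ e → q (cong (p ∘ f) e))))
      (trans (co (f x) (f y) (f x') (f y') (m x a) (m y b) (m x' a') (m y' b') q q' l l')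
        (s x' y' a' b' (λ e → q' (cong (p ∘ f) e))))) ,
  λ c → TM-iso ℓ d f (λ x h → ∧-i (m x (∧-l h)) (∧-r {B x} h)) (λ x y a b → i x y (∧-l a) (∧-l b))
    (λ x y a b → s x y (∧-l a) (∧-l b)) (ch c)

TM-⊆ : ∀ ℓ d {n} {S : Mat n} {A B : Subset n} → (∀ x → x ∈ B → x ∈ A) → TM ℓ d S A → TM ℓ d S B
TM-⊆ ℓ d h = TM-iso ℓ d id h (λ x y a b e → e) (λ x y a b e → refl)

z2 : ∀ ℓ → Fin (2 ^ ℓ)
z2 zero    = zero
z2 (suc ℓ) = combine {2} zero (z2 ℓ)

TM-suc : ∀ ℓ d {n} {S : Mat n} {A : Subset n} → TM ℓ d S A → TM ℓ (suc d) S A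
TM-suc ℓ d t = zeroOf , (λ _ → z2 ℓ) , (λ x y _ _ _ _ _ _ q → ⊥-elim (q (zeroOf-const x y))) ,
  λ c → TM-⊆ ℓ d (λ x → ∧-l) t

TM-small : ∀ ℓ d {n} {S : Mat n} {A : Subset n} → TM ℓ 0 S A → TM ℓ d S A
TM-small ℓ zero    t = t
TM-small ℓ (suc d) t = TM-suc ℓ d (TM-small ℓ d t)

bitF : Bool → Fin 2
bitF false = zero
bitF true  = suc zero

bitF-inj : ∀ {a b} → bitF a ≡ bitF b → a ≡ b
bitF-inj {true}  {true}  h = refl
bitF-inj {false} {false} h = refl

-- At every level the two bits of a vertex are added to its label, and the labels then determine the
-- correction `g`.
TM-flip : ∀ ℓ d {n} {S S' : Mat n} {A : Subset n} (b₁ b₂ : Fin n → Bool) (g : Bool → Bool → Bool → Bool → Bool) →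
  (∀ x y → x ∈ A → y ∈ A → x ≢ y → S' x y ≡ S x y xor g (b₁ x) (b₂ x) (b₁ y) (b₂ y)) →
  TM ℓ d S A → TM (2 + ℓ) d S' A
TM-flip ℓ zero b₁ b₂ g h t = t
TM-flip ℓ (suc d) {n} {S} {S'} {A} b₁ b₂ g h (p , lab , co , ch) = p , lab' , co' ,
  λ c → TM-flip ℓ d b₁ b₂ g (λ x y a b → h x y (∧-l a) (∧-l b)) (ch c)
  where
  lab' : Fin n → Fin (2 ^ (2 + ℓ))
  lab' x = combine (bitF (b₁ x)) (combine (bitF (b₂ x)) (lab x))
  un : ∀ x x' → lab' x ≡ lab' x' → b₁ x ≡ b₁ x' × b₂ x ≡ b₂ x' × lab x ≡ lab x'
  un x x' e =
    let (e₁ , e₂) = FP.combine-injective (bitF (b₁ x)) (combine (bitF (b₂ x)) (lab x)) (bitF (b₁ x')) (combine (bitF (b₂ x')) (lab x')) e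
        (e₃ , e₄) = FP.combine-injective (bitF (b₂ x)) (lab x) (bitF (b₂ x')) (lab x') e₂
    in bitF-inj e₁ , bitF-inj e₃ , e₄
  co' : Cons S' A p lab'
  co' x y x' y' a b a' b' q q' l l' with un x x' l | un y y' l'
  ... | (u₁ , u₂ , u₃) | (v₁ , v₂ , v₃) =
    trans (h x y a b (λ e → q (cong p e)))
      (trans (cong₂ _xor_ (co x y x' y' a b a' b' q q' u₃ v₃) (trans (cong₂ (λ s t → g s t (b₁ y) (b₂ y)) u₁ u₂) (cong₂ (g (b₁ x') (b₂ x')) v₁ v₂)))
        (sym (h x' y' a' b' (λ e → q' (cong p e)))))

-- A new top level separates `v` from the rest, with `S x v` as label. The second additional bit is
-- padding, so that the price in label bits is the same as for `TM-flip`.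
TM-vertex : ∀ ℓ d {n} {S : Mat n} {A : Subset n} → Sym S → ∀ v → TM ℓ d S (A ⊝ v) → TM (2 + ℓ) (suc d) S A
TM-vertex ℓ d {n} {S} {A} sy v t with ∃? (A ⊝ v)
... | inj₂ e = TM-small (2 + ℓ) (suc d) (λ x y a b → trans (eq x a) (sym (eq y b)))
  where
  eq : ∀ x → x ∈ A → x ≡ v
  eq x a with bool (x == v)
  ... | inj₁ h = ==-yes h
  ... | inj₂ h = tf (⊝-i {A = A} a (==-no h)) (e x)
... | inj₁ (w , hw) = p , lab , co , ch
  where
  w≢v = ⊝-r {A = A} hw
  p : Fin n → Fin n
  p x = if x == v then v else w
  pv : ∀ x → x ≡ v → p x ≡ v
  pv x refl rewrite ==-refl x = refl
  pw : ∀ x → x ≢ v → p x ≡ w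
  pw x q rewrite ==-f q = refl
  lab : Fin n → Fin (2 ^ (2 + ℓ))
  lab x = combine (bitF (S x v)) (combine {2} zero (z2 ℓ))
  un : ∀ x x' → lab x ≡ lab x' → S x v ≡ S x' v
  un x x' e = bitF-inj (proj₁ (FP.combine-injective (bitF (S x v)) _ (bitF (S x' v)) _ e))
  sort : ∀ x y → p x ≢ p y → (x ≡ v × y ≢ v) ⊎ (x ≢ v × y ≡ v)
  sort x y q with bool (x == v) | bool (y == v)
  ... | inj₁ e | inj₁ e' = ⊥-elim (q (trans (pv x (==-yes e)) (sym (pv y (==-yes e')))))
  ... | inj₁ e | inj₂ e' = inj₁ (==-yes e , ==-no e')
  ... | inj₂ e | inj₁ e' = inj₂ (==-no e , ==-yes e')
  ... | inj₂ e | inj₂ e' = ⊥-elim (q (trans (pw x (==-no e)) (sym (pw y (==-no e')))))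
  co : Cons S A p lab
  co x y x' y' a b a' b' q q' l l' with sort x y q | sort x' y' q'
  ... | inj₁ (refl , _) | inj₁ (refl , _) = trans (sy x y) (trans (un y y' l') (sy y' x))
  ... | inj₂ (_ , refl) | inj₂ (_ , refl) = un x x' l
  -- Here `v` stands on opposite sides of the two entries. Both are equal to the diagonal entry of
  -- `v`, because the label of `v` records it.
  ... | inj₁ (refl , _) | inj₂ (_ , refl) = trans (sy x y) (trans (un y x l') (un x x' l))
  ... | inj₂ (_ , refl) | inj₁ (refl , _) = trans (un x y l) (trans (un y y' l') (sy y' y))
  ch : ∀ c → TM (2 + ℓ) d S (A ∩ cls p c)
  ch c with c FP.≟ v
  ... | yes refl = TM-small (2 + ℓ) d (λ x y a b → trans (eq x a) (sym (eq y b)))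
    where
    eq : ∀ x → x ∈ (A ∩ cls p c) → x ≡ c
    eq x a with bool (x == c)
    ... | inj₁ e = ==-yes e
    ... | inj₂ e = ⊥-elim (w≢v (trans (sym (pw x (==-no e))) (==-yes (∧-r {A x} a))))
  ... | no c≢v = TM-⊆ (2 + ℓ) d (λ x a → ⊝-i {A = A} (∧-l a) (λ e → c≢v (trans (sym (==-yes (∧-r {A x} a))) (pv x e))))
        (TM-flip ℓ d (λ _ → false) (λ _ → false) (λ _ _ _ _ → false) (λ x y _ _ _ → sym (BP.xor-identityʳ (S x y))) t)

TM-disjoint : ∀ ℓ d {n} {S : Mat n} {A : Subset n} (p : Fin n → Fin n) →
  (∀ x y → x ∈ A → y ∈ A → p x ≢ p y → S x y ≡ false) → (∀ c → TM ℓ d S (A ∩ cls p c)) → TM ℓ (suc d) S A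
TM-disjoint ℓ d p h ch = p , (λ _ → z2 ℓ) ,
  (λ x y x' y' a b a' b' q q' _ _ → trans (h x y a b q) (sym (h x' y' a' b' q'))) , ch

-- Deciding tree-models

vec-search : ∀ {k} m (P : Vec (Fin k) m → Set) → (∀ v → Dec (P v)) → Dec (Σ _ P)
vec-search zero P d = map′ (λ q → [] , q) (λ { ([] , q) → q }) (d [])
vec-search (suc m) P d =
  map′ (λ { (x , v , q) → (x ∷ v) , q }) (λ { ((x ∷ v) , q) → x , v , q })
    (FP.any? (λ x → vec-search m (λ v → P (x ∷ v)) (λ v → d (x ∷ v))))

Cons? : ∀ {n m} (S : Mat n) A p (lab : Fin n → Fin m) → Dec (Cons S A p lab)
Cons? S A p lab = FP.all? λ x → FP.all? λ y → FP.all? λ x' → FP.all? λ y' →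
  (A x BP.≟ true) →-dec (A y BP.≟ true) →-dec (A x' BP.≟ true) →-dec (A y' BP.≟ true) →-dec
  ¬? (p x FP.≟ p y) →-dec ¬? (p x' FP.≟ p y') →-dec (lab x FP.≟ lab x') →-dec (lab y FP.≟ lab y') →-dec (S x y BP.≟ S x' y')

-- Partition and labelling are sought among vectors, which can be enumerated, and `back` tabulates
-- given functions. Decidability is what makes minimal high sets and high components available
-- constructively.
TM? : ∀ ℓ d {n} (S : Mat n) (A : Subset n) → Dec (TM ℓ d S A)
TM? ℓ zero S A = FP.all? λ x → FP.all? λ y → (A x BP.≟ true) →-dec (A y BP.≟ true) →-dec (x FP.≟ y)
TM? ℓ (suc d) {n} S A =
  map′ (λ { (v , w , co , ch) → lookup v , lookup w , co , ch }) back
    (vec-search n _ λ v → vec-search n _ λ w → Cons? S A (lookup v) (lookup w) ×-dec FP.all? (λ c → TM? ℓ d S (A ∩ cls (lookup v) c)))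
  where
  back : TM ℓ (suc d) S A → Σ (Vec (Fin n) n) λ v → Σ (Vec (Fin (2 ^ ℓ)) n) λ w →
    Cons S A (lookup v) (lookup w) × (∀ c → TM ℓ d S (A ∩ cls (lookup v) c))
  back (p , lab , co , ch) = tabulate p , tabulate lab ,
    (λ x y x' y' a b a' b' q q' l l' → co x y x' y' a b a' b'
      (λ e → q (trans (P x) (trans e (sym (P y))))) (λ e → q' (trans (P x') (trans e (sym (P y')))))
      (trans (sym (L x)) (trans l (L x'))) (trans (sym (L y)) (trans l' (L y')))) ,
    λ c → TM-⊆ ℓ d (λ x h → ∧-i (∧-l h) (==-t (trans (sym (P x)) (==-yes (∧-r {A x} h))))) (ch c)
    where
    P = VP.lookup∘tabulate p
    L = VP.lookup∘tabulate lab

-- Each part is renamed after one of its own vertices. Names outside the set are then free for new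
-- parts, as the pumping step requires.
TM-normal : ∀ ℓ d {n} {S : Mat n} {A : Subset n} → TM ℓ (suc d) S A →
  Σ (TM ℓ (suc d) S A) λ t → ∀ x → x ∈ A → proj₁ t x ∈ A
TM-normal ℓ d {n} {S} {A} (p , lab , co , ch) = (p' , lab ,
    (λ x y x' y' a b a' b' q q' → co x y x' y' a b a' b' (λ e → q (cong h e)) (λ e → q' (cong h e))) ,
    child) , λ x a → proj₁ (hp x a)
  where
  found : ∀ c → (Σ (Fin n) λ y → (A ∩ cls p c) y ≡ true) ⊎ (∀ y → (A ∩ cls p c) y ≡ false)
  found c = ∃? (A ∩ cls p c)
  pick : ∀ {c} → (Σ (Fin n) λ y → (A ∩ cls p c) y ≡ true) ⊎ (∀ y → (A ∩ cls p c) y ≡ false) → Fin n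
  pick (inj₁ (y , _)) = y
  pick {c} (inj₂ _) = c
  h : Fin n → Fin n
  h c = pick (found c)
  p' = h ∘ p
  hp : ∀ x → x ∈ A → (h (p x) ∈ A) × (p (h (p x)) ≡ p x)
  hp x a with found (p x)
  ... | inj₁ (y , q) = ∧-l q , ==-yes (∧-r {A y} q)
  ... | inj₂ q = tf (∧-i a (==-refl (p x))) (q x)
  child : ∀ c → TM ℓ d S (A ∩ cls p' c)
  child c = TM-⊆ ℓ d (λ x q → ∧-i (∧-l q)
      (==-t (trans (sym (proj₂ (hp x (∧-l q)))) (cong p (==-yes (∧-r {A x} q)))))) (ch (p c))

-- Compactness: a matrix without a tree-model has a submatrix of bounded size without one

-- Each of the two properties holds at one index at most, so one of three indices has neither.
avoid : ∀ {L} (P Q : Fin (3 + L) → Set) → (∀ j → Dec (P j)) → (∀ j → Dec (Q j)) →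
  (∀ j j' → j ≢ j' → P j → P j' → ⊥) → (∀ j j' → j ≢ j' → Q j → Q j' → ⊥) → Σ (Fin (3 + L)) λ j → ¬ P j × ¬ Q j
avoid {L} P Q P? Q? p q = go (P? a) (Q? a) (P? b) (Q? b) (P? c) (Q? c)
  where
  a b c : Fin (3 + L)
  a = zero
  b = suc zero
  c = suc (suc zero)
  go : Dec (P a) → Dec (Q a) → Dec (P b) → Dec (Q b) → Dec (P c) → Dec (Q c) → Σ (Fin (3 + L)) λ j → ¬ P j × ¬ Q j
  go (no x) (no y) _ _ _ _ = a , x , y
  go _ _ (no x) (no y) _ _ = b , x , y
  go _ _ _ _ (no x) (no y) = c , x , y
  go (yes x) _ (yes y) _ _ _ = ⊥-elim (p a b (λ ()) x y)
  go (yes x) _ _ _ (yes y) _ = ⊥-elim (p a c (λ ()) x y)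
  go _ _ (yes x) _ (yes y) _ = ⊥-elim (p b c (λ ()) x y)
  go _ (yes x) _ (yes y) _ _ = ⊥-elim (q a b (λ ()) x y)
  go _ (yes x) _ _ _ (yes y) = ⊥-elim (q a c (λ ()) x y)
  go _ _ _ (yes x) _ (yes y) = ⊥-elim (q b c (λ ()) x y)

-- The set A is B together with one further copy φ of the pairwise disjoint copies ψ j in B, all seen in the same way from outside.
record Copies {n k M : ℕ} (S : Mat n) (I : Subset k) (φ : Fin k → Fin n) (ψ : Fin M → Fin k → Fin n) (A B : Subset n) : Set where
  field
    B⊆A   : ∀ x → x ∈ B → x ∈ A
    cover : ∀ x → x ∈ A → x ∈ B ⊎ Σ (Fin k) λ i → i ∈ I × x ≡ φ i
    φ∉B   : ∀ i → i ∈ I → φ i ∉ B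
    φ-inj : ∀ i i' → i ∈ I → i' ∈ I → φ i ≡ φ i' → i ≡ i'
    ψ∈B   : ∀ j i → i ∈ I → ψ j i ∈ B
    ψ-inj : ∀ j i i' → i ∈ I → i' ∈ I → ψ j i ≡ ψ j i' → i ≡ i'
    disj  : ∀ j j' → j ≢ j' → ∀ i i' → i ∈ I → i' ∈ I → ψ j i ≢ ψ j' i'
    inner : ∀ j i i' → i ∈ I → i' ∈ I → i ≢ i' → S (ψ j i) (ψ j i') ≡ S (φ i) (φ i')
    outer : ∀ j i u → i ∈ I → u ∈ B → (∀ i' → i' ∈ I → u ≢ ψ j i') → S (ψ j i) u ≡ S (φ i) u

module PumpStep {ℓ k d M' n : ℕ} {S : Mat n} (sy : Sym S) {I : Subset k} {φ : Fin k → Fin n}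
  {ψ : Fin (3 + M' + suc k) → Fin k → Fin n} {A B : Subset n} (C : Copies S I φ ψ A B)
  (p : Fin n → Fin n) (lab : Fin n → Fin (2 ^ ℓ)) (co : Cons S B p lab) (ch : ∀ c → TM ℓ d S (B ∩ cls p c))
  (nrm : ∀ x → x ∈ B → p x ∈ B)
  (lc : ∀ i → Const (λ j → lab (ψ j i))) (pc : ∀ i → Const (λ j → p (ψ j i)) ⊎ Inj (λ j → p (ψ j i)))
  (IH : ∀ {I : Subset k} {φ : Fin k → Fin n} {ψ : Fin M' → Fin k → Fin n} {A B : Subset n} →
    Copies S I φ ψ A B → TM ℓ d S B → TM ℓ d S A) where
  open Copies C
  L = 3 + M' + suc k

  -- A slot `i` is stationary (`true`) if its copies all lie in one part, and moving (`false`) if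
  -- their parts are pairwise distinct.
  kd : ∀ {f : Fin L → Fin n} → Const f ⊎ Inj f → Bool
  kd (inj₁ _) = true
  kd (inj₂ _) = false
  kind : Subset k
  kind i = kd (pc i)
  kind-t : ∀ i → kind i ≡ true → Const (λ j → p (ψ j i))
  kind-t i h with pc i
  kind-t i h  | inj₁ c = c
  kind-t i () | inj₂ _
  kind-f : ∀ i → kind i ≡ false → Inj (λ j → p (ψ j i))
  kind-f i h  with pc i
  kind-f i () | inj₁ _
  kind-f i h  | inj₂ c = c

  j₀ : Fin L
  j₀ = zero
  P : Fin k → Fin n
  P i = p (ψ j₀ i)
  -- The moving slots of the new copy are put into fresh parts, grouped as in the copy `j₀`. A fresh
  -- part is named after one of its vertices `φ r`, which lies outside `B` and hence is not the name
  -- of an old part.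
  rep : ∀ c → (Σ (Fin k) λ i → (I i ∧ not (kind i) ∧ (P i == c)) ≡ true) ⊎ (∀ i → (I i ∧ not (kind i) ∧ (P i == c)) ≡ false)
  rep c = ∃? _
  nm' : ∀ {c} → (Σ (Fin k) λ i → (I i ∧ not (kind i) ∧ (P i == c)) ≡ true) ⊎ (∀ i → (I i ∧ not (kind i) ∧ (P i == c)) ≡ false) → Fin n
  nm' (inj₁ (i , _)) = φ i
  nm' {c} (inj₂ _) = c
  nm : Fin n → Fin n
  nm c = nm' (rep c)
  nm-ok : ∀ i → i ∈ I → kind i ≡ false → Σ (Fin k) λ r → r ∈ I × (kind r ≡ false) × (P r ≡ P i) × (nm (P i) ≡ φ r)
  nm-ok i a f with rep (P i)
  ... | inj₁ (r , h) = r , ∧-l h , not-e (∧-l (∧-r {I r} h)) , ==-yes (∧-r {not (kind r)} (∧-r {I r} h)) , refl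
  ... | inj₂ h = tf (∧-i a (∧-i (not-i f) (==-refl (P i)))) (h i)
  nm-inj : ∀ i i' → i ∈ I → i' ∈ I → kind i ≡ false → kind i' ≡ false → nm (P i) ≡ nm (P i') → P i ≡ P i'
  nm-inj i i' a a' f f' e with nm-ok i a f | nm-ok i' a' f'
  ... | (r , ra , _ , q , v) | (r' , ra' , _ , q' , v') with φ-inj r r' ra ra' (trans (sym v) (trans e v'))
  ...   | refl = trans (sym q) q'

  pn : Fin k → Fin n
  pn i = if kind i then P i else nm (P i)
  pn-c : ∀ i → kind i ≡ true → pn i ≡ P i
  pn-c i h rewrite h = refl
  pn-f : ∀ i → kind i ≡ false → pn i ≡ nm (P i)
  pn-f i h rewrite h = refl
  pn-f∉ : ∀ i → i ∈ I → kind i ≡ false → pn i ∉ B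
  pn-f∉ i a h with nm-ok i a h
  ... | (r , ra , _ , _ , v) = trans (cong B (trans (pn-f i h) v)) (φ∉B r ra)

  Pick : Fin n → Set
  Pick x = (x ∈ B) ⊎ ((Σ (Fin k) λ i → i ∈ I × x ≡ φ i) ⊎ (x ∉ B × ∀ i → (I i ∧ (x == φ i)) ≡ false))
  pick : ∀ x → Pick x
  pick x with bool (B x) | ∃? (λ i → I i ∧ (x == φ i))
  ... | inj₁ b | _ = inj₁ b
  ... | inj₂ _ | inj₁ (i , h) = inj₂ (inj₁ (i , ∧-l h , ==-yes (∧-r {I i} h)))
  ... | inj₂ b | inj₂ h = inj₂ (inj₂ (b , h))
  p₁ : ∀ {x} → Pick x → Fin n
  p₁ {x} (inj₁ _) = p x
  p₁ (inj₂ (inj₁ (i , _))) = pn i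
  p₁ {x} (inj₂ (inj₂ _)) = x
  lab₁ : ∀ {x} → Pick x → Fin (2 ^ ℓ)
  lab₁ (inj₂ (inj₁ (i , _))) = lab (ψ j₀ i)
  lab₁ {x} _ = lab x
  f₁ : ∀ {x} → Pick x → Fin n
  f₁ (inj₂ (inj₁ (i , _))) = ψ j₀ i
  f₁ {x} _ = x
  p' : Fin n → Fin n
  p' x = p₁ (pick x)
  lab' : Fin n → Fin (2 ^ ℓ)
  lab' x = lab₁ (pick x)
  f' : Fin n → Fin n
  f' x = f₁ (pick x)

  InB : Fin n → Set
  InB x = x ∈ B × p' x ≡ p x × lab' x ≡ lab x
  Inφ : Fin n → Set
  Inφ x = Σ (Fin k) λ i → i ∈ I × x ≡ φ i × p' x ≡ pn i × lab' x ≡ lab (ψ j₀ i) × f' x ≡ ψ j₀ i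
  view : ∀ x → x ∈ A → InB x ⊎ Inφ x
  view x a with pick x
  ... | inj₁ b = inj₁ (b , refl , refl)
  ... | inj₂ (inj₁ (i , h , e)) = inj₂ (i , h , e , refl , refl , refl)
  ... | inj₂ (inj₂ (b , h)) with cover x a
  ...   | inj₁ b' = tf b' b
  ...   | inj₂ (i , h' , e) = tf (∧-i h' (==-t e)) (h i)

  -- Every pair that the new model separates imitates a separated pair of `B` with the same labels
  -- and the same entry. This reduces consistency of the new model to `co`.
  Sim : Fin n → Fin n → Set
  Sim x y = Σ (Fin n) λ x* → Σ (Fin n) λ y* → x* ∈ B × y* ∈ B × p x* ≢ p y* × lab x* ≡ lab' x × lab y* ≡ lab' y × S x* y* ≡ S x y

  -- The imitating copy must not contain `y`, and its slot `i` must not lie in the part of `y`. The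
  -- first fails for one copy at most since the copies are disjoint; the second fails for one copy
  -- at most if `i` is moving, and for none if `i` is stationary.
  sim-φB : ∀ x y → Inφ x → InB y → p' x ≢ p' y → Sim x y
  sim-φB x y (i , a , refl , px , lx , _) (b , py , ly) q with avoid {M' + suc k} P? Q? dP dQ oP oQ
    where
    P? Q? : Fin L → Set
    P? j = ∃ λ i' → (i' ∈ I) × (y ≡ ψ j i')
    Q? j = p (ψ j i) ≡ p y
    dP : ∀ j → Dec (P? j)
    dP j = FP.any? (λ i' → (I i' BP.≟ true) ×-dec (y FP.≟ ψ j i'))
    dQ : ∀ j → Dec (Q? j)
    dQ j = p (ψ j i) FP.≟ p y
    oP : ∀ j j' → j ≢ j' → P? j → P? j' → ⊥
    oP j j' ne (i₁ , a₁ , e₁) (i₂ , a₂ , e₂) = disj j j' ne i₁ i₂ a₁ a₂ (trans (sym e₁) e₂)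
    oQ : ∀ j j' → j ≢ j' → Q? j → Q? j' → ⊥
    oQ j j' ne e₁ e₂ with bool (kind i)
    ... | inj₁ t = q (trans px (trans (pn-c i t) (trans (kind-t i t j₀ j) (trans e₁ (sym py)))))
    ... | inj₂ f = kind-f i f j j' ne (trans e₁ (sym e₂))
  ... | (j , nP , nQ) = ψ j i , y , ψ∈B j i a , b , nQ , trans (lc i j j₀) (sym lx) , sym ly ,
        outer j i y a b (λ i' a' e → nP (i' , a' , e))

  sim-sym : ∀ x y → Sim x y → Sim y x
  sim-sym x y (x* , y* , a , b , q , l , l' , s) = y* , x* , b , a , (λ e → q (sym e)) , l' , l , trans (sy y* x*) (trans s (sy x y))

  sim-φφ : ∀ x y → Inφ x → Inφ y → p' x ≢ p' y → Sim x y
  sim-φφ x y (i , a , refl , px , lx , _) (i' , a' , refl , py , ly , _) q =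
    let (j , h) = sep in ψ j i , ψ j i' , ψ∈B j i a , ψ∈B j i' a' , h , trans (lc i j j₀) (sym lx) , trans (lc i' j j₀) (sym ly) ,
      inner j i i' a a' (λ { refl → h refl })
    where
    pq : pn i ≢ pn i'
    pq e = q (trans px (trans e (sym py)))
    mix : ∀ i i' → kind i ≡ true → kind i' ≡ false → Σ (Fin L) λ j → p (ψ j i) ≢ p (ψ j i')
    mix i i' t f with avoid {M' + suc k} (λ j → p (ψ j₀ i) ≡ p (ψ j i')) (λ _ → ⊥) (λ j → p (ψ j₀ i) FP.≟ p (ψ j i')) (λ _ → no id)
      (λ j j' ne e₁ e₂ → kind-f i' f j j' ne (trans (sym e₁) e₂)) (λ _ _ _ ())
    ... | (j , h , _) = j , λ e → h (trans (kind-t i t j₀ j) e)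
    sep : Σ (Fin L) λ j → p (ψ j i) ≢ p (ψ j i')
    sep with bool (kind i) | bool (kind i')
    ... | inj₁ t | inj₁ t' = j₀ , λ e → pq (trans (pn-c i t) (trans e (sym (pn-c i' t'))))
    ... | inj₁ t | inj₂ f' = mix i i' t f'
    ... | inj₂ f | inj₁ t' = let (j , h) = mix i' i t' f in j , λ e → h (sym e)
    ... | inj₂ f | inj₂ f' = j₀ , λ e → pq (trans (pn-f i f) (trans (cong nm e) (sym (pn-f i' f'))))

  sim : ∀ x y → x ∈ A → y ∈ A → p' x ≢ p' y → Sim x y
  sim x y a b q with view x a | view y b
  ... | inj₁ (a' , px , lx) | inj₁ (b' , py , ly) =
    x , y , a' , b' , (λ e → q (trans px (trans e (sym py)))) , sym lx , sym ly , refl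
  ... | inj₂ u | inj₁ v = sim-φB x y u v q
  ... | inj₁ u | inj₂ v = sim-sym y x (sim-φB y x v u (λ e → q (sym e)))
  ... | inj₂ u | inj₂ v = sim-φφ x y u v q

  co' : Cons S A p' lab'
  co' x y x' y' a b a' b' q q' l l' with sim x y a b q | sim x' y' a' b' q'
  ... | (u , v , ua , va , d₁ , lu , lv , s) | (u' , v' , ua' , va' , d₁' , lu' , lv' , s') =
    trans (sym s) (trans (co u v u' v' ua va ua' va' d₁ d₁' (trans lu (trans l (sym lu'))) (trans lv (trans l' (sym lv')))) s')

  -- A fresh part consists of moving slots only, and `f'` maps it isomorphically into the part of
  -- `B` where these slots lie in the copy `j₀`.
  fresh : ∀ c → c ∉ B → TM ℓ d S (A ∩ cls p' c)
  fresh c c∉ with rep' | rest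
    where
    E : Subset k
    E i = I i ∧ (not (kind i) ∧ (nm (P i) == c))
    rep' = ∃? E
    rest : ∀ x → x ∈ (A ∩ cls p' c) → Σ (Fin k) λ i → i ∈ I × x ≡ φ i × kind i ≡ false × nm (P i) ≡ c × f' x ≡ ψ j₀ i
    rest x h with view x (∧-l h)
    ... | inj₁ (b , px , _) = tf (nrm x b) (trans (cong B (trans (sym px) (==-yes (∧-r {A x} h)))) c∉)
    ... | inj₂ (i , a , e , px , _ , fx) with bool (kind i)
    ...   | inj₁ t = tf (nrm _ (ψ∈B j₀ i a)) (trans (cong B (trans (sym (trans px (pn-c i t))) (==-yes (∧-r {A x} h)))) c∉)
    ...   | inj₂ f = i , a , e , f , trans (sym (trans px (pn-f i f))) (==-yes (∧-r {A x} h)) , fx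
  ... | inj₂ none | rest = TM-small ℓ d (λ x y a _ → let (i , a' , _ , f , e , _) = rest x a in
          tf (∧-i a' (∧-i (not-i f) (==-t e))) (none i))
  ... | inj₁ (i₁ , h₁) | rest = TM-iso ℓ d f' mem inj same (ch (P i₁))
    where
    a₁ = ∧-l {I i₁} h₁
    k₁ = not-e (∧-l {not (kind i₁)} (∧-r {I i₁} h₁))
    e₁ = ==-yes (∧-r {not (kind i₁)} (∧-r {I i₁} h₁))
    mem : ∀ x → x ∈ (A ∩ cls p' c) → f' x ∈ (B ∩ cls p (P i₁))
    mem x h with rest x h
    ... | (i , a , e , f , nc , fx) = trans (cong (B ∩ cls p (P i₁)) fx)
          (∧-i (ψ∈B j₀ i a) (==-t (nm-inj i i₁ a a₁ f k₁ (trans nc (sym e₁)))))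
    inj : ∀ x y → x ∈ (A ∩ cls p' c) → y ∈ (A ∩ cls p' c) → f' x ≡ f' y → x ≡ y
    inj x y h h' q with rest x h | rest y h'
    ... | (i , a , e , _ , _ , fx) | (i' , a' , e' , _ , _ , fy) =
      trans e (trans (cong φ (ψ-inj j₀ i i' a a' (trans (sym fx) (trans q fy)))) (sym e'))
    same : ∀ x y → x ∈ (A ∩ cls p' c) → y ∈ (A ∩ cls p' c) → x ≢ y → S (f' x) (f' y) ≡ S x y
    same x y h h' q with rest x h | rest y h'
    ... | (i , a , e , _ , _ , fx) | (i' , a' , e' , _ , _ , fy) =
      trans (cong₂ S fx fy) (trans (inner j₀ i i' a a' (λ { refl → q (trans e (sym e')) })) (cong₂ S (sym e) (sym e')))

  -- An old part gains its stationary slots, to which the induction hypothesis applies with the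
  -- copies cut down to that part.
  old : ∀ c → c ∈ B → TM ℓ d S (A ∩ cls p' c)
  old c c∈ = IH record
      { B⊆A = λ x h → let b = ∧-l h in ∧-i (B⊆A x b) (==-t (trans (pB x b) (==-yes (∧-r {B x} h))))
      ; cover = cov
      ; φ∉B = λ i h → ≢true (λ t → tf (∧-l t) (φ∉B i (∧-l h)))
      ; φ-inj = λ i i' a a' → φ-inj i i' (∧-l a) (∧-l a')
      ; ψ∈B = λ j i h → ∧-i (ψ∈B _ i (∧-l h)) (==-t (trans (kind-t i (∧-l (∧-r {I i} h)) _ j₀) (==-yes (∧-r {kind i} (∧-r {I i} h)))))
      ; ψ-inj = λ j i i' a a' → ψ-inj _ i i' (∧-l a) (∧-l a')
      ; disj = λ j j' ne i i' a a' → disj _ _ (at-inj e ne) i i' (∧-l a) (∧-l a')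
      ; inner = λ j i i' a a' → inner _ i i' (∧-l a) (∧-l a')
      ; outer = λ j i u a b g → outer _ i u (∧-l a) (∧-l b) (out j u b g)
      } (ch c)
    where
    J : Subset k
    J i = I i ∧ (kind i ∧ (P i == c))
    -- A moving slot of a copy inside the part `c` would be excluded from the restricted copy
    -- without being covered by `outer`. Each moving slot spoils one copy at most, so `suc k`
    -- spoiled copies would collide.
    Bad : Fin k → Fin L → Bool
    Bad i j = (I i ∧ not (kind i)) ∧ (p (ψ j i) == c)
    good : Σ ((3 + M') ↪ L) λ e → ∀ j → ∀ i → Bad i (at e j) ≡ false
    good with split (3 + M') (suc k) (λ j → does (FP.all? (λ i → Bad i j BP.≟ false)))
    ... | inj₁ (e , h) = e , λ j i → does-yes (FP.all? (λ i → Bad i (at e j) BP.≟ false)) (h j) i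
    ... | inj₂ (e , h) = ⊥-elim (clash (FP.pigeonhole (NP.n<1+n k) w))
      where
      wit : ∀ j → Σ (Fin k) λ i → Bad i (at e j) ≡ true
      wit j with ∃? (λ i → Bad i (at e j))
      ... | inj₁ q = q
      ... | inj₂ q = ⊥-elim (does-no (FP.all? (λ i → Bad i (at e j) BP.≟ false)) (h j) q)
      w : Fin (suc k) → Fin k
      w j = proj₁ (wit j)
      clash : (∃ λ i → ∃ λ j → i Fin.< j × w i ≡ w j) → ⊥
      clash (i , j , i<j , eq) with wit i | wit j
      ... | (r , h₁) | (r' , h₂) with eq
      ...   | refl = kind-f r (not-e (∧-r {I r} (∧-l {I r ∧ not (kind r)} h₁))) (at e i) (at e j) (at-inj e (λ { refl → NP.<-irrefl refl i<j }))
                (trans (==-yes (∧-r {I r ∧ not (kind r)} h₁)) (sym (==-yes (∧-r {I r ∧ not (kind r)} h₂))))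
    -- The three surplus copies come from the shape of `L`, which is dictated by `avoid`.
    e : M' ↪ L
    e = proj₁ good ∘ₑ sucₑ (sucₑ (sucₑ idₑ))
    nb : ∀ j i → Bad i (at e j) ≡ false
    nb j = proj₂ good (suc (suc (suc j)))
    pB : ∀ x → x ∈ B → p' x ≡ p x
    pB x b with view x (B⊆A x b)
    ... | inj₁ (_ , q , _) = q
    ... | inj₂ (i , a , refl , _) = tf b (φ∉B i a)
    cov : ∀ x → x ∈ (A ∩ cls p' c) → x ∈ (B ∩ cls p c) ⊎ Σ (Fin k) λ i → i ∈ J × x ≡ φ i
    cov x h with view x (∧-l h)
    ... | inj₁ (b , q , _) = inj₁ (∧-i b (==-t (trans (sym q) (==-yes (∧-r {A x} h)))))
    ... | inj₂ (i , a , e , px , _) with bool (kind i)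
    ...   | inj₁ t = inj₂ (i , ∧-i a (∧-i t (==-t (trans (sym (trans px (pn-c i t))) (==-yes (∧-r {A x} h))))) , e)
    ...   | inj₂ f = tf c∈ (trans (cong B (sym (trans (sym px) (==-yes (∧-r {A x} h))))) (pn-f∉ i a f))
    out : ∀ j u → u ∈ (B ∩ cls p c) → (∀ i' → i' ∈ J → u ≢ ψ (at e j) i') → ∀ i' → i' ∈ I → u ≢ ψ (at e j) i'
    out j u b g i' a' refl with bool (kind i')
    ... | inj₁ t = g i' (∧-i a' (∧-i t (==-t (trans (kind-t i' t j₀ (at e j)) (==-yes (∧-r {B u} b)))))) refl
    ... | inj₂ f = tf (∧-i (∧-i a' (not-i f)) (∧-r {B u} b)) (nb j i')

  step : TM ℓ (suc d) S A
  step = p' , lab' , co' , λ c → child c (bool (B c))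
    where
    child : ∀ c → (c ∈ B) ⊎ (c ∉ B) → TM ℓ d S (A ∩ cls p' c)
    child c (inj₁ h) = old c h
    child c (inj₂ h) = fresh c h

copies-sub : ∀ {n k M N} {S : Mat n} {I : Subset k} {φ} {ψ : Fin N → Fin k → Fin n} {A B} (e : M ↪ N) →
  Copies S I φ ψ A B → Copies S I φ (ψ ∘ at e) A B
copies-sub e C = record { B⊆A = B⊆A ; cover = cover ; φ∉B = φ∉B ; φ-inj = φ-inj ; ψ∈B = λ j → ψ∈B _ ; ψ-inj = λ j → ψ-inj _
  ; disj = λ j j' ne → disj _ _ (at-inj e ne) ; inner = λ j → inner _ ; outer = λ j → outer _ }
  where open Copies C

-- Thinning the copies makes the part of each slot constant or injective and its label constant. Of
-- the copies that remain, `M'` are for the level below, `suc k` allow for those spoiled by moving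
-- slots, and three are for `avoid`.
pump : ∀ ℓ k d → Σ ℕ λ M → ∀ {n} {S : Mat n} → Sym S → ∀ {I : Subset k} {φ} {ψ : Fin M → Fin k → Fin n} {A B} →
  Copies S I φ ψ A B → TM ℓ d S B → TM ℓ d S A
-- A model of depth 0 has at most one vertex, so two disjoint copies force `I` to be empty.
pump ℓ k zero = 2 , λ {n} {S} sy {I} {φ} {ψ} C t → base C t
  where
  base : ∀ {n} {S : Mat n} {I : Subset k} {φ} {ψ : Fin 2 → Fin k → Fin n} {A B} → Copies S I φ ψ A B → TM ℓ 0 S B → TM ℓ 0 S A
  base {I = I} {φ} {ψ} {A} {B} C t x y a b = t x y (in-B x a) (in-B y b)
    where
    open Copies C
    in-B : ∀ x → x ∈ A → x ∈ B
    in-B x a with cover x a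
    ... | inj₁ b = b
    ... | inj₂ (i , h , _) = ⊥-elim (disj zero (suc zero) (λ ()) i i h h (t _ _ (ψ∈B zero i h) (ψ∈B (suc zero) i h)))
pump ℓ k (suc d) =
  let (M' , IH) = pump ℓ k d ; (N₁ , q₁) = pigeons k (2 ^ ℓ) (3 + M' + suc k) ; (N₂ , q₂) = consts-or-injs k N₁ in
  N₂ , λ {n} {S} sy {I} {φ} {ψ} {A} {B} C t →
    let ((p , lab , co , ch) , nrm) = TM-normal ℓ d t
        (e₂ , h₂) = q₂ (λ i j → p (ψ j i))
        (e₁ , h₁) = q₁ (λ i j → lab (ψ (at e₂ j) i))
        weak : ∀ i → Const (λ j → p (ψ (at e₂ j) i)) ⊎ Inj (λ j → p (ψ (at e₂ j) i)) →
          Const (λ j → p (ψ (at e₂ (at e₁ j)) i)) ⊎ Inj (λ j → p (ψ (at e₂ (at e₁ j)) i))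
        weak i = λ { (inj₁ c) → inj₁ (λ x y → c _ _) ; (inj₂ c) → inj₂ (λ x y ne → c _ _ (at-inj e₁ ne)) }
    in PumpStep.step {ℓ} {k} {d} {M'} sy (copies-sub e₁ (copies-sub e₂ C)) p lab co ch nrm h₁ (λ i → weak i (h₂ i)) (λ {I} → IH sy)

-- An enumeration with gaps and repetitions, possibly listing vertices outside `Y`; `act` filters it
-- where exact copies are needed.
Cover : ∀ {n} → ℕ → Subset n → Set
Cover {n} s Y = Σ (Fin s → Maybe (Fin n)) λ c → ∀ y → y ∈ Y → Σ (Fin s) λ i → c i ≡ just y

least : ∀ {n} (f : Fin n → Bool) → (Σ (Fin n) λ i → f i ≡ true) → Σ (Fin n) λ i → f i ≡ true × (∀ j → j Fin.< i → f j ≡ false)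
least {suc n} f (i , h) with bool (f zero)
... | inj₁ t = zero , t , λ j ()
least {suc n} f (zero , h)  | inj₂ t = tf h t
least {suc n} f (suc i , h) | inj₂ t with least (f ∘ suc) (i , h)
... | (k , a , b) = suc k , a , λ { zero _ → t ; (suc j) (s≤s p) → b j p }

greedy : ∀ B {n} (p : Fin n → Fin n) (Y : Subset n) →
  (Σ (Fin B → Fin n) λ e → (∀ i → e i ∈ Y) × Inj (p ∘ e)) ⊎ (Σ (Fin B → Maybe (Fin n)) λ e → ∀ y → y ∈ Y → Σ (Fin B) λ i → e i ≡ just (p y))
greedy zero p Y = inj₁ ((λ ()) , (λ ()) , λ ())
greedy (suc B) {n} p Y with greedy B p Y
... | inj₂ (e , h) = inj₂ ((λ { zero → nothing ; (suc i) → e i }) , λ y a → let (i , q) = h y a in suc i , q)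
... | inj₁ (e , m , d) with FP.any? (λ y → (Y y BP.≟ true) ×-dec FP.all? (λ i → ¬? (p (e i) FP.≟ p y)))
...   | yes (y , a , g) = inj₁ ((λ { zero → y ; (suc i) → e i }) , (λ { zero → a ; (suc i) → m i }) , λ
        { zero zero q _ → q refl ; zero (suc j) _ r → g j (sym r) ; (suc i) zero _ r → g i r
        ; (suc i) (suc j) q → d i j (λ { refl → q refl }) })
...   | no none = inj₂ (e' , cov)
  where
  e' : Fin (suc B) → Maybe (Fin n)
  e' zero = nothing
  e' (suc i) = just (p (e i))
  cov : ∀ y → y ∈ Y → Σ (Fin (suc B)) λ i → e' i ≡ just (p y)
  cov y a with FP.any? (λ i → p (e i) FP.≟ p y)
  ... | yes (i , q) = suc i , cong just q
  ... | no q = ⊥-elim (none (y , a , λ i r → q (i , r)))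

module Prune (ℓ ℓ' d : ℕ) {n} {S : Mat n} (sy : Sym S) {Z : Subset n} (high : ¬ TM ℓ d S Z) (min : ∀ z → z ∈ Z → TM ℓ d S (Z ⊝ z))
  {τn e b M N : ℕ} {Y : Subset n} (Y⊆Z : ∀ y → y ∈ Y → y ∈ Z) (τ : Fin n → Fin τn)
  (τ-ok : ∀ y y' u → y ∈ Y → y' ∈ Y → u ∈ Z → u ∉ Y → τ y ≡ τ y' → S y u ≡ S y' u)
  (p : Fin n → Fin n) (lab : Fin n → Fin (2 ^ ℓ')) (co : Cons S Y p lab)
  (child : ∀ c → Cover b (Y ∩ cls p c))
  (pmp : ∀ {I : Subset b} {φ} {ψ : Fin M → Fin b → Fin n} {A B} → Copies S I φ ψ A B → TM ℓ d S B → TM ℓ d S A)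
  (r : Fin N → Fin n) (r∈ : ∀ j → r j ∈ Y) (r-inj : Inj (p ∘ r)) where

  c : Fin N → Fin n
  c j = p (r j)
  f : Fin N → Fin b → Maybe (Fin n)
  f j = proj₁ (child (c j))
  K : Fin N → Subset n
  K j = Y ∩ cls p (c j)

  first : Fin N → Fin b → Fin n → Set
  first j i x = ∀ i' → i' Fin.< i → f j i' ≢ just x
  first? : ∀ j i x → Dec (first j i x)
  first? j i x = FP.all? (λ i' → (i' FP.<? i) →-dec ¬? (MP.≡-dec FP._≟_ (f j i') (just x)))

  -- A slot is active if it lists a vertex of the child, and for the first time. The active slots
  -- thus enumerate the child bijectively.
  actM : Fin N → Fin b → Maybe (Fin n) → Bool
  actM j i nothing  = false
  actM j i (just x) = K j x ∧ does (first? j i x)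
  act : Fin N → Fin b → Bool
  act j i = actM j i (f j i)
  valM : Fin N → Maybe (Fin n) → Fin n
  valM j nothing  = r j
  valM j (just x) = x
  ψ : Fin N → Fin b → Fin n
  ψ j i = valM j (f j i)

  act-ok : ∀ j i → act j i ≡ true → f j i ≡ just (ψ j i) × ψ j i ∈ K j × first j i (ψ j i)
  act-ok j i = go (f j i)
    where
    go : ∀ m → actM j i m ≡ true → m ≡ just (valM j m) × valM j m ∈ K j × first j i (valM j m)
    go (just x) h = refl , ∧-l h , does-yes (first? j i x) (∧-r {K j x} h)

  act-inj : ∀ j i i' → act j i ≡ true → act j i' ≡ true → ψ j i ≡ ψ j i' → i ≡ i'
  act-inj j i i' a a' q with act-ok j i a | act-ok j i' a'
  ... | (e , _ , g) | (e' , _ , g') with NP.<-cmp (toℕ i) (toℕ i')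
  ...   | tri< l _ _ = ⊥-elim (g' i l (trans e (cong just q)))
  ...   | tri≈ _ t _ = FP.toℕ-injective t
  ...   | tri> _ _ l = ⊥-elim (g i' l (trans e' (cong just (sym q))))

  act-cov : ∀ j y → y ∈ K j → Σ (Fin b) λ i → act j i ≡ true × y ≡ ψ j i
  act-cov j y a with FP.any? {P = λ i → f j i ≡ just y × first j i y} (λ i → MP.≡-dec FP._≟_ (f j i) (just y) ×-dec first? j i y)
  ... | yes (i , q , g) = i , go (f j i) q , cong (valM j) (sym q)
    where
    go : ∀ m → m ≡ just y → actM j i m ≡ true
    go .(just y) refl = ∧-i a (does-y (first? j i y) g)
  ... | no none = ⊥-elim (none (let (i , q , g) = least (λ i → does (MP.≡-dec FP._≟_ (f j i) (just y))) start in
      i , does-yes (MP.≡-dec FP._≟_ (f j i) (just y)) q , λ i' l → does-no (MP.≡-dec FP._≟_ (f j i') (just y)) (g i' l)))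
    where
    start : Σ (Fin b) λ i → does (MP.≡-dec FP._≟_ (f j i) (just y)) ≡ true
    start = let (i , q) = proj₂ (child (c j)) y a in i , does-y (MP.≡-dec FP._≟_ (f j i) (just y)) q

  -- The child `j₀` is removed, which leaves a low set by the minimality of `Z`. It is pumped back
  -- from `M` children that agree with it in active slots, inner entries, types and labels; so `Z`
  -- would be low.
  contra : (g : suc M ↪ N) → (∀ i → Const (λ j → bitF (act (at g j) i))) →
    (∀ i i' → Const (λ j → bitF (S (ψ (at g j) i) (ψ (at g j) i')))) →
    (∀ i → Const (λ j → combine (τ (ψ (at g j) i)) (lab (ψ (at g j) i)))) → ⊥
  contra g ha hs hl = high (pmp {I = I} {φ} {λ j → ψ (j' j)} {Z} {B} cop (TM-⊆ ℓ d B⊆ (min (r j₀) (Y⊆Z _ (r∈ j₀)))))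
    where
    j₀ = at g zero
    j' : Fin M → Fin N
    j' j = at g (suc j)
    I : Subset b
    I = act j₀
    φ = ψ j₀
    im : ∀ x → Dec (Σ (Fin b) λ i → I i ≡ true × x ≡ φ i)
    im x = FP.any? (λ i → (I i BP.≟ true) ×-dec (x FP.≟ φ i))
    B : Subset n
    B x = Z x ∧ not (does (im x))
    act' : ∀ j i → I i ≡ true → act (j' j) i ≡ true
    act' j i h = trans (bitF-inj (ha i (suc j) zero)) h
    no-im : ∀ x → x ∈ B → ∀ i → I i ≡ true → x ≢ φ i
    no-im x h i a e = does-no (im x) (not-e (∧-r {Z x} h)) (i , a , e)
    B-i : ∀ x → x ∈ Z → (∀ i → I i ≡ true → x ≢ φ i) → x ∈ B
    B-i x z h with im x
    ... | yes (i , a , e) = ⊥-elim (h i a e)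
    ... | no _ = ∧-i z refl
    B⊆ : ∀ x → x ∈ B → x ∈ (Z ⊝ r j₀)
    B⊆ x h = let (i , a , q) = act-cov j₀ (r j₀) (∧-i (r∈ j₀) (==-refl (c j₀))) in
      ⊝-i {A = Z} (∧-l h) (λ e → no-im x h i a (trans e q))
    inK : ∀ j i → act j i ≡ true → ψ j i ∈ Y × p (ψ j i) ≡ c j
    inK j i a with act-ok j i a
    ... | (_ , k , _) = ∧-l k , ==-yes (∧-r {Y (ψ j i)} k)
    cc : ∀ {j k} → j ≢ k → c (at g j) ≢ c (at g k)
    cc ne = r-inj _ _ (at-inj g ne)
    apart : ∀ {j k} → j ≢ k → ∀ i i' → act (at g j) i ≡ true → act (at g k) i' ≡ true → ψ (at g j) i ≢ ψ (at g k) i'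
    apart ne i i' a a' e = cc ne (trans (sym (proj₂ (inK _ i a))) (trans (cong p e) (proj₂ (inK _ i' a'))))
    cop : Copies S I φ (λ j → ψ (j' j)) Z B
    cop = record
      { B⊆A = λ x → ∧-l
      ; cover = λ x z → cov x z (im x)
      ; φ∉B = λ i a → ≢true (λ h → no-im _ h i a refl)
      ; φ-inj = λ i i' → act-inj j₀ i i'
      ; ψ∈B = λ j i a → B-i _ (Y⊆Z _ (proj₁ (inK _ i (act' j i a)))) (λ i' a' → apart {suc j} {zero} (λ ()) i i' (act' j i a) a')
      ; ψ-inj = λ j i i' a a' → act-inj _ i i' (act' j i a) (act' j i' a')
      ; disj = λ j k ne i i' a a' → apart {suc j} {suc k} (λ { refl → ne refl }) i i' (act' j i a) (act' k i' a')
      ; inner = λ j i i' a a' ne → bitF-inj (hs i i' (suc j) zero)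
      ; outer = out }
      where
      cov : ∀ x → x ∈ Z → Dec (Σ (Fin b) λ i → I i ≡ true × x ≡ φ i) → x ∈ B ⊎ Σ (Fin b) λ i → I i ≡ true × x ≡ φ i
      cov x z (yes q) = inj₂ q
      cov x z (no q)  = inj₁ (B-i x z (λ i a e → q (i , a , e)))
      out : ∀ j i u → I i ≡ true → u ∈ B → (∀ i' → I i' ≡ true → u ≢ ψ (j' j) i') → S (ψ (j' j) i) u ≡ S (φ i) u
      out j i u a ub h with bool (Y u) | FP.combine-injective (τ (ψ (j' j) i)) (lab (ψ (j' j) i)) (τ (φ i)) (lab (φ i)) (hl i (suc j) zero)
      ... | inj₂ nu | (tq , lq) = τ-ok _ _ u (proj₁ (inK _ i (act' j i a))) (proj₁ (inK _ i a)) (∧-l ub) nu tq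
      ... | inj₁ uY | (tq , lq) = co _ _ _ _ (proj₁ (inK _ i (act' j i a))) uY (proj₁ (inK _ i a)) uY
              (λ e → other (j' j) (λ i' a' → h i' (trans (sym (bitF-inj (ha i' (suc j) zero))) a')) (trans (sym e) (proj₂ (inK _ i (act' j i a)))))
              (λ e → other j₀ (λ i' a' → no-im u ub i' a') (trans (sym e) (proj₂ (inK _ i a)))) lq refl
        where
        other : ∀ k → (∀ i' → act k i' ≡ true → u ≢ ψ k i') → p u ≢ c k
        other k g' e = let (i' , a' , q) = act-cov k u (∧-i uY (==-t e)) in g' i' a' q

-- With `N` parts, many of them would be isomorphic and of the same type, and pumping one of them
-- would contradict minimality. The type `τ` records how a vertex of `Y` sees the rest of `Z`; on
-- the way to a part it is refined by the label, which decides the view into the other parts.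
prune : ∀ ℓ ℓ' d e τn → Σ ℕ λ s → ∀ {n} {S : Mat n} → Sym S → ∀ {Z : Subset n} → ¬ TM ℓ d S Z → (∀ z → z ∈ Z → TM ℓ d S (Z ⊝ z)) →
  ∀ {Y : Subset n} → (∀ y → y ∈ Y → y ∈ Z) → (τ : Fin n → Fin τn) →
  (∀ y y' u → y ∈ Y → y' ∈ Y → u ∈ Z → u ∉ Y → τ y ≡ τ y' → S y u ≡ S y' u) → TM ℓ' e S Y → Cover s Y
prune ℓ ℓ' d zero τn = 1 , λ {n} {S} _ _ _ {Y} _ _ _ t → go {S = S} t (∃? Y)
  where
  go : ∀ {n} {S : Mat n} {Y : Subset n} → TM ℓ' 0 S Y → (Σ (Fin n) λ x → Y x ≡ true) ⊎ (∀ x → Y x ≡ false) → Cover 1 Y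
  go {S = S} t (inj₁ (x , a)) = (λ _ → just x) , λ y b → zero , cong just (t x y a b)
  go {S = S} t (inj₂ h) = (λ _ → nothing) , λ y b → tf b (h y)
prune ℓ ℓ' d (suc e) τn =
  let (b , IH) = prune ℓ ℓ' d e (τn * 2 ^ ℓ') ; (M , pmp) = pump ℓ b d
      (N₁ , q₁) = pigeons b 2 (suc M) ; (N₂ , q₂) = pigeons (b * b) 2 N₁ ; (N , q₃) = pigeons b (τn * 2 ^ ℓ') N₂ in
  N * b , λ {n} {S} sy {Z} high min {Y} Y⊆Z τ τ-ok (p , lab , co , ch) →
    let child : ∀ c → Cover b (Y ∩ cls p c)
        child c = IH sy high min (λ y h → Y⊆Z y (∧-l h)) (λ y → combine (τ y) (lab y))
          (λ y y' u a a' uz nu eq → let (tq , lq) = FP.combine-injective (τ y) (lab y) (τ y') (lab y') eq in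
            outside Y p c τ-ok co y y' u a a' uz nu tq lq) (ch c)
    in decide child (greedy N p Y) λ r r∈ r-inj →
      let open Prune ℓ ℓ' d sy high min {τn} {e} {b} {M} {N} Y⊆Z τ τ-ok p lab co child (pmp sy) r r∈ r-inj
          (g₃ , h₃) = q₃ (λ i j → combine (τ (ψ j i)) (lab (ψ j i)))
          (g₂ , h₂) = q₂ (λ k j → let (i , i') = remQuot b k in bitF (S (ψ (at g₃ j) i) (ψ (at g₃ j) i')))
          (g₁ , h₁) = q₁ (λ i j → bitF (act (at g₃ (at g₂ j)) i))
      in contra (g₃ ∘ₑ (g₂ ∘ₑ g₁)) h₁ (λ i i' x y → sq b S ψ g₃ g₂ g₁ h₂ i i' x y)
           (λ i x y → h₃ i (at g₂ (at g₁ x)) (at g₂ (at g₁ y)))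
  where
  outside : ∀ {n} {S : Mat n} {Z} Y (p : Fin n → Fin n) {lab : Fin n → Fin (2 ^ ℓ')} c {τ : Fin n → Fin τn} →
    (∀ y y' u → y ∈ Y → y' ∈ Y → u ∈ Z → u ∉ Y → τ y ≡ τ y' → S y u ≡ S y' u) → Cons S Y p lab →
    ∀ y y' u → y ∈ (Y ∩ cls p c) → y' ∈ (Y ∩ cls p c) → u ∈ Z → u ∉ (Y ∩ cls p c) → τ y ≡ τ y' → lab y ≡ lab y' → S y u ≡ S y' u
  outside Y p c τ-ok co y y' u a a' uz nu tq lq with bool (Y u)
  ... | inj₂ f = τ-ok y y' u (∧-l a) (∧-l a') uz f tq
  ... | inj₁ t = co y u y' u (∧-l a) t (∧-l a') t (ne y a) (ne y' a') lq refl
    where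
    ne : ∀ y → y ∈ (Y ∩ cls p c) → p y ≢ p u
    ne y a e = tf (∧-i t (==-t (trans (sym e) (==-yes (∧-r {Y y} a))))) nu
  decide : ∀ {n N b} {Y : Subset n} {p : Fin n → Fin n} → (∀ c → Cover b (Y ∩ cls p c)) →
    (Σ (Fin N → Fin n) λ e → (∀ i → e i ∈ Y) × Inj (p ∘ e)) ⊎ (Σ (Fin N → Maybe (Fin n)) λ e → ∀ y → y ∈ Y → Σ (Fin N) λ i → e i ≡ just (p y)) →
    (∀ r → (∀ i → r i ∈ Y) → Inj (p ∘ r) → ⊥) → Cover (N * b) Y
  decide child (inj₁ (r , a , i)) k = ⊥-elim (k r a i)
  decide {n} {N} {b} {Y} {p} child (inj₂ (e , h)) k = f , cov
    where
    g : Maybe (Fin n) → Fin b → Maybe (Fin n)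
    g nothing  j = nothing
    g (just c) j = proj₁ (child c) j
    f : Fin (N * b) → Maybe (Fin n)
    f k = g (e (proj₁ (remQuot {N} b k))) (proj₂ (remQuot {N} b k))
    cov : ∀ y → y ∈ Y → Σ (Fin (N * b)) λ k → f k ≡ just y
    cov y a with h y a
    ... | (i , q) with proj₂ (child (p y)) y (∧-i a (==-refl (p y)))
    ...   | (j , q') = combine i j ,
      trans (cong (λ z → g (e (proj₁ z)) (proj₂ z)) (FP.remQuot-combine {N} {b} i j)) (trans (cong (λ z → g z j) q) q')
  sq : ∀ {n N₁ N₂ N M} b (S : Mat n) (ψ : Fin N → Fin b → Fin n) (g₃ : N₂ ↪ N) (g₂ : N₁ ↪ N₂) (g₁ : M ↪ N₁) →
    (∀ k → Const (λ j → bitF (S (ψ (at g₃ (at g₂ j)) (proj₁ (remQuot {b} b k))) (ψ (at g₃ (at g₂ j)) (proj₂ (remQuot {b} b k)))))) →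
    ∀ i i' x y → bitF (S (ψ (at g₃ (at g₂ (at g₁ x))) i) (ψ (at g₃ (at g₂ (at g₁ x))) i')) ≡
      bitF (S (ψ (at g₃ (at g₂ (at g₁ y))) i) (ψ (at g₃ (at g₂ (at g₁ y))) i'))
  sq b S ψ g₃ g₂ g₁ h i i' x y = subst (λ z → F z (at g₁ x) ≡ F z (at g₁ y)) (FP.remQuot-combine {b} i i') (h (combine i i') (at g₁ x) (at g₁ y))
    where
    F : Fin b × Fin b → _ → Fin 2
    F z j = bitF (S (ψ (at g₃ (at g₂ j)) (proj₁ z)) (ψ (at g₃ (at g₂ j)) (proj₂ z)))

minimal : ∀ ℓ d {n} {S : Mat n} (A : Subset n) → ¬ TM ℓ d S A →
  Σ (Subset n) λ Z → (∀ x → x ∈ Z → x ∈ A) × ¬ TM ℓ d S Z × (∀ z → z ∈ Z → TM ℓ d S (Z ⊝ z))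
minimal ℓ d {n} {S} A h = go (card A) A NP.≤-refl h
  where
  go : ∀ k A → card A ≤ k → ¬ TM ℓ d S A →
    Σ (Subset n) λ Z → (∀ x → x ∈ Z → x ∈ A) × ¬ TM ℓ d S Z × (∀ z → z ∈ Z → TM ℓ d S (Z ⊝ z))
  step : ∀ k A → card A ≤ k → ¬ TM ℓ d S A → Dec (Σ (Fin n) λ z → z ∈ A × ¬ TM ℓ d S (A ⊝ z)) →
    Σ (Subset n) λ Z → (∀ x → x ∈ Z → x ∈ A) × ¬ TM ℓ d S Z × (∀ z → z ∈ Z → TM ℓ d S (Z ⊝ z))
  smaller : ∀ A z → z ∈ A → card (A ⊝ z) < card A
  smaller A z a = card-strict {A = A ⊝ z} {A} ∧-l z a (≢true (λ q → ⊝-r {A = A} q refl))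
  go k A p h = step k A p h (FP.any? (λ z → (A z BP.≟ true) ×-dec ¬? (TM? ℓ d S (A ⊝ z))))
  step k A p h (no q) = A , (λ x → id) , h , λ z a → dne (TM? ℓ d S (A ⊝ z)) (λ nt → q (z , a , nt))
    where
    dne : ∀ {X : Set} → Dec X → ¬ ¬ X → X
    dne (yes x) _ = x
    dne (no x) nx = ⊥-elim (nx x)
  step zero A p h (yes (z , a , nt)) = ⊥-elim (NP.n≮0 (NP.<-≤-trans (smaller A z a) p))
  step (suc k) A p h (yes (z , a , nt)) with go k (A ⊝ z) (NP.≤-pred (NP.<-≤-trans (smaller A z a) p)) nt
  ... | (Z , s , r) = Z , (λ x b → ∧-l (s x b)) , r

-- A minimal high set becomes low when a vertex is deleted, so it has itself a model with one more
-- level and two more label bits. It is this model that `prune` cuts down.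
compact : ∀ ℓ d → Σ ℕ λ s → ∀ {n} {S : Mat n} → Sym S → (A : Subset n) → ¬ TM ℓ d S A →
  Σ (Subset n) λ Z → (∀ x → x ∈ Z → x ∈ A) × ¬ TM ℓ d S Z × Cover s Z
compact ℓ d = let (s , pr) = prune ℓ (2 + ℓ) d (suc d) 1 in
  s , λ {n} {S} sy A h → let (Z , s⊆ , hz , mn) = minimal ℓ d A h in
    Z , s⊆ , hz , pr sy hz mn (λ y a → a) (λ _ → zero) (λ y y' u _ _ uz nu _ → tf uz nu) (model sy Z hz mn (∃? Z))
  where
  model : ∀ {n} {S : Mat n} → Sym S → ∀ Z → ¬ TM ℓ d S Z → (∀ z → z ∈ Z → TM ℓ d S (Z ⊝ z)) →
    (Σ (Fin n) λ x → Z x ≡ true) ⊎ (∀ x → Z x ≡ false) → TM (2 + ℓ) (suc d) S Z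
  model sy Z hz mn (inj₁ (z , a)) = TM-vertex ℓ d sy z (mn z a)
  model sy Z hz mn (inj₂ e) = ⊥-elim (hz (TM-small ℓ d (λ x y a → tf a (e x))))

-- Connectivity and handles

-- Connectivity is stated by cuts rather than walks: a pivot destroys walks, but it is easy to see
-- that it leaves an edge across every cut.
Joined : ∀ {n} → Mat n → Subset n → Set
Joined {n} S R = ∀ (U : Subset n) a b → a ∈ R → a ∈ U → b ∈ R → b ∉ U →
  Σ (Fin n) λ x → Σ (Fin n) λ y → x ∈ R × x ∈ U × y ∈ R × y ∉ U × S x y ≡ true

∪-l : ∀ {n} (A : Subset n) {v x} → x ∈ A → x ∈ (A ∪ ｛ v ｝)
∪-l A = ∨-l

∪-v : ∀ {n} (A : Subset n) v → v ∈ (A ∪ ｛ v ｝)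
∪-v A v = ∨-r {A v} (==-refl v)

∪-e : ∀ {n} (A : Subset n) {v x} → x ∈ (A ∪ ｛ v ｝) → x ∈ A ⊎ x ≡ v
∪-e A {v} {x} h with ∨-e {A x} h
... | inj₁ a = inj₁ a
... | inj₂ e = inj₂ (==-yes e)

conn-single : ∀ {n} {S : Mat n} v → Joined S ｛ v ｝
conn-single v U a b ha ua hb ub = tf ua (trans (cong U (trans (==-yes ha) (sym (==-yes hb)))) ub)

conn-add : ∀ {n} {S : Mat n} → Sym S → ∀ {R y z} → Joined S R → z ∈ R → S y z ≡ true → Joined S (R ∪ ｛ y ｝)
conn-add {S = S} sy {R} {y} {z} c hz s U a b ha ua hb ub with bool (U y) | bool (U z)
... | inj₁ uy | inj₂ uz = y , z , ∪-v R y , uy , ∪-l R hz , uz , s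
... | inj₂ uy | inj₁ uz = z , y , ∪-l R hz , uz , ∪-v R y , uy , trans (sy z y) s
... | inj₁ uy | inj₁ uz with ∪-e R hb
...   | inj₂ refl = tf uy ub
...   | inj₁ rb = let (x , y , hx , ux , hy , uy' , t) = c U z b hz uz rb ub in x , y , ∪-l R hx , ux , ∪-l R hy , uy' , t
conn-add {S = S} sy {R} {y} {z} c hz s U a b ha ua hb ub | inj₂ uy | inj₂ uz with ∪-e R ha
...   | inj₂ refl = tf ua uy
...   | inj₁ ra = let (x , y , hx , ux , hy , uy' , t) = c U a z ra ua hz uz in x , y , ∪-l R hx , ux , ∪-l R hy , uy' , t

record Component {n} (S : Mat n) (X C : Subset n) : Set where
  field
    K      : Subset n
    C⊆K    : ∀ x → x ∈ C → x ∈ K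
    K⊆X    : ∀ x → x ∈ K → x ∈ X
    conn   : Joined S K
    closed : ∀ c x → c ∈ K → x ∈ X → x ∉ K → S c x ≡ false

component : ∀ {n} {S : Mat n} → Sym S → ∀ X C → (∀ x → x ∈ C → x ∈ X) → Joined S C → Component S X C
component {n} {S} sy X C s c = go (card (rest C)) C NP.≤-refl s c
  where
  rest : Subset n → Subset n
  rest C x = X x ∧ not (C x)
  go : ∀ k C → card (rest C) ≤ k → (∀ x → x ∈ C → x ∈ X) → Joined S C → Component S X C
  step : ∀ k C → card (rest C) ≤ k → (∀ x → x ∈ C → x ∈ X) → Joined S C →
    (∃ λ c → ∃ λ x → (C c ≡ true) × (rest C x ≡ true) × (S c x ≡ true)) ⊎ (∀ c x → ¬ ((C c ≡ true) × (rest C x ≡ true) × (S c x ≡ true))) →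
    Component S X C
  go k C p s c = step k C p s c (any₂? _ (λ c x → (C c BP.≟ true) ×-dec (rest C x BP.≟ true) ×-dec (S c x BP.≟ true)))
  step k C p s c (inj₂ none) = record { K = C ; C⊆K = λ x a → a ; K⊆X = s ; conn = c
    ; closed = λ c x a b d → ≢true (λ t → none c x (a , ∧-i b (not-i d) , t)) }
  step k C p s c (inj₁ (y , x , a , b , t)) = shrink k p
    where
    C' = C ∪ ｛ x ｝
    less : card (rest C') < card (rest C)
    less = card-strict {A = rest C'} {rest C} (λ {z} h → ∧-i (∧-l h) (not-i (≢true (λ q → tf (∪-l C q) (not-e (∧-r {X z} h)))))) x b
      (≢true (λ h → tf (∪-v C x) (not-e (∧-r {X x} h))))
    s' : ∀ z → z ∈ C' → z ∈ X
    s' z h with ∪-e C h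
    ... | inj₁ q = s z q
    ... | inj₂ refl = ∧-l b
    shrink : ∀ k → card (rest C) ≤ k → Component S X C
    shrink zero    p = ⊥-elim (NP.n≮0 (NP.<-≤-trans less p))
    shrink (suc k) p = let r = go k C' (NP.≤-pred (NP.<-≤-trans less p)) s' (conn-add sy c a (trans (sy x y) t)) in
      record { K = Component.K r ; C⊆K = λ z h → Component.C⊆K r z (∪-l C h) ; K⊆X = Component.K⊆X r
             ; conn = Component.conn r ; closed = Component.closed r }

-- Doubling in a form for which `dbl (suc k)` computes to `2 + dbl k`, the label bits of `TM-flip`
-- and `TM-vertex`.
dbl : ℕ → ℕ
dbl zero    = zero
dbl (suc k) = suc (suc (dbl k))

-- One unit of k pays for two label bits and one level.
Hi : ∀ {n} → ℕ → Mat n → Subset n → Set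
Hi k S A = ¬ TM (dbl k) k S A

low-flip : ∀ k {n} {S S' : Mat n} {A : Subset n} (b₁ b₂ : Fin n → Bool) (g : Bool → Bool → Bool → Bool → Bool) →
  (∀ x y → x ∈ A → y ∈ A → x ≢ y → S' x y ≡ S x y xor g (b₁ x) (b₂ x) (b₁ y) (b₂ y)) →
  TM (dbl k) k S A → TM (dbl (suc k)) (suc k) S' A
low-flip k b₁ b₂ g h t = TM-suc _ k (TM-flip (dbl k) k b₁ b₂ g h t)

hi-flip : ∀ k {n} {S S' : Mat n} {A : Subset n} (b₁ b₂ : Fin n → Bool) (g : Bool → Bool → Bool → Bool → Bool) →
  (∀ x y → x ∈ A → y ∈ A → x ≢ y → S' x y ≡ S x y xor g (b₁ x) (b₂ x) (b₁ y) (b₂ y)) → Hi (suc k) S' A → Hi k S A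
hi-flip k b₁ b₂ g h hi t = hi (low-flip k b₁ b₂ g h t)

hi-vertex : ∀ k {n} {S : Mat n} {A : Subset n} → Sym S → ∀ v → Hi (suc k) S A → Hi k S (A ⊝ v)
hi-vertex k sy v hi t = hi (TM-vertex (dbl k) k sy v t)

hi-weak : ∀ k {n} {S : Mat n} {A : Subset n} → Hi (suc k) S A → Hi k S A
hi-weak k {S = S} = hi-flip k (λ _ → false) (λ _ → false) (λ _ _ _ _ → false) (λ x y _ _ _ → sym (BP.xor-identityʳ (S x y)))

hi-⊇ : ∀ k {n} {S : Mat n} {A B : Subset n} → (∀ x → x ∈ A → x ∈ B) → Hi k S A → Hi k S B
hi-⊇ k s hi t = hi (TM-⊆ (dbl k) k s t)

hi-nonempty : ∀ k {n} {S : Mat n} {A : Subset n} → Hi k S A → Σ (Fin n) λ x → x ∈ A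
hi-nonempty k {A = A} hi with ∃? A
... | inj₁ q = q
... | inj₂ e = ⊥-elim (hi (TM-small (dbl k) k (λ x y a → tf a (e x))))

-- If all connected components are low, they serve as the parts of a new top level with zero entries
-- between them.
components : ∀ ℓ d {n} {S : Mat n} → Sym S → ∀ X →
  (Σ (Subset n) λ C → (∀ x → x ∈ C → x ∈ X) × Joined S C × ¬ TM ℓ d S C) ⊎ TM ℓ (suc d) S X
components ℓ d {n} {S} sy X = fin (go (card X) X NP.≤-refl)
  where
  -- The names of the parts belong to `X`, so that a component split off can be named by its vertex
  -- `x₀` without a clash.
  Part : Subset n → Set
  Part X = Σ (Fin n → Fin n) λ p → (∀ x → x ∈ X → p x ∈ X) × (∀ x y → x ∈ X → y ∈ X → p x ≢ p y → S x y ≡ false) × (∀ c → TM ℓ d S (X ∩ cls p c))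
  High : Subset n → Set
  High X = Σ (Subset n) λ C → (∀ x → x ∈ C → x ∈ X) × Joined S C × ¬ TM ℓ d S C
  fin : High X ⊎ Part X → High X ⊎ TM ℓ (suc d) S X
  fin (inj₁ h) = inj₁ h
  fin (inj₂ (p , _ , h , t)) = inj₂ (TM-disjoint ℓ d p h t)
  empty : ∀ X → (∀ x → X x ≡ false) → Part X
  empty X e = id , (λ x a → a) , (λ x y a → tf a (e x)) , λ c → TM-small ℓ d (λ x y a → tf (∧-l a) (e x))
  join : ∀ X x₀ → x₀ ∈ X → (r : Component S X ｛ x₀ ｝) → TM ℓ d S (Component.K r) → Part (λ x → X x ∧ not (Component.K r x)) → Part X
  join X x₀ h₀ r t (p' , m , na , ch) = p , mem , nonadj , child
    where
    open Component r
    x₀K : x₀ ∈ K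
    x₀K = C⊆K x₀ (==-refl x₀)
    p : Fin n → Fin n
    p x = if K x then x₀ else p' x
    pK : ∀ x → x ∈ K → p x ≡ x₀
    pK x h rewrite h = refl
    pN : ∀ x → x ∉ K → p x ≡ p' x
    pN x h rewrite h = refl
    mem : ∀ x → x ∈ X → p x ∈ X
    mem x a with bool (K x)
    ... | inj₁ k = trans (cong X (pK x k)) h₀
    ... | inj₂ k = trans (cong X (pN x k)) (∧-l (m x (∧-i a (not-i k))))
    nonadj : ∀ x y → x ∈ X → y ∈ X → p x ≢ p y → S x y ≡ false
    nonadj x y a b q with bool (K x) | bool (K y)
    ... | inj₁ k | inj₁ k' = ⊥-elim (q (trans (pK x k) (sym (pK y k'))))
    ... | inj₁ k | inj₂ k' = closed x y k b k'
    ... | inj₂ k | inj₁ k' = trans (sy x y) (closed y x k' a k)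
    ... | inj₂ k | inj₂ k' = na x y (∧-i a (not-i k)) (∧-i b (not-i k')) (λ e → q (trans (pN x k) (trans e (sym (pN y k')))))
    child : ∀ c → TM ℓ d S (X ∩ cls p c)
    child c with c FP.≟ x₀
    ... | yes refl = TM-⊆ ℓ d (λ x h → inK x h (bool (K x))) t
      where
      inK : ∀ x → x ∈ (X ∩ cls p c) → (K x ≡ true) ⊎ (K x ≡ false) → x ∈ K
      inK x h (inj₁ k) = k
      inK x h (inj₂ k) = tf x₀K (trans (cong K (sym (trans (sym (pN x k)) (==-yes (∧-r {X x} h))))) (not-e (∧-r {X (p' x)} (m x (∧-i (∧-l h) (not-i k))))))
    ... | no ne = TM-⊆ ℓ d (λ x h → out x h (bool (K x))) (ch c)
      where
      out : ∀ x → x ∈ (X ∩ cls p c) → (K x ≡ true) ⊎ (K x ≡ false) → ((X x ∧ not (K x)) ∧ (p' x == c)) ≡ true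
      out x h (inj₁ k) = ⊥-elim (ne (trans (sym (==-yes (∧-r {X x} h))) (pK x k)))
      out x h (inj₂ k) = ∧-i (∧-i (∧-l h) (not-i k)) (==-t (trans (sym (pN x k)) (==-yes (∧-r {X x} h))))
  go : ∀ k X → card X ≤ k → High X ⊎ Part X
  peel : ∀ k X → card X ≤ k → ∀ x₀ → x₀ ∈ X → (r : Component S X ｛ x₀ ｝) → Dec (TM ℓ d S (Component.K r)) → High X ⊎ Part X
  go k X p with ∃? X
  ... | inj₂ e = inj₂ (empty X e)
  ... | inj₁ (x₀ , h₀) = peel k X p x₀ h₀ r (TM? ℓ d S (Component.K r))
    where r = component sy X ｛ x₀ ｝ (λ x e → trans (cong X (==-yes e)) h₀) (conn-single x₀)
  peel k X p x₀ h₀ r (no nt) = inj₁ (Component.K r , Component.K⊆X r , Component.conn r , nt)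
  peel zero X p x₀ h₀ r (yes t) = ⊥-elim (NP.n≮0 (NP.<-≤-trans (card-strict {A = λ _ → false} {X} (λ ()) x₀ h₀ refl) p))
  peel (suc k) X p x₀ h₀ r (yes t) with go k (λ x → X x ∧ not (Component.K r x))
      (NP.≤-pred (NP.<-≤-trans (card-strict {A = λ x → X x ∧ not (Component.K r x)} {X} ∧-l x₀ h₀
        (≢true (λ q → tf (Component.C⊆K r x₀ (==-refl x₀)) (not-e (∧-r {X x₀} q))))) p))
  ... | inj₁ (C , s , c , nt) = inj₁ (C , (λ x h → ∧-l (s x h)) , c , nt)
  ... | inj₂ q = inj₂ (join X x₀ h₀ r t q)

hi-comp : ∀ k {n} {S : Mat n} → Sym S → ∀ {X} → Hi (suc k) S X →
  Σ (Subset n) λ C → (∀ x → x ∈ C → x ∈ X) × Joined S C × Hi k S C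
hi-comp k {S = S} sy {X} hi with components (dbl k) k sy X
... | inj₁ q = q
-- A flip by the zero function raises the label bits from `dbl k` to `dbl (suc k)`.
... | inj₂ t = ⊥-elim (hi (TM-flip (dbl k) (suc k) (λ _ → false) (λ _ → false) (λ _ _ _ _ → false) (λ x y _ _ _ → sym (BP.xor-identityʳ (S x y))) t))

Link : ∀ {n} → Mat n → Fin n → List (Fin n) → Set
Link S x []      = ⊤
Link S x (y ∷ l) = S x y ≡ true × All (λ z → S x z ≡ false) l × All (x ≢_) (y ∷ l)

Path : ∀ {n} → Mat n → List (Fin n) → Set
Path S []      = ⊤
Path S (x ∷ l) = Link S x l × Path S l

-- Only w sees the bag R.
record Handle {n} (S : Mat n) (w : Fin n) (ps : List (Fin n)) (R : Subset n) : Set where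
  field
    pth : Path S (w ∷ ps)
    null : All (λ p → ∀ z → z ∈ R → S p z ≡ false) ps
    out  : All (_∉ R) (w ∷ ps)

handle-⊆ : ∀ {n} {S : Mat n} {w ps R R'} → (∀ x → x ∈ R' → x ∈ R) → Handle S w ps R → Handle S w ps R'
handle-⊆ {R = R} {R'} s H = record { pth = pth ; null = All.map (λ f z h → f z (s z h)) null
  ; out = All.map (λ q → ≢true (λ t → tf (s _ t) q)) out }
  where open Handle H

data Suf {n} (l : List (Fin n)) : List (Fin n) → Set where
  here  : Suf l l
  there : ∀ {x k} → Suf l k → Suf l (x ∷ k)

suf-tail : ∀ {n} {x : Fin n} {l k} → Suf (x ∷ l) k → Suf l k
suf-tail here      = there here
suf-tail (there s) = there (suf-tail s)

suf-length : ∀ {n} {l k : List (Fin n)} → Suf l k → length l ≤ length k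
suf-length here      = NP.≤-refl
suf-length (there s) = NP.m≤n⇒m≤1+n (suf-length s)

record Grown {n} (S : Mat n) (w : Fin n) (ps : List (Fin n)) (R Z : Subset n) : Set where
  field
    y      : Fin n
    qs     : List (Fin n)
    handle : Handle S y qs Z
    conn   : Joined S (Z ∪ ｛ y ｝)
    suf    : Suf (w ∷ ps) qs
    -- Quantified over `Q`, because different callers locate the grown path in different ambient
    -- sets.
    within : ∀ Q → (∀ x → x ∈ R → x ∈ Q) → All (_∈ Q) (w ∷ ps) → All (_∈ Q) (y ∷ qs)

-- Let `K` be the component of `Z` among the vertices of `R` that `w` does not see. By connectivity
-- an edge leaves `K`, and its other end `y` must be seen by `w`. So the path goes on to `y` with
-- the smaller bag `K`, until its end sees `Z`.
grow : ∀ {n} {S : Mat n} → Sym S → ∀ {w ps R Z z₀} → Handle S w ps R → Joined S (R ∪ ｛ w ｝) → (∀ x → x ∈ Z → x ∈ R) →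
  Joined S Z → z₀ ∈ Z → (∀ z → z ∈ Z → S w z ≡ false) → Grown S w ps R Z
grow {n} {S} sy {R = R} {Z} {z₀} H c s cZ hz z = go (card R) R NP.≤-refl H c s z
  where
  go : ∀ k R {w ps} → card R ≤ k → Handle S w ps R → Joined S (R ∪ ｛ w ｝) → (∀ x → x ∈ Z → x ∈ R) → (∀ z → z ∈ Z → S w z ≡ false) → Grown S w ps R Z
  go k R {w} {ps} p H c s zw = cross (c K z₀ w (∪-l R (KR z₀ z₀K)) z₀K (∪-v R w) w∉K)
    where
    open Handle H
    X : Subset n
    X x = R x ∧ not (S w x)
    comp = component sy X Z (λ x h → ∧-i (s x h) (not-i (zw x h))) cZ
    open Component comp
    z₀K = C⊆K z₀ hz
    KR : ∀ x → x ∈ K → x ∈ R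
    KR x h = ∧-l (K⊆X x h)
    w∉R : w ∉ R
    w∉R = All.head out
    w∉K : w ∉ K
    w∉K = ≢true (λ t → tf (KR w t) w∉R)
    cross : (Σ (Fin n) λ x → Σ (Fin n) λ y → x ∈ (R ∪ ｛ w ｝) × x ∈ K × y ∈ (R ∪ ｛ w ｝) × y ∉ K × S x y ≡ true) → Grown S w ps R Z
    cross (x , y , _ , xK , hy , yK , t) = fin (∃? (λ z → Z z ∧ S y z))
      where
      wx : S w x ≡ false
      wx = not-e (∧-r {R x} (K⊆X x xK))
      yR : y ∈ R
      yR with ∪-e R hy
      ... | inj₁ h = h
      ... | inj₂ refl = tf t (trans (sy x y) wx)
      wy : S w y ≡ true
      wy = ≢false (λ f → tf t (closed x y xK (∧-i yR (not-i f)) yK))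
      H' : Handle S y (w ∷ ps) K
      H' = record
        { pth = (trans (sy y w) wy , All.map (λ {p} f → trans (sy y p) (f y yR)) null , All.map (λ q → ∈∉ {A = R} yR q) out) , pth
        ; null = (λ z h → not-e (∧-r {R z} (K⊆X z h))) ∷ All.map (λ f z h → f z (KR z h)) null
        ; out = yK ∷ All.map (λ q → ≢true (λ h → tf (KR _ h) q)) out }
      fin : (Σ (Fin n) λ z → (Z z ∧ S y z) ≡ true) ⊎ (∀ z → (Z z ∧ S y z) ≡ false) → Grown S w ps R Z
      fin (inj₁ (z , h)) = record { y = y ; qs = w ∷ ps ; handle = handle-⊆ C⊆K H' ; conn = conn-add sy cZ (∧-l h) (∧-r {Z z} h)
        ; suf = here ; within = λ Q q a → q y yR ∷ a }
      fin (inj₂ none) = rec k p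
        where
        rec : ∀ k → card R ≤ k → Grown S w ps R Z
        rec zero p = ⊥-elim (NP.n≮0 (NP.<-≤-trans (card-strict {A = λ _ → false} {R} (λ ()) y yR refl) p))
        rec (suc k) p with go k K {y} {w ∷ ps} (NP.≤-pred (NP.<-≤-trans (card-strict {A = K} {R} (λ {x} → KR x) y yR yK) p)) H'
            (conn-add sy conn xK (trans (sy y x) t)) C⊆K (λ z h → ≢true (λ q → tf (∧-i h q) (none z)))
        ... | g = record { y = Grown.y g ; qs = Grown.qs g ; handle = Grown.handle g ; conn = Grown.conn g
          ; suf = suf-tail (Grown.suf g) ; within = λ Q q a → Grown.within g Q (λ x h → q x (KR x h)) (q y yR ∷ a) }

-- Principal pivots of symmetric matrices over GF(2)

-- Truth tables: with `refl` as the argument of `taut`, identities over GF(2) are checked by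
-- evaluation.
agree : ∀ m → (Vec Bool m → Bool) → (Vec Bool m → Bool) → Bool
agree zero    f g = not (f [] xor g [])
agree (suc m) f g = agree m (f ∘ (true ∷_)) (g ∘ (true ∷_)) ∧ agree m (f ∘ (false ∷_)) (g ∘ (false ∷_))

taut : ∀ m (f g : Vec Bool m → Bool) → agree m f g ≡ true → ∀ v → f v ≡ g v
taut zero f g h [] with f [] | g []
... | true  | true  = refl
... | false | false = refl
taut (suc m) f g h (true ∷ v)  = taut m _ _ (∧-l h) v
taut (suc m) f g h (false ∷ v) = taut m _ _ (∧-r {agree m (f ∘ (true ∷_)) (g ∘ (true ∷_))} h) v

-- The principal pivot transform over GF(2) at a diagonal entry 1: a rank-one update away from `b`,
-- with row `b` kept.
record IsLoop {n} (S : Mat n) (b : Fin n) (S' : Mat n) : Set where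
  field
    msym : Sym S'
    lp   : S b b ≡ true
    off  : ∀ x y → x ≢ b → y ≢ b → S' x y ≡ S x y xor (S x b ∧ S b y)
    row  : ∀ y → S' b y ≡ S b y

-- The principal pivot on the block of `b` and `c`, which has zero diagonal. It is a relation since
-- it has to hold both of `edgeM` and of the adjacency of `pivot`, which agree only pointwise.
record IsEdge {n} (S : Mat n) (b c : Fin n) (S' : Mat n) : Set where
  field
    msym : Sym S'
    ub   : S b b ≡ false
    uc   : S c c ≡ false
    bc   : S b c ≡ true
    off  : ∀ x y → x ≢ b → x ≢ c → y ≢ b → y ≢ c → S' x y ≡ S x y xor ((S x b ∧ S c y) xor (S x c ∧ S b y))
    rowb : ∀ y → y ≢ b → y ≢ c → S' b y ≡ S c y
    rowc : ∀ y → y ≢ b → y ≢ c → S' c y ≡ S b y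
    bc'  : S' b c ≡ true
    bb'  : S' b b ≡ false
    cc'  : S' c c ≡ false

edge-≢ : ∀ {n} {S : Mat n} {b c S'} → IsEdge S b c S' → b ≢ c
edge-≢ e refl = tf (IsEdge.bc e) (IsEdge.ub e)

edge-swap : ∀ {n} {S : Mat n} {b c S'} → Sym S → IsEdge S b c S' → IsEdge S c b S'
edge-swap {S = S} {b} {c} sy e = record
  { msym = msym ; ub = uc ; uc = ub ; bc = trans (sy c b) bc
  ; off = λ x y p q r s → trans (off x y q p s r) (cong (S x y xor_) (BP.xor-comm (S x b ∧ S c y) (S x c ∧ S b y)))
  ; rowb = λ y p q → rowc y q p ; rowc = λ y p q → rowb y q p ; bc' = trans (msym c b) bc' ; bb' = cc' ; cc' = bb' }
  where open IsEdge e

loopM : ∀ {n} → Mat n → Fin n → Mat n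
loopM S b x y = if (x == b) ∨ (y == b) then S x y else S x y xor (S x b ∧ S b y)

isLoop : ∀ {n} {S : Mat n} {b} → Sym S → S b b ≡ true → IsLoop S b (loopM S b)
isLoop {n} {S} {b} sy h = record { msym = ms ; lp = h ; off = of ; row = ro }
  where
  of : ∀ x y → x ≢ b → y ≢ b → loopM S b x y ≡ S x y xor (S x b ∧ S b y)
  of x y p q rewrite ==-f p | ==-f q = refl
  ro : ∀ y → loopM S b b y ≡ S b y
  ro y rewrite ==-refl b = refl
  ms : Sym (loopM S b)
  ms x y with x == b | y == b
  ... | true  | true  = sy x y
  ... | true  | false = sy x y
  ... | false | true  = sy x y
  ... | false | false = cong₂ _xor_ (sy x y) (trans (cong₂ _∧_ (sy x b) (sy b y)) (BP.∧-comm (S b x) (S y b)))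

edgeM : ∀ {n} → Mat n → Fin n → Fin n → Mat n
edgeM S b c x y =
  if x == b then (if y == b then false else if y == c then true else S c y)
  else if x == c then (if y == b then true else if y == c then false else S b y)
  else if y == b then S x c else if y == c then S x b
  else S x y xor ((S x b ∧ S c y) xor (S x c ∧ S b y))

isEdge : ∀ {n} {S : Mat n} {b c} → Sym S → S b b ≡ false → S c c ≡ false → S b c ≡ true → IsEdge S b c (edgeM S b c)
isEdge {n} {S} {b} {c} sy ub uc bc = record { msym = ms ; ub = ub ; uc = uc ; bc = bc ; off = of ; rowb = rb ; rowc = rc
    ; bc' = e₁ ; bb' = e₂ ; cc' = e₃ }
  where
  b≢c : b ≢ c
  b≢c refl = tf bc ub
  of : ∀ x y → x ≢ b → x ≢ c → y ≢ b → y ≢ c → edgeM S b c x y ≡ S x y xor ((S x b ∧ S c y) xor (S x c ∧ S b y))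
  of x y p q r s rewrite ==-f p | ==-f q | ==-f r | ==-f s = refl
  rb : ∀ y → y ≢ b → y ≢ c → edgeM S b c b y ≡ S c y
  rb y p q rewrite ==-refl b | ==-f p | ==-f q = refl
  rc : ∀ y → y ≢ b → y ≢ c → edgeM S b c c y ≡ S b y
  rc y p q rewrite ==-f (λ e → b≢c (sym e)) | ==-refl c | ==-f p | ==-f q = refl
  e₁ : edgeM S b c b c ≡ true
  e₁ rewrite ==-refl b | ==-f (λ e → b≢c (sym e)) | ==-refl c = refl
  e₂ : edgeM S b c b b ≡ false
  e₂ rewrite ==-refl b = refl
  e₃ : edgeM S b c c c ≡ false
  e₃ rewrite ==-f (λ e → b≢c (sym e)) | ==-refl c = refl
  ms : Sym (edgeM S b c)
  ms x y with x == b | x == c | y == b | y == c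
  ... | true  | _     | true  | _     = refl
  ... | true  | _     | false | true  = refl
  ... | true  | _     | false | false = sy c y
  ... | false | true  | true  | _     = refl
  ... | false | true  | false | true  = refl
  ... | false | true  | false | false = sy b y
  ... | false | false | true  | _     = sy x c
  ... | false | false | false | true  = sy x b
  ... | false | false | false | false = cong₂ _xor_ (sy x y) (trans (BP.xor-comm (S x b ∧ S c y) (S x c ∧ S b y))
        (cong₂ _xor_ (trans (cong₂ _∧_ (sy x c) (sy b y)) (BP.∧-comm (S c x) (S y b))) (trans (cong₂ _∧_ (sy x b) (sy c y)) (BP.∧-comm (S b x) (S y c)))))

-- Only loops are counted: in the graph behind the matrix a loop pivot costs one twin, whereas an
-- edge pivot is an ordinary pivot and free.
data Steps {n} (B : Subset n) : ℕ → Mat n → Mat n → Set where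
  nil  : ∀ {m S} → Steps B m S S
  loop : ∀ {m S S₁ S₂} b → b ∈ B → IsLoop S b S₁ → Steps B m S₁ S₂ → Steps B (suc m) S S₂
  edge : ∀ {m S S₁ S₂} b c → b ∈ B → c ∈ B → IsEdge S b c S₁ → Steps B m S₁ S₂ → Steps B m S S₂

steps-weak : ∀ {n} {B : Subset n} {m m' S S'} → m ≤ m' → Steps B m S S' → Steps B m' S S'
steps-weak p nil = nil
steps-weak (s≤s p) (loop b h i t) = loop b h i (steps-weak p t)
steps-weak p (edge b c h h' i t) = edge b c h h' i (steps-weak p t)

steps-++ : ∀ {n} {B : Subset n} {m m' S S₁ S₂} → Steps B m S S₁ → Steps B m' S₁ S₂ → Steps B (m + m') S S₂
steps-++ {m = m} {m'} nil t = steps-weak (NP.m≤n+m m' m) t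
steps-++ (loop b h i s) t = loop b h i (steps-++ s t)
steps-++ (edge b c h h' i s) t = edge b c h h' i (steps-++ s t)

steps-sym : ∀ {n} {B : Subset n} {m S S'} → Sym S → Steps B m S S' → Sym S'
steps-sym sy nil = sy
steps-sym sy (loop b h i t) = steps-sym (IsLoop.msym i) t
steps-sym sy (edge b c h h' i t) = steps-sym (IsEdge.msym i) t

xf : ∀ a {b} → b ≡ false → a xor b ≡ a
xf a refl = BP.xor-identityʳ a

∧f : ∀ a {b} → b ≡ false → a ∧ b ≡ false
∧f a refl = BP.∧-zeroʳ a

∧f' : ∀ {a} b → a ≡ false → a ∧ b ≡ false
∧f' b refl = refl

loop-row : ∀ {n} {S : Mat n} {b S'} → Sym S → IsLoop S b S' → ∀ {p} → S p b ≡ false → ∀ y → S' p y ≡ S p y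
loop-row {S = S} {b} sy i {p} h y with eq? y b
... | inj₁ refl = trans (IsLoop.msym i p b) (trans (IsLoop.row i p) (sy b p))
... | inj₂ e = trans (IsLoop.off i p y (λ { refl → tf (IsLoop.lp i) h }) e) (xf (S p y) (∧f' (S b y) h))

edge-row : ∀ {n} {S : Mat n} {b c S'} → Sym S → IsEdge S b c S' → ∀ {p} → S p b ≡ false → S p c ≡ false → ∀ y → S' p y ≡ S p y
edge-row {S = S} {b} {c} {S'} sy i {p} h h' y = go (eq? y b) (eq? y c)
  where
  open IsEdge i
  p≢b : p ≢ b
  p≢b refl = tf bc h'
  p≢c : p ≢ c
  p≢c refl = tf bc (trans (sy b c) h)
  go : (y ≡ b) ⊎ (y ≢ b) → (y ≡ c) ⊎ (y ≢ c) → S' p y ≡ S p y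
  go (inj₁ refl) _ = trans (msym p b) (trans (rowb p p≢b p≢c) (trans (sy c p) (trans h' (sym h))))
  go (inj₂ e) (inj₁ refl) = trans (msym p c) (trans (rowc p p≢b p≢c) (trans (sy b p) (trans h (sym h'))))
  go (inj₂ e) (inj₂ e') = trans (off p y p≢b p≢c e e') (xf (S p y) (trans (cong₂ _xor_ (∧f' (S c y) h) (∧f' (S b y) h')) refl))

-- A row that vanishes at the pivoted vertices is not touched, so it still vanishes on `B` at the
-- next step. This protects all of a handle except its end.
steps-row : ∀ {n} {B : Subset n} {m S S'} → Sym S → Steps B m S S' → ∀ {p} → (∀ z → z ∈ B → S p z ≡ false) → ∀ y → S' p y ≡ S p y
steps-row sy nil h y = refl
steps-row sy (loop b hb i t) h y = trans (steps-row (IsLoop.msym i) t (λ z hz → trans (loop-row sy i (h b hb) z) (h z hz)) y) (loop-row sy i (h b hb) y)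
steps-row sy (edge b c hb hc i t) h y =
  trans (steps-row (IsEdge.msym i) t (λ z hz → trans (edge-row sy i (h b hb) (h c hc) z) (h z hz)) y) (edge-row sy i (h b hb) (h c hc) y)

-- If the pivot changes a crossing edge, then `b` sees both of its ends; so `b` has an edge to the
-- end on the other side, and the row of `b` is kept.
loop-joined : ∀ {n} {S : Mat n} {b S' R} → Sym S → IsLoop S b S' → b ∈ R → Joined S R → Joined S' R
loop-joined {n} {S} {b} {S'} {R} sy i hb c U a a' ha ua ha' ua' with c U a a' ha ua ha' ua'
... | (x , y , hx , ux , hy , uy , s) = go (bool (U b)) (bool (S b x)) (bool (S b y))
  where
  open IsLoop i using (msym; off; row)
  Res = Σ (Fin n) λ x → Σ (Fin n) λ y → x ∈ R × x ∈ U × y ∈ R × y ∉ U × S' x y ≡ true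
  keep : (x ≡ b ⊎ y ≡ b) ⊎ (S b x ≡ false ⊎ S b y ≡ false) → Res
  keep (inj₁ (inj₁ refl)) = x , y , hx , ux , hy , uy , trans (row y) s
  keep (inj₁ (inj₂ refl)) = x , y , hx , ux , hy , uy , trans (msym x y) (trans (row x) (trans (sy y x) s))
  keep (inj₂ (inj₁ f)) = x , y , hx , ux , hy , uy , trans (loop-row sy i (trans (sy x b) f) y) s
  keep (inj₂ (inj₂ f)) = x , y , hx , ux , hy , uy , trans (msym x y) (trans (loop-row sy i (trans (sy y b) f) x) (trans (sy y x) s))
  go : (U b ≡ true) ⊎ (U b ≡ false) → (S b x ≡ true) ⊎ (S b x ≡ false) → (S b y ≡ true) ⊎ (S b y ≡ false) → Res
  go (inj₁ u) _ (inj₁ t) = b , y , hb , u , hy , uy , trans (row y) t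
  go (inj₁ u) _ (inj₂ f) = keep (inj₂ (inj₂ f))
  go (inj₂ u) (inj₁ t) _ = x , b , hx , ux , hb , u , trans (msym x b) (trans (row x) t)
  go (inj₂ u) (inj₂ f) _ = keep (inj₂ (inj₁ f))

-- If the cut separates `b` from `c`, the edge between them crosses it. Otherwise take the end of a
-- crossing edge on the side opposite to `b` and `c`: either one of them sees it, and the exchanged
-- rows still give a crossing edge, or its row is unchanged.
edge-joined : ∀ {n} {S : Mat n} {b c S' R} → Sym S → IsEdge S b c S' → b ∈ R → c ∈ R → Joined S R → Joined S' R
edge-joined {n} {S} {b} {c} {S'} {R} sy i hb hc cn U a a' ha ua ha' ua' with cn U a a' ha ua ha' ua'
... | (x , y , hx , ux , hy , uy , s) = go (bool (U b)) (bool (U c))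
  where
  open IsEdge i
  Res = Σ (Fin n) λ x → Σ (Fin n) λ y → x ∈ R × x ∈ U × y ∈ R × y ∉ U × S' x y ≡ true
  go : (U b ≡ true) ⊎ (U b ≡ false) → (U c ≡ true) ⊎ (U c ≡ false) → Res
  go (inj₁ ub') (inj₂ uc') = b , c , hb , ub' , hc , uc' , bc'
  go (inj₂ ub') (inj₁ uc') = c , b , hc , uc' , hb , ub' , trans (msym c b) bc'
  go (inj₁ ub') (inj₁ uc') = test (bool (S b y)) (bool (S c y))
    where
    y≢b = λ e → tf ub' (trans (cong U (sym e)) uy)
    y≢c = λ e → tf uc' (trans (cong U (sym e)) uy)
    test : (S b y ≡ true) ⊎ (S b y ≡ false) → (S c y ≡ true) ⊎ (S c y ≡ false) → Res
    test (inj₁ t) _ = c , y , hc , uc' , hy , uy , trans (rowc y y≢b y≢c) t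
    test (inj₂ f) (inj₁ t) = b , y , hb , ub' , hy , uy , trans (rowb y y≢b y≢c) t
    test (inj₂ f) (inj₂ f') = x , y , hx , ux , hy , uy ,
      trans (msym x y) (trans (edge-row sy i (trans (sy y b) f) (trans (sy y c) f') x) (trans (sy y x) s))
  go (inj₂ ub') (inj₂ uc') = test (bool (S b x)) (bool (S c x))
    where
    x≢b = λ e → tf (trans (cong U (sym e)) ux) ub'
    x≢c = λ e → tf (trans (cong U (sym e)) ux) uc'
    test : (S b x ≡ true) ⊎ (S b x ≡ false) → (S c x ≡ true) ⊎ (S c x ≡ false) → Res
    test (inj₁ t) _ = x , c , hx , ux , hc , uc' , trans (msym x c) (trans (rowc x x≢b x≢c) t)
    test (inj₂ f) (inj₁ t) = x , b , hx , ux , hb , ub' , trans (msym x b) (trans (rowb x x≢b x≢c) t)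
    test (inj₂ f) (inj₂ f') = x , y , hx , ux , hy , uy , trans (edge-row sy i (trans (sy x b) f) (trans (sy x c) f') y) s

steps-joined : ∀ {n} {B R : Subset n} {m S S'} → Sym S → (∀ x → x ∈ B → x ∈ R) → Steps B m S S' → Joined S R → Joined S' R
steps-joined sy s nil c = c
steps-joined sy s (loop b h i t) c = steps-joined (IsLoop.msym i) s t (loop-joined sy i (s b h) c)
steps-joined sy s (edge b d h h' i t) c = steps-joined (IsEdge.msym i) s t (edge-joined sy i (s b h) (s d h') c)

joined-cong : ∀ {n} {S S' : Mat n} {R} → (∀ x y → x ∈ R → y ∈ R → S' x y ≡ S x y) → Joined S R → Joined S' R
joined-cong e c U a b ha ua hb ub = let (x , y , hx , ux , hy , uy , s) = c U a b ha ua hb ub in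
  x , y , hx , ux , hy , uy , trans (e x y hx hy) s

hi-cong : ∀ k {n} {S S' : Mat n} {A} → (∀ x y → x ∈ A → y ∈ A → S' x y ≡ S x y) → Hi k S A → Hi k S' A
hi-cong k e hi t = hi (TM-iso (dbl k) k id (λ x h → h) (λ _ _ _ _ q → q) (λ x y a b _ → e x y a b) t)

link-cong : ∀ {n} {S S' : Mat n} {x} l → All (λ z → S' x z ≡ S x z) l → Link S x l → Link S' x l
link-cong [] _ _ = tt
link-cong (y ∷ l) (e ∷ es) (a , z , d) = trans e a , All.zipWith (λ (p , q) → trans p q) (es , z) , d

path-cong : ∀ {n} {S S' : Mat n} → Sym S → Sym S' → ∀ {w} ps → All (λ p → ∀ y → S' p y ≡ S p y) ps → Path S (w ∷ ps) → Path S' (w ∷ ps)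
path-cong {S = S} {S'} sy sy' {w} ps e (l , pth) = link-cong ps (All.map (λ {p} f → trans (sy' w p) (trans (f w) (sy p w))) e) l , go ps e pth
  where
  go : ∀ ps → All (λ p → ∀ y → S' p y ≡ S p y) ps → Path S ps → Path S' ps
  go [] e pth = tt
  go (p ∷ ps) (f ∷ e) (l , pth) = link-cong ps (All.tabulate (λ {z} _ → f z)) l , go ps e pth

handle-steps : ∀ {n} {B R : Subset n} {m S S' w ps} → Sym S → (∀ x → x ∈ B → x ∈ R) → Steps B m S S' → Handle S w ps R → Handle S' w ps R
handle-steps {S = S} {S'} sy s t H = record
  { pth = path-cong sy (steps-sym sy t) _ same pth ; null = All.zipWith (λ { (f , g) z h → trans (g z) (f z h) }) (null , same) ; out = out }
  where
  open Handle H
  same = All.map (λ f → steps-row sy t (λ z h → f z (s z h))) null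

data FirstLoop {n} (S : Mat n) : List (Fin n) → Fin n → Set where
  hit  : ∀ {p l} → S p p ≡ true → FirstLoop S (p ∷ l) p
  miss : ∀ {p l q} → S p p ≡ false → FirstLoop S l q → FirstLoop S (p ∷ l) q

Loopy : ∀ {n} → Mat n → List (Fin n) → Set
Loopy {n} S ps = Σ (Fin n) (FirstLoop S ps)

loopy-cons : ∀ {n} {S : Mat n} x {l} → Loopy S l → Loopy S (x ∷ l)
loopy-cons {S = S} x (q , f) with bool (S x x)
... | inj₁ t = x , hit t
... | inj₂ e = q , miss e f

loopy-suf : ∀ {n} {S : Mat n} {l k} → Suf l k → Loopy S l → Loopy S k
loopy-suf here q = q
loopy-suf (there {x} s) q = loopy-cons x (loopy-suf s q)

firstLoop-cong : ∀ {n} {S S' : Mat n} {l q} → All (λ p → S' p p ≡ S p p) l → FirstLoop S l q → FirstLoop S' l q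
firstLoop-cong (e ∷ es) (hit t)    = hit (trans e t)
firstLoop-cong (e ∷ es) (miss f r) = miss (trans e f) (firstLoop-cong es r)

loopy-steps : ∀ {n} {B R : Subset n} {m S S' w ps} → Sym S → (∀ x → x ∈ B → x ∈ R) → Steps B m S S' → Handle S w ps R → Loopy S ps → Loopy S' ps
loopy-steps sy s t H (q , f) = q , firstLoop-cong (All.map (λ {p} g → steps-row sy t (λ z h → g z (s z h)) p) (Handle.null H)) f

xor-true : ∀ a → a xor true ≡ not a
xor-true true  = refl
xor-true false = refl

-- Merging nested handles with equal traces

record Better {n} (k m : ℕ) (S : Mat n) (w : Fin n) (ps : List (Fin n)) (B Z : Subset n) : Set where
  field
    S'     : Mat n
    steps  : Steps B m S S'
    y      : Fin n
    qs     : List (Fin n)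
    Z'     : Subset n
    Z'⊆Z   : ∀ x → x ∈ Z' → x ∈ Z
    handle : Handle S' y qs Z'
    conn   : Joined S' (Z' ∪ ｛ y ｝)
    joined : Joined S' Z'
    hi     : Hi k S' Z'
    suf    : Suf (w ∷ ps) qs
    within : ∀ Q → (∀ x → x ∈ B → x ∈ Q) → All (_∈ Q) (w ∷ ps) → All (_∈ Q) (y ∷ qs)

better-after : ∀ {n k m m' S S₁ w ps} {B Z : Subset n} → Steps B m S S₁ → Better k m' S₁ w ps B Z → Better k (m + m') S w ps B Z
better-after t b = record { S' = S' ; steps = steps-++ t steps ; y = y ; qs = qs ; Z' = Z' ; Z'⊆Z = Z'⊆Z ; handle = handle ; conn = conn
  ; joined = joined ; hi = hi ; suf = suf ; within = within }
  where open Better b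

better-weak : ∀ {n k m m' S w ps} {B Z : Subset n} → m ≤ m' → Better k m S w ps B Z → Better k m' S w ps B Z
better-weak p b = record { S' = S' ; steps = steps-weak p steps ; y = y ; qs = qs ; Z' = Z' ; Z'⊆Z = Z'⊆Z ; handle = handle ; conn = conn
  ; joined = joined ; hi = hi ; suf = suf ; within = within }
  where open Better b

-- After the pivots `w` vanishes on `Z₁` but still sees `r` in the connected set `R`. Hence `grow`
-- has to pass at least one further vertex on its way to a high connected part of `Z₁`.
finish : ∀ k {n m} {S S' : Mat n} {w ps} {B R Z Z₁ : Subset n} → Sym S → Steps B m S S' → Handle S w ps B → (∀ x → x ∈ R → x ∈ B) →
  (∀ x → x ∈ Z → x ∈ R) → (∀ x → x ∈ Z₁ → x ∈ Z) → Joined S' R → Hi (suc k) S' Z₁ → (∀ z → z ∈ Z₁ → S' w z ≡ false) →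
  ∀ r → r ∈ R → S' w r ≡ true → Better k m S w ps B Z
finish k {S' = S'} {w} {ps} {B} {R} {Z} {Z₁} sy st H R⊆B Z⊆R Z₁⊆Z j hi van r hr wr
  with hi-comp k (steps-sym sy st) hi
... | (C , C⊆ , jC , hC) = record
  { S' = S' ; steps = st ; y = y ; qs = qs ; Z' = C ; Z'⊆Z = λ x h → Z₁⊆Z x (C⊆ x h) ; handle = handle ; conn = conn ; joined = jC
  ; hi = hC ; suf = suf ; within = λ Q q a → within Q (λ x h → q x (R⊆B x h)) a }
  where
  sy' = steps-sym sy st
  open Grown (grow sy' {R = R} {Z = C} (handle-⊆ R⊆B (handle-steps sy (λ x h → h) st H)) (conn-add sy' j hr wr) (λ x h → Z⊆R x (Z₁⊆Z x (C⊆ x h)))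
    jC (proj₂ (hi-nonempty k hC)) (λ z h → van z (C⊆ z h)))

record Twins {n} (S : Mat n) (w₁ : Fin n) (ps : List (Fin n)) (w₂ : Fin n) (B R Z : Subset n) : Set where
  field
    sy   : Sym S
    H    : Handle S w₁ ps B
    R⊆B  : ∀ x → x ∈ R → x ∈ B
    Z⊆R  : ∀ x → x ∈ Z → x ∈ R
    w₂R  : w₂ ∈ R
    w₂Z  : w₂ ∉ Z
    same : ∀ z → z ∈ Z → S w₁ z ≡ S w₂ z
    jR   : Joined S R
  w₁B : w₁ ∉ B
  w₁B = All.head (Handle.out H)
  ∈B : ∀ {x} → x ∈ Z → x ∈ B
  ∈B h = R⊆B _ (Z⊆R _ h)
  w₁≢ : ∀ {x} → x ∈ B → w₁ ≢ x
  w₁≢ h e = tf h (trans (cong B (sym e)) w₁B)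
  Z≢ : ∀ {z} → z ∈ Z → z ≢ w₂
  Z≢ h = ∈∉ {A = Z} h w₂Z

-- As `w₁` sees `w₂`, the pivot adds the row of `w₂` to that of `w₁`, and equal traces cancel. One
-- unit of height pays for the rank-one update of `Z`, one for `finish`.
merge-loop : ∀ k {n} {S : Mat n} {w₁ ps w₂} {B R Z : Subset n} → Twins S w₁ ps w₂ B R Z →
  S w₂ w₂ ≡ true → S w₁ w₂ ≡ true → Hi (2 + k) S Z → Better k 1 S w₁ ps B Z
merge-loop k {S = S} {w₁} {ps} {w₂} {B} {R} {Z} T lw s hi =
  finish k sy (loop w₂ (R⊆B _ w₂R) i nil) H R⊆B Z⊆R (λ x h → h) (loop-joined sy i w₂R jR)
    (hi-flip (suc k) (λ x → S x w₂) (λ _ → false) (λ a _ b _ → a ∧ b) flip hi) van w₂ w₂R (trans (msym w₁ w₂) (trans (row w₁) (trans (sy w₂ w₁) s)))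
  where
  open Twins T
  i = isLoop {S = S} sy lw
  open IsLoop i using (msym; off; row)
  van : ∀ z → z ∈ Z → loopM S w₂ w₁ z ≡ false
  van z h = trans (off w₁ z (w₁≢ (R⊆B _ w₂R)) (Z≢ h)) (trans (cong₂ (λ a b → a xor (b ∧ S w₂ z)) (same z h) s) (BP.xor-same (S w₂ z)))
  flip : ∀ x y → x ∈ Z → y ∈ Z → x ≢ y → S x y ≡ loopM S w₂ x y xor (S x w₂ ∧ S y w₂)
  flip x y a b _ = trans (taut 3 (λ { (s ∷ p ∷ q ∷ []) → s }) (λ { (s ∷ p ∷ q ∷ []) → (s xor (p ∧ q)) xor (p ∧ q) }) refl (S x y ∷ S x w₂ ∷ S w₂ y ∷ []))
    (cong₂ _xor_ (sym (off x y (Z≢ a) (Z≢ b))) (cong (S x w₂ ∧_) (sy w₂ y)))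

-- With `S w₁ w₂` zero and `S w₁ c` one, the update of row `w₁` is exactly the row of `w₂`. The
-- third unit of height pays for dropping `c`, whose row is replaced and not updated.
merge-edge : ∀ k {n} {S : Mat n} {w₁ ps w₂ c} {B R Z : Subset n} → Twins S w₁ ps w₂ B R Z →
  S w₂ w₂ ≡ false → S w₁ w₂ ≡ false → c ∈ Z → S w₁ c ≡ true → S c c ≡ false → Hi (3 + k) S Z → Better k 1 S w₁ ps B Z
merge-edge k {S = S} {w₁} {ps} {w₂} {c} {B} {R} {Z} T lw s hc sc lc hi =
  finish k sy (edge w₂ c (R⊆B _ w₂R) (∈B hc) i nil) H R⊆B Z⊆R (λ x h → ∧-l h) (edge-joined sy i w₂R (Z⊆R _ hc) jR)
    (hi-flip (suc k) (λ x → S x w₂) (λ x → S x c) (λ a b a' b' → (a ∧ b') xor (b ∧ a')) flip (hi-vertex (2 + k) sy c hi)) van w₂ w₂R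
    (trans (msym w₁ w₂) (trans (rowb w₁ (w₁≢ (R⊆B _ w₂R)) (w₁≢ (∈B hc))) (trans (sy c w₁) sc)))
  where
  open Twins T
  i = isEdge {S = S} {w₂} {c} sy lw lc (trans (sym (same c hc)) sc)
  open IsEdge i
  van : ∀ z → z ∈ (Z ⊝ c) → edgeM S w₂ c w₁ z ≡ false
  van z h = trans (off w₁ z (w₁≢ (R⊆B _ w₂R)) (w₁≢ (∈B hc)) (Z≢ (∧-l h)) (⊝-r {A = Z} h))
    (trans (cong₂ (λ a b → a xor ((b ∧ S c z) xor (S w₁ c ∧ S w₂ z))) (same z (∧-l h)) s)
      (trans (cong (λ b → S w₂ z xor (b ∧ S w₂ z)) sc) (BP.xor-same (S w₂ z))))
  flip : ∀ x y → x ∈ (Z ⊝ c) → y ∈ (Z ⊝ c) → x ≢ y → S x y ≡ edgeM S w₂ c x y xor ((S x w₂ ∧ S y c) xor (S x c ∧ S y w₂))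
  flip x y a b _ = trans
    (taut 2 (λ { (s ∷ p ∷ []) → s }) (λ { (s ∷ p ∷ []) → (s xor p) xor p }) refl (S x y ∷ ((S x w₂ ∧ S c y) xor (S x c ∧ S w₂ y)) ∷ []))
    (cong₂ _xor_ (sym (off x y (Z≢ (∧-l a)) (⊝-r {A = Z} a) (Z≢ (∧-l b)) (⊝-r {A = Z} b)))
      (cong₂ (λ u v → (S x w₂ ∧ u) xor (S x c ∧ v)) (sy c y) (sy w₂ y)))

-- In the remaining case, `w₂` unlooped and `c` looped, the pivot at `c` turns both `S w₂ w₂` and
-- `S w₁ w₂` from 0 to 1 and keeps the traces equal, so that `merge-loop` applies.
merge : ∀ k {n} {S : Mat n} {w₁ ps w₂ c} {B R Z : Subset n} → Twins S w₁ ps w₂ B R Z →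
  S w₁ w₂ ≡ S w₂ w₂ → c ∈ Z → S w₁ c ≡ true → Hi (3 + k) S Z → Better k 2 S w₁ ps B Z
merge k {n} {S} {w₁} {ps} {w₂} {c} {B} {R} {Z} T good hc sc hi with bool (S w₂ w₂) | bool (S c c)
... | inj₁ t | _ = better-weak (s≤s z≤n) (merge-loop k T t (trans good t) (hi-weak (2 + k) hi))
... | inj₂ f | inj₂ f' = better-weak (s≤s z≤n) (merge-edge k T f (trans good f) hc sc f' hi)
... | inj₂ f | inj₁ t = better-after (loop {m = 0} c (∈B hc) i nil) (merge-loop k T₁ l₁ s₁ hi₁)
  where
  open Twins T
  i = isLoop {S = S} sy t
  open IsLoop i using (msym; off; row)
  S₁ = loopM S c
  w₂≢c : w₂ ≢ c
  w₂≢c e = Z≢ hc (sym e)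
  l₁ : S₁ w₂ w₂ ≡ true
  l₁ = trans (off w₂ w₂ w₂≢c w₂≢c) (cong₂ _xor_ f (cong₂ _∧_ (trans (sym (same c hc)) sc) (trans (sy c w₂) (trans (sym (same c hc)) sc))))
  s₁ : S₁ w₁ w₂ ≡ true
  s₁ = trans (off w₁ w₂ (w₁≢ (∈B hc)) w₂≢c) (cong₂ _xor_ (trans good f) (cong₂ _∧_ sc (trans (sy c w₂) (trans (sym (same c hc)) sc))))
  same₁ : ∀ z → z ∈ Z → S₁ w₁ z ≡ S₁ w₂ z
  same₁ z h with eq? z c
  ... | inj₁ refl = trans (msym w₁ c) (trans (row w₁) (trans (sy c w₁) (trans (same c hc) (trans (sy w₂ c) (sym (trans (msym w₂ c) (row w₂)))))))
  ... | inj₂ e = trans (off w₁ z (w₁≢ (∈B hc)) e) (trans (cong₂ (λ a b → a xor (b ∧ S c z)) (same z h) (same c hc)) (sym (off w₂ z w₂≢c e)))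
  T₁ : Twins S₁ w₁ ps w₂ B R Z
  T₁ = record { sy = msym ; H = handle-steps sy (λ x h → h) (loop {m = 0} c (∈B hc) i nil) H ; R⊆B = R⊆B ; Z⊆R = Z⊆R ; w₂R = w₂R ; w₂Z = w₂Z
    ; same = same₁ ; jR = loop-joined sy i (Z⊆R _ hc) jR }
  hi₁ : Hi (2 + k) S₁ Z
  -- The pivot keeps the row of `c`, hence the bit of `c` itself is masked.
  hi₁ = hi-flip (2 + k) (λ x → S x c ∧ not (x == c)) (λ _ → false) (λ a _ b _ → a ∧ b) flip hi
    where
    flip : ∀ x y → x ∈ Z → y ∈ Z → x ≢ y → S x y ≡ S₁ x y xor ((S x c ∧ not (x == c)) ∧ (S y c ∧ not (y == c)))
    flip x y a b ne with eq? x c | eq? y c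
    ... | inj₁ refl | _ = sym (trans (cong₂ (λ u v → u xor (v ∧ (S y c ∧ not (y == c)))) (row y) (trans (cong (λ v → S c c ∧ not v) (==-refl c)) (BP.∧-zeroʳ (S c c)))) (BP.xor-identityʳ (S c y)))
    ... | inj₂ e | inj₁ refl = sym (trans (cong₂ (λ u v → u xor ((S x c ∧ not (x == c)) ∧ v)) (trans (msym x c) (trans (row x) (sy c x))) (trans (cong (λ v → S c c ∧ not v) (==-refl c)) (BP.∧-zeroʳ (S c c))))
            (trans (cong (S x c xor_) (BP.∧-zeroʳ (S x c ∧ not (x == c)))) (BP.xor-identityʳ (S x c))))
    ... | inj₂ e | inj₂ e' rewrite ==-f e | ==-f e' = trans
      (taut 3 (λ { (s ∷ p ∷ q ∷ []) → s }) (λ { (s ∷ p ∷ q ∷ []) → (s xor (p ∧ q)) xor ((p ∧ true) ∧ (q ∧ true)) }) refl (S x y ∷ S x c ∷ S y c ∷ []))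
      (cong (λ u → (S x y xor (S x c ∧ u)) xor ((S x c ∧ true) ∧ (S y c ∧ true))) (sy y c))

-- A tool w₂ of the wrong parity is repaired by its own handle, unless the first loop of that handle is seen by w₁.
record Pair {n} (k : ℕ) (S : Mat n) (w₁ : Fin n) (ps₁ : List (Fin n)) (w₂ : Fin n) (ps₂ : List (Fin n)) (B Z : Subset n) : Set where
  field
    sy   : Sym S
    H₁   : Handle S w₁ ps₁ B
    H₂   : Handle S w₂ ps₂ Z
    Z⊆B  : ∀ x → x ∈ Z → x ∈ B
    w₂B  : w₂ ∈ B
    ps₂B : All (_∈ B) ps₂
    jZ   : Joined S Z
    c    : Fin n
    cZ   : c ∈ Z
    w₁c  : S w₁ c ≡ true
    same : ∀ z → z ∈ Z → S w₁ z ≡ S w₂ z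
    bad  : S w₁ w₂ ≡ not (S w₂ w₂)
    hi   : Hi (4 + k) S Z
  w₁B : w₁ ∉ B
  w₁B = All.head (Handle.out H₁)
  w₁≢ : ∀ {x} → x ∈ B → w₁ ≢ x
  w₁≢ h e = tf h (trans (cong B (sym e)) w₁B)
  w₂Z : w₂ ∉ Z
  w₂Z = All.head (Handle.out H₂)

∪-⊆ : ∀ {n} {A B : Subset n} {v} → (∀ x → x ∈ A → x ∈ B) → v ∈ B → ∀ x → x ∈ (A ∪ ｛ v ｝) → x ∈ B
∪-⊆ {A = A} s h x q with ∪-e A q
... | inj₁ a = s x a
... | inj₂ refl = h

twins : ∀ {n} {S : Mat n} {w₁ ps₁ w₂} {B Z : Subset n} {c} → Sym S → Handle S w₁ ps₁ B → (∀ x → x ∈ Z → x ∈ B) → w₂ ∈ B → w₂ ∉ Z →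
  (∀ z → z ∈ Z → S w₁ z ≡ S w₂ z) → Joined S Z → c ∈ Z → S w₁ c ≡ true → Twins S w₁ ps₁ w₂ B (Z ∪ ｛ w₂ ｝) Z
twins {Z = Z} {c} sy H s b nz same j hc q = record { sy = sy ; H = H ; R⊆B = ∪-⊆ {A = Z} s b ; Z⊆R = λ x h → ∪-l Z h ; w₂R = ∪-v Z _ ; w₂Z = nz
  ; same = same ; jR = conn-add sy j hc (trans (sym (same _ hc)) q) }

-- A step at vertices that vanish on Z, changing S w₁ w₂ or S w₂ w₂, repairs the parity.
repaired : ∀ {k n m} {S S₁ : Mat n} {w₁ ps₁ w₂ ps₂} {B Z : Subset n} → Pair k S w₁ ps₁ w₂ ps₂ B Z → Steps B m S S₁ →
  (∀ x y → x ∈ Z → y ∈ Z → S₁ x y ≡ S x y) → (∀ z → z ∈ Z → S₁ w₁ z ≡ S w₁ z) → (∀ z → z ∈ Z → S₁ w₂ z ≡ S w₂ z) →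
  S₁ w₁ w₂ ≡ S₁ w₂ w₂ → Better k (m + 2) S w₁ ps₁ B Z
repaired {k} P st eZ e₁ e₂ good = better-after st (merge k (twins (steps-sym sy st) (handle-steps sy (λ x h → h) st H₁) Z⊆B w₂B w₂Z
    (λ z h → trans (e₁ z h) (trans (same z h) (sym (e₂ z h)))) (joined-cong eZ jZ) cZ (trans (e₁ c cZ) w₁c)) good cZ (trans (e₁ c cZ) w₁c)
    (hi-weak (3 + k) (hi-cong (4 + k) eZ hi)))
  where open Pair P

zero-row : ∀ {n} {S : Mat n} {Z : Subset n} {p} → Sym S → (∀ z → z ∈ Z → S p z ≡ false) → ∀ {z} → z ∈ Z → S z p ≡ false
zero-row sy f {z} h = trans (sy z _) (f z h)

-- The vertex `p` sees `w₂`, but neither `w₁` nor `Z`. So the pivot at `p` toggles the loop of `w₂`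
-- and keeps the row of `w₁`, the traces and the entries in `Z`.
fix-loop : ∀ k {n} {S : Mat n} {w₁ ps₁ w₂ p l} {B Z : Subset n} → Pair k S w₁ ps₁ w₂ (p ∷ l) B Z → S p p ≡ true → S w₁ p ≡ false →
  Better k 3 S w₁ ps₁ B Z
fix-loop k {S = S} {w₁} {w₂ = w₂} {p} {l} {B} {Z} P lp nadj =
  repaired P (loop {m = 0} p pB i nil) (λ x y hx hy → loop-row sy i (zero-row sy pz hx) y) (λ z h → loop-row sy i nadj z)
    (λ z h → trans (msym w₂ z) (trans (loop-row sy i (zero-row sy pz h) w₂) (sy z w₂)))
    (trans (loop-row sy i nadj w₂) (trans bad (sym (trans (off w₂ w₂ w₂≢p w₂≢p) (trans (cong₂ (λ a b → S w₂ w₂ xor (a ∧ b)) w₂p (trans (sy p w₂) w₂p)) (xor-true (S w₂ w₂)))))))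
  where
  open Pair P
  i = isLoop {S = S} sy lp
  open IsLoop i using (msym; off; row)
  pB = All.head ps₂B
  pz = All.head (Handle.null H₂)
  w₂p = proj₁ (proj₁ (Handle.pth H₂))
  w₂≢p = All.head (proj₂ (proj₂ (proj₁ (Handle.pth H₂))))

-- If `w₂` is unlooped, the pivot on `w₂` and `p` adds the row of `w₂` to that of `w₁` on `Z`, where
-- `p` is null. If `w₂` is looped, the pivot at `w₂` gives `p` a loop and the trace of `w₂`; since
-- `w₁` sees `p`, this vertex takes the place of `w₂` in `merge-loop`.
fix-edge : ∀ k {n} {S : Mat n} {w₁ ps₁ w₂ p l} {B Z : Subset n} → Pair k S w₁ ps₁ w₂ (p ∷ l) B Z → S p p ≡ false → S w₁ p ≡ true →
  Better k 3 S w₁ ps₁ B Z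
fix-edge k {S = S} {w₁} {ps₁} {w₂} {p} {l} {B} {Z} P lp adj₁ with bool (S w₂ w₂)
... | inj₂ f = better-weak z≤n (finish k {m = 0} sy st H₁ (∪-⊆ {A = Z} Z⊆B pB) (λ x h → ∪-l Z h) (λ x h → h)
      (conn-add msym (joined-cong eZ jZ) cZ (trans (rowc c (Z≢ cZ w₂Z) (Z≢ cZ pZ)) (trans (sym (same c cZ)) w₁c)))
      (hi-weak (suc k) (hi-weak (2 + k) (hi-weak (3 + k) (hi-cong (4 + k) eZ hi)))) van p (∪-v Z p)
      (trans (msym w₁ p) (trans (rowc w₁ (w₁≢ w₂B) (w₁≢ pB)) (trans (sy w₂ w₁) (trans bad (cong not f))))))
  where
  open Pair P
  pB = All.head ps₂B
  pz = All.head (Handle.null H₂)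
  pZ = All.head (All.tail (Handle.out H₂))
  w₂p = proj₁ (proj₁ (Handle.pth H₂))
  i = isEdge {S = S} {w₂} {p} sy f lp w₂p
  open IsEdge i
  st = edge {m = 0} w₂ p w₂B pB i nil
  Z≢ : ∀ {z v} → z ∈ Z → v ∉ Z → z ≢ v
  Z≢ a b = ∈∉ {A = Z} a b
  eZ : ∀ x y → x ∈ Z → y ∈ Z → edgeM S w₂ p x y ≡ S x y
  eZ x y hx hy = trans (off x y (Z≢ hx w₂Z) (Z≢ hx pZ) (Z≢ hy w₂Z) (Z≢ hy pZ))
    (xf (S x y) (cong₂ _xor_ (∧f (S x w₂) (pz y hy)) (∧f' (S w₂ y) (zero-row sy pz hx))))
  van : ∀ z → z ∈ Z → edgeM S w₂ p w₁ z ≡ false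
  van z h = trans (off w₁ z (w₁≢ w₂B) (w₁≢ pB) (Z≢ h w₂Z) (Z≢ h pZ))
    (trans (cong₂ (λ a b → a xor (b xor (S w₁ p ∧ S w₂ z))) (same z h) (∧f (S w₁ w₂) (pz z h)))
      (trans (cong (λ a → S w₂ z xor (a ∧ S w₂ z)) adj₁) (BP.xor-same (S w₂ z))))
... | inj₁ t = better-after st (better-weak (s≤s z≤n) (merge-loop k T l₁ s₁ (hi-weak (2 + k) (hi-flip (3 + k) (λ x → S x w₂) (λ _ → false) (λ a _ b _ → a ∧ b) flip hi))))
  where
  open Pair P
  pB = All.head ps₂B
  pz = All.head (Handle.null H₂)
  pZ = All.head (All.tail (Handle.out H₂))
  w₂p = proj₁ (proj₁ (Handle.pth H₂))
  w₂≢p = All.head (proj₂ (proj₂ (proj₁ (Handle.pth H₂))))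
  i = isLoop {S = S} {w₂} sy t
  open IsLoop i using (msym; off; row)
  st = loop {m = 0} w₂ w₂B i nil
  S₁ = loopM S w₂
  n₁ : S w₁ w₂ ≡ false
  n₁ = trans bad (cong not t)
  Z≢ : ∀ {z v} → z ∈ Z → v ∉ Z → z ≢ v
  Z≢ a b = ∈∉ {A = Z} a b
  p≢ : p ≢ w₂
  p≢ e = w₂≢p (sym e)
  pw₂ = trans (sy p w₂) w₂p
  l₁ : S₁ p p ≡ true
  l₁ = trans (off p p p≢ p≢) (cong₂ _xor_ lp (cong₂ _∧_ pw₂ w₂p))
  s₁ : S₁ w₁ p ≡ true
  s₁ = trans (loop-row sy i n₁ p) adj₁
  R = (Z ∪ ｛ w₂ ｝) ∪ ｛ p ｝
  same₁ : ∀ z → z ∈ Z → S₁ w₁ z ≡ S₁ p z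
  same₁ z h = trans (loop-row sy i n₁ z) (trans (same z h) (sym (trans (off p z p≢ (Z≢ h w₂Z)) (cong₂ (λ a b → a xor (b ∧ S w₂ z)) (pz z h) pw₂))))
  jw : Joined S (Z ∪ ｛ w₂ ｝)
  jw = conn-add sy jZ cZ (trans (sym (same c cZ)) w₁c)
  T : Twins S₁ w₁ ps₁ p B R Z
  T = record { sy = msym ; H = handle-steps sy (λ x h → h) st H₁ ; R⊆B = ∪-⊆ {A = Z ∪ ｛ w₂ ｝} (∪-⊆ {A = Z} Z⊆B w₂B) pB
    ; Z⊆R = λ x h → ∪-l (Z ∪ ｛ w₂ ｝) (∪-l Z h) ; w₂R = ∪-v (Z ∪ ｛ w₂ ｝) p ; w₂Z = pZ ; same = same₁
    ; jR = loop-joined sy i (∪-l (Z ∪ ｛ w₂ ｝) (∪-v Z w₂)) (conn-add sy jw (∪-v Z w₂) pw₂) }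
  flip : ∀ x y → x ∈ Z → y ∈ Z → x ≢ y → S x y ≡ S₁ x y xor (S x w₂ ∧ S y w₂)
  flip x y a b _ = trans (taut 3 (λ { (s ∷ p ∷ q ∷ []) → s }) (λ { (s ∷ p ∷ q ∷ []) → (s xor (p ∧ q)) xor (p ∧ q) }) refl (S x y ∷ S x w₂ ∷ S w₂ y ∷ []))
    (cong₂ _xor_ (sym (off x y (Z≢ a w₂Z) (Z≢ b w₂Z))) (cong (S x w₂ ∧_) (sy w₂ y)))

module EdgeOnHandle {k n} {S : Mat n} {w₁ ps₁ w₂ p q l} {B Z : Subset n} (P : Pair k S w₁ ps₁ w₂ (p ∷ q ∷ l) B Z)
  (lp : S p p ≡ false) (lq : S q q ≡ false) (f : S w₁ p ≡ false) where
  open Pair P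
  open Handle H₂ using (pth; null; out)
  pB = All.head ps₂B
  qB = All.head (All.tail ps₂B)
  pz = All.head null
  qz = All.head (All.tail null)
  w₂p = proj₁ (proj₁ pth)
  w₂q = All.head (proj₁ (proj₂ (proj₁ pth)))
  w₂≢p = All.head (proj₂ (proj₂ (proj₁ pth)))
  w₂≢q = All.head (All.tail (proj₂ (proj₂ (proj₁ pth))))
  pq = proj₁ (proj₁ (proj₂ pth))
  i = isEdge {S = S} {p} {q} sy lp lq pq
  open IsEdge i
  st = edge {m = 0} p q pB qB i nil
  S₁ = edgeM S p q
  eZ : ∀ x y → x ∈ Z → y ∈ Z → S₁ x y ≡ S x y
  eZ x y hx hy = edge-row sy i (zero-row sy pz hx) (zero-row sy qz hx) y
  zsame : ∀ v {z} → z ∈ Z → S₁ v z ≡ S v z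
  zsame v {z} h = trans (msym v z) (trans (edge-row sy i (zero-row sy pz h) (zero-row sy qz h) v) (sy z v))
  good : S w₁ q ≡ true → S₁ w₁ w₂ ≡ S₁ w₂ w₂
  good g = trans (off w₁ w₂ (w₁≢ pB) (w₁≢ qB) w₂≢p w₂≢q)
    (trans (cong₂ _xor_ bad (cong₂ _xor_ (∧f' (S q w₂) f) (cong₂ _∧_ g (trans (sy p w₂) w₂p))))
      (trans (taut 1 (λ { (a ∷ []) → not a xor true }) (λ { (a ∷ []) → a }) refl (S w₂ w₂ ∷ []))
        (sym (trans (off w₂ w₂ w₂≢p w₂≢q w₂≢p w₂≢q) (xf (S w₂ w₂) (cong₂ _xor_ (∧f (S w₂ p) (trans (sy q w₂) w₂q)) (∧f' (S p w₂) w₂q)))))))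
  Far : Fin n → Set
  Far u = S p u ≡ false × u ≢ p × u ≢ q
  far : All Far l
  far = All.zipWith (λ { (a , b , c) → a , (λ e → b (sym e)) , (λ e → c (sym e)) })
    (proj₁ (proj₂ (proj₁ (proj₂ pth))) , All.zipWith id (All.tail (proj₂ (proj₂ (proj₁ (proj₂ pth)))) , q≢ l (proj₁ (proj₂ (proj₂ pth)))))
    where
    q≢ : ∀ l → Link S q l → All (q ≢_) l
    q≢ [] _ = []
    q≢ (s ∷ l) (_ , _ , d) = d
  inner : ∀ {u v} → Far u → Far v → S₁ u v ≡ S u v
  inner {u} {v} (a , b , c) (d , e , h) = trans (off u v b c e h) (xf (S u v) (cong₂ _xor_ (∧f' (S q v) (trans (sy u p) a)) (∧f (S u q) d)))
  diag : All (λ s → S₁ s s ≡ S s s) l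
  diag = All.map (λ a → inner a a) far
  path-inner : ∀ l → All Far l → Path S l → Path S₁ l
  path-inner [] _ _ = tt
  path-inner (s ∷ l) (a ∷ as) (k , pth') = link-cong l (All.map (inner a) as) k , path-inner l as pth'

-- Two consecutive unlooped vertices of the handle, both invisible to w₁, are pivoted out.
fix : ∀ k {n} {S : Mat n} {w₁ ps₁ w₂} ps₂ {B Z : Subset n} {q} → Pair k S w₁ ps₁ w₂ ps₂ B Z → FirstLoop S ps₂ q →
  Better k 4 S w₁ ps₁ B Z ⊎ (S w₁ q ≡ true)
fix k {S = S} {w₁} (p ∷ l) P (hit lp) with bool (S w₁ p)
... | inj₁ t = inj₂ t
... | inj₂ f = inj₁ (better-weak (s≤s (s≤s (s≤s z≤n))) (fix-loop k P lp f))
fix k {S = S} {w₁} (p ∷ l) P (miss lp r) with bool (S w₁ p)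
... | inj₁ t = inj₁ (better-weak (s≤s (s≤s (s≤s z≤n))) (fix-edge k P lp t))
fix k {n} {S} {w₁} {ps₁} {w₂} (p ∷ q ∷ l) {B} {Z} P (miss lp (hit lq)) | inj₂ f with bool (S w₁ q)
... | inj₁ t = inj₂ t
-- The pivot at `q` puts a loop on `p`. The handle of `w₂` is cut down to `p`, and `fix-loop`
-- applies.
... | inj₂ g = inj₁ (better-after st (fix-loop k {l = []} P₁ l₁ (trans (loop-row sy i g p) f)))
  where
  open Pair P
  open Handle H₂ using (pth; null; out)
  qB = All.head (All.tail ps₂B)
  pz = All.head null
  qz = All.head (All.tail null)
  w₂p = proj₁ (proj₁ pth)
  w₂q = All.head (proj₁ (proj₂ (proj₁ pth)))
  pq = proj₁ (proj₁ (proj₂ pth))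
  p≢q = All.head (proj₂ (proj₂ (proj₁ (proj₂ pth))))
  i = isLoop {S = S} {q} sy lq
  open IsLoop i using (msym; off; row)
  st = loop {m = 0} q qB i nil
  S₁ = loopM S q
  l₁ : S₁ p p ≡ true
  l₁ = trans (off p p p≢q p≢q) (cong₂ _xor_ lp (cong₂ _∧_ pq (trans (sy q p) pq)))
  eZ : ∀ x y → x ∈ Z → y ∈ Z → S₁ x y ≡ S x y
  eZ x y hx hy = loop-row sy i (zero-row sy qz hx) y
  zp : ∀ z → z ∈ Z → S₁ p z ≡ false
  zp z h = trans (msym p z) (trans (loop-row sy i (zero-row sy qz h) p) (zero-row sy pz h))
  P₁ : Pair k S₁ w₁ ps₁ w₂ (p ∷ []) B Z
  P₁ = record { sy = msym ; H₁ = handle-steps sy (λ x h → h) st H₁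
    ; H₂ = record { pth = (trans (loop-row sy i w₂q p) w₂p , [] , All.head (proj₂ (proj₂ (proj₁ pth))) ∷ []) , tt , tt
                  ; null = zp ∷ [] ; out = All.head out ∷ All.head (All.tail out) ∷ [] }
    ; Z⊆B = Z⊆B ; w₂B = w₂B ; ps₂B = All.head ps₂B ∷ [] ; jZ = joined-cong eZ jZ ; c = c ; cZ = cZ ; w₁c = trans (loop-row sy i g c) w₁c
    ; same = λ z h → trans (loop-row sy i g z) (trans (same z h) (sym (loop-row sy i w₂q z)))
    ; bad = trans (loop-row sy i g w₂) (trans bad (cong not (sym (loop-row sy i w₂q w₂)))) ; hi = hi-cong (4 + k) eZ hi }
fix k {S = S} {w₁} (p ∷ q ∷ l) P (miss lp (miss lq r)) | inj₂ f with bool (S w₁ q)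
-- Since `w₁` sees `q` and `w₂` sees `p`, the pivot on `p` and `q` toggles `S w₁ w₂`, while the loop
-- of `w₂` stays.
... | inj₁ g = inj₁ (better-weak (s≤s (s≤s z≤n)) (repaired P st eZ (λ z h → zsame _ h) (λ z h → zsame _ h) (good g)))
  where open EdgeOnHandle P lp lq f
fix k {S = S} {w₁} {w₂ = w₂} (p ∷ q ∷ s ∷ l) {B} {Z} {ℓ} P (miss lp (miss lq r)) | inj₂ f | inj₂ g =
  conclude (fix k (s ∷ l) P₁ (firstLoop-cong diag r))
  where
  open EdgeOnHandle P lp lq f
  open Pair P
  open Handle H₂ using (pth; null; out)
  open IsEdge i using (msym; off)
  row₁ : ∀ y → S₁ w₁ y ≡ S w₁ y
  row₁ = edge-row sy i f g
  Lw = proj₁ pth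
  Lq = proj₁ (proj₂ (proj₂ pth))
  w₂≢ = All.tail (All.tail (proj₂ (proj₂ Lw)))
  toW₂ : ∀ {u} → S w₂ u ≡ false → Far u → S₁ w₂ u ≡ S q u
  toW₂ {u} a (b , c , d) = trans (off w₂ u w₂≢p w₂≢q c d) (trans (cong₂ _xor_ a (cong₂ _xor_ (cong (_∧ S q u) w₂p) (∧f (S w₂ q) b))) (BP.xor-identityʳ (S q u)))
  w₂0 = All.tail (proj₁ (proj₂ Lw))
  link : Link S₁ w₂ (s ∷ l)
  link = trans (toW₂ (All.head w₂0) (All.head far)) (proj₁ Lq) ,
    All.zipWith (λ { ((a , b) , c) → trans (toW₂ a b) c }) (All.zipWith id (All.tail w₂0 , All.tail far) , proj₁ (proj₂ Lq)) , w₂≢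
  P₁ : Pair k S₁ w₁ _ w₂ (s ∷ l) B Z
  P₁ = record { sy = msym ; H₁ = handle-steps sy (λ x h → h) st H₁
    ; H₂ = record { pth = link , path-inner (s ∷ l) far (proj₂ (proj₂ (proj₂ pth)))
                  ; null = All.map (λ {u} a z h → trans (zsame u h) (a z h)) (All.tail (All.tail null)) ; out = All.head out ∷ All.tail (All.tail (All.tail out)) }
    ; Z⊆B = Z⊆B ; w₂B = w₂B ; ps₂B = All.tail (All.tail ps₂B) ; jZ = joined-cong eZ jZ ; c = c ; cZ = cZ ; w₁c = trans (row₁ c) w₁c
    ; same = λ z h → trans (row₁ z) (trans (same z h) (sym (zsame w₂ h)))
    ; bad = trans (row₁ w₂) (trans bad (cong not (sym (trans (off w₂ w₂ w₂≢p w₂≢q w₂≢p w₂≢q) (xf (S w₂ w₂) (cong₂ _xor_ (∧f (S w₂ p) (trans (sy q w₂) w₂q)) (∧f' (S p w₂) w₂q)))))))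
    ; hi = hi-cong (4 + k) eZ hi }
  conclude : Better k 4 S₁ w₁ _ B Z ⊎ (S₁ w₁ ℓ ≡ true) → Better k 4 S w₁ _ B Z ⊎ (S w₁ ℓ ≡ true)
  conclude (inj₁ b) = inj₁ (better-after st b)
  conclude (inj₂ h) = inj₂ (trans (sym (row₁ ℓ)) h)

-- Pivoting graphs, and the matrix S = G * v read through a supply of twins of v

lc-off : ∀ {n} (G : Graph n) v {x y} → x ≢ y → lcAdj G v x y ≡ adj G x y xor (adj G v x ∧ adj G v y)
lc-off G v h rewrite ==-f h = refl

pivot-edge : ∀ {n} (G : Graph n) u v → adj G u v ≡ true → IsEdge (adj G) u v (adj (pivot G u v))
pivot-edge {n} G u v e = record
  { msym = adj-sym (pivot G u v) ; ub = adj-irrefl G u ; uc = adj-irrefl G v ; bc = e ; off = of ; rowb = rb ; rowc = rc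
  ; bc' = trans (lc-off G₂ u u≢v) (cong₂ _xor_ g₂uv (cong (_∧ adj G₂ u v) (adj-irrefl G₂ u)))
  ; bb' = adj-irrefl (pivot G u v) u ; cc' = adj-irrefl (pivot G u v) v }
  where
  A = adj G
  G₁ = localComp G u
  G₂ = localComp G₁ v
  u≢v : u ≢ v
  u≢v refl = tf e (adj-irrefl G u)
  g₁v : ∀ {x} → x ≢ v → adj G₁ v x ≡ A v x xor A u x
  g₁v {x} h = trans (lc-off G u (λ q → h (sym q))) (cong (λ a → A v x xor (a ∧ A u x)) e)
  g₁vu : adj G₁ v u ≡ true
  g₁vu = trans (g₁v u≢v) (cong₂ _xor_ (trans (adj-sym G v u) e) (adj-irrefl G u))
  g₁u : ∀ {x} → x ≢ u → adj G₁ u x ≡ A u x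
  g₁u {x} h = trans (lc-off G u (λ q → h (sym q))) (xf (A u x) (∧f' (A u x) (adj-irrefl G u)))
  g₂u : ∀ {x} → x ≢ u → x ≢ v → adj G₂ u x ≡ A v x
  g₂u {x} h h' = trans (lc-off G₁ v (λ q → h (sym q))) (trans (cong₂ _xor_ (g₁u h) (cong₂ _∧_ g₁vu (g₁v h')))
    (taut 2 (λ { (p ∷ q ∷ []) → p xor (true ∧ (q xor p)) }) (λ { (p ∷ q ∷ []) → q }) refl (A u x ∷ A v x ∷ [])))
  g₂uv : adj G₂ u v ≡ true
  g₂uv = trans (lc-off G₁ v u≢v) (cong₂ _xor_ (trans (g₁u (λ q → u≢v (sym q))) e) (∧f (adj G₁ v u) (adj-irrefl G₁ v)))
  of : ∀ x y → x ≢ u → x ≢ v → y ≢ u → y ≢ v → adj (pivot G u v) x y ≡ A x y xor ((A x u ∧ A v y) xor (A x v ∧ A u y))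
  of x y p q r s with eq? x y
  ... | inj₁ refl = trans (adj-irrefl (pivot G u v) x) (sym (trans (cong₂ (λ a b → a xor ((A x u ∧ A v x) xor b)) (adj-irrefl G x)
          (trans (cong₂ _∧_ (adj-sym G x v) (adj-sym G u x)) (BP.∧-comm (A v x) (A x u)))) (BP.xor-same (A x u ∧ A v x))))
  ... | inj₂ ne = trans (lc-off G₂ u ne) (trans (cong₂ _xor_ (trans (lc-off G₁ v ne) (cong₂ _xor_ (lc-off G u ne) (cong₂ _∧_ (g₁v q) (g₁v s))))
          (cong₂ _∧_ (g₂u p q) (g₂u r s)))
        (trans (taut 5 (λ { (a ∷ xu ∷ yu ∷ xv ∷ yv ∷ []) → ((a xor (xu ∧ yu)) xor ((xv xor xu) ∧ (yv xor yu))) xor (xv ∧ yv) })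
            (λ { (a ∷ xu ∷ yu ∷ xv ∷ yv ∷ []) → a xor ((xu ∧ yv) xor (xv ∧ yu)) }) refl (A x y ∷ A u x ∷ A u y ∷ A v x ∷ A v y ∷ []))
          (cong₂ (λ a b → A x y xor ((a ∧ A v y) xor (b ∧ A u y))) (adj-sym G u x) (adj-sym G v x))))
  rb : ∀ y → y ≢ u → y ≢ v → adj (pivot G u v) u y ≡ A v y
  rb y p q = trans (lc-off G₂ u (λ z → p (sym z))) (trans (cong₂ _xor_ (g₂u p q) (∧f' (adj G₂ u y) (adj-irrefl G₂ u))) (BP.xor-identityʳ (A v y)))
  rc : ∀ y → y ≢ u → y ≢ v → adj (pivot G u v) v y ≡ A u y
  rc y p q = trans (lc-off G₂ u (λ z → q (sym z))) (trans (cong₂ _xor_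
      (trans (lc-off G₁ v (λ z → q (sym z))) (trans (cong₂ _xor_ (g₁v q) (∧f' (adj G₁ v y) (adj-irrefl G₁ v))) (BP.xor-identityʳ (A v y xor A u y))))
      (cong₂ _∧_ g₂uv (g₂u p q)))
    (taut 2 (λ { (a ∷ b ∷ []) → (a xor b) xor (true ∧ a) }) (λ { (a ∷ b ∷ []) → b }) refl (A v y ∷ A u y ∷ [])))

-- The set `B` remembers where the pivots take place, so that handles built around it can be carried
-- along.
data PivIn {n} (B : Subset n) : Graph n → Graph n → Set where
  nil  : ∀ {G} → PivIn B G G
  step : ∀ {G G'} u v → u ∈ B → v ∈ B → adj G u v ≡ true → PivIn B (pivot G u v) G' → PivIn B G G'

piv-++ : ∀ {n} {B : Subset n} {G G₁ G₂} → PivIn B G G₁ → PivIn B G₁ G₂ → PivIn B G G₂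
piv-++ nil q = q
piv-++ (step u v h h' e p) q = step u v h h' e (piv-++ p q)

piv-⊆ : ∀ {n} {B B' : Subset n} {G G'} → (∀ x → x ∈ B → x ∈ B') → PivIn B G G' → PivIn B' G G'
piv-⊆ s nil = nil
piv-⊆ s (step u v h h' e p) = step u v (s u h) (s v h') e (piv-⊆ s p)

piv-minor : ∀ {n h} {B : Subset n} {G G' : Graph n} {H : Graph h} → PivIn B G G' → PivotMinor H G' → PivotMinor H G
piv-minor nil m = m
piv-minor (step u v _ _ e p) m = let (k , G' , r , i) = piv-minor p m in k , G' , piv u v e r , i

piv-steps : ∀ {n} {B : Subset n} {G G'} → PivIn B G G' → Steps B 0 (adj G) (adj G')
piv-steps nil = nil
piv-steps {G = G} (step u v h h' e p) = edge u v h h' (pivot-edge G u v e) (piv-steps p)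

-- On Y, S is g * v with a loop at every neighbour of v. The T i are true twins of v: pivoting g on the edge T i b
-- is the principal pivot of S at the looped vertex b.
record Rep {n} (m : ℕ) (g : Mat n) (v : Fin n) (T : Fin m → Fin n) (S : Mat n) (Y : Subset n) : Set where
  field
    sy : Sym S
    gs : Sym g
    v∉ : v ∉ Y
    T∉ : ∀ i → T i ∉ Y
    vT : ∀ i → g v (T i) ≡ true
    TT : ∀ i j → i ≢ j → g (T i) (T j) ≡ true
    vY : ∀ y → y ∈ Y → g v y ≡ S y y
    TY : ∀ i y → y ∈ Y → g (T i) y ≡ S y y
    YY : ∀ x y → x ∈ Y → y ∈ Y → x ≢ y → g x y ≡ S x y xor (S x x ∧ S y y)

rep-loop : ∀ {n m} {g g' S S' : Mat n} {v T} {Y : Subset n} {b} → Rep (suc m) g v T S Y → b ∈ Y → IsLoop S b S' → IsEdge g (T zero) b g' →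
  Rep m g' v (T ∘ suc) S' Y
rep-loop {n} {m} {g} {g'} {S} {S'} {v} {T} {Y} {b} r hb L E = record
  { sy = L.msym ; gs = E.msym ; v∉ = v∉ ; T∉ = λ i → T∉ (suc i) ; vT = λ i → clique v (T (suc i)) (vT zero) v∉ (vY b hb) (tt' i) (T∉ (suc i)) (TY (suc i) b hb) (vT (suc i))
  ; TT = λ i j ne → clique (T (suc i)) (T (suc j)) (tt' i) (T∉ (suc i)) (TY (suc i) b hb) (tt' j) (T∉ (suc j)) (TY (suc j) b hb) (TT _ _ (λ { refl → ne refl }))
  ; vY = twin v (vT zero) v∉ vY ; TY = λ i → twin (T (suc i)) (tt' i) (T∉ (suc i)) (TY (suc i)) ; YY = yy }
  where
  open Rep r
  module L = IsLoop L
  module E = IsEdge E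
  t = T zero
  tt' : ∀ i → g (T (suc i)) t ≡ true
  tt' i = TT (suc i) zero (λ ())
  g-irr : ∀ {w} → g w t ≡ true → w ≢ t
  g-irr h refl = tf h E.ub
  Y≢t : ∀ {y} → y ∈ Y → y ≢ t
  Y≢t h = ∈∉ {A = Y} h (T∉ zero)
  w≢b : ∀ {w} → w ∉ Y → w ≢ b
  w≢b h e = ∈∉ {A = Y} hb h (sym e)
  gby : ∀ y → y ∈ Y → y ≢ b → g b y ≡ S b y xor S y y
  gby y h ne = trans (YY b y hb h (λ e → ne (sym e))) (cong (λ a → S b y xor (a ∧ S y y)) L.lp)
  clique : ∀ w w' → g w t ≡ true → w ∉ Y → g w b ≡ S b b → g w' t ≡ true → w' ∉ Y → g w' b ≡ S b b → g w w' ≡ true → g' w w' ≡ true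
  clique w w' a nw wb a' nw' wb' e = trans (E.off w w' (g-irr a) (w≢b nw) (g-irr a') (w≢b nw'))
    (cong₂ _xor_ e (cong₂ _xor_ (cong₂ _∧_ a (trans (gs b w') (trans wb' L.lp))) (cong₂ _∧_ (trans wb L.lp) (trans (gs t w') a'))))
  twin : ∀ w → g w t ≡ true → w ∉ Y → (∀ y → y ∈ Y → g w y ≡ S y y) → ∀ y → y ∈ Y → g' w y ≡ S' y y
  twin w a nw wy y h with eq? y b
  ... | inj₁ refl = trans (E.msym w y) (trans (E.rowc w (g-irr a) (w≢b nw)) (trans (gs t w) (trans a (sym (trans (L.row y) L.lp)))))
  ... | inj₂ ne = trans (E.off w y (g-irr a) (w≢b nw) (Y≢t h) ne)
    (trans (cong₂ _xor_ (wy y h) (cong₂ _xor_ (cong₂ _∧_ a (gby y h ne)) (cong₂ _∧_ (trans (wy b hb) L.lp) (TY zero y h))))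
    (trans (taut 2 (λ { (p ∷ q ∷ []) → p xor ((true ∧ (q xor p)) xor (true ∧ p)) }) (λ { (p ∷ q ∷ []) → p xor (q ∧ q) }) refl (S y y ∷ S b y ∷ []))
      (sym (trans (L.off y y ne ne) (cong (λ a → S y y xor (a ∧ S b y)) (sy y b))))))
  diag' : ∀ y → y ≢ b → S' y y ≡ S y y xor S b y
  diag' y ne = trans (L.off y y ne ne) (trans (cong (λ a → S y y xor (a ∧ S b y)) (sy y b)) (cong (S y y xor_) (BP.∧-idem (S b y))))
  yb : ∀ y → y ∈ Y → y ≢ b → g' b y ≡ S' b y xor (S' b b ∧ S' y y)
  yb y h ne = trans (E.rowc y (Y≢t h) ne) (trans (TY zero y h)
    (trans (taut 2 (λ { (p ∷ q ∷ []) → p }) (λ { (p ∷ q ∷ []) → q xor (true ∧ (p xor q)) }) refl (S y y ∷ S b y ∷ []))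
      (sym (cong₂ _xor_ (L.row y) (cong₂ _∧_ (trans (L.row b) L.lp) (diag' y ne))))))
  yy : ∀ x y → x ∈ Y → y ∈ Y → x ≢ y → g' x y ≡ S' x y xor (S' x x ∧ S' y y)
  yy x y hx hy ne with eq? x b | eq? y b
  ... | inj₁ refl | inj₁ refl = ⊥-elim (ne refl)
  ... | inj₁ refl | inj₂ nb = yb y hy nb
  ... | inj₂ nb | inj₁ refl = trans (E.msym x y) (trans (yb x hx nb) (cong₂ _xor_ (L.msym y x) (BP.∧-comm (S' y y) (S' x x))))
  ... | inj₂ nx | inj₂ ny = trans (E.off x y (Y≢t hx) nx (Y≢t hy) ny)
    (trans (cong₂ _xor_ (YY x y hx hy ne) (cong₂ _xor_ (cong₂ _∧_ (trans (gs x t) (TY zero x hx)) (gby y hy ny)) (cong₂ _∧_ (trans (gs x b) (gby x hx nx)) (TY zero y hy))))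
    (trans (taut 5 (λ { (s ∷ p ∷ q ∷ x ∷ y ∷ []) → (s xor (p ∧ q)) xor ((p ∧ (y xor q)) xor ((x xor p) ∧ q)) })
       (λ { (s ∷ p ∷ q ∷ x ∷ y ∷ []) → (s xor (x ∧ y)) xor ((p xor x) ∧ (q xor y)) }) refl (S x y ∷ S x x ∷ S y y ∷ S b x ∷ S b y ∷ []))
      (sym (cong₂ _xor_ (trans (L.off x y nx ny) (cong (λ a → S x y xor (a ∧ S b y)) (sy x b))) (cong₂ _∧_ (diag' x nx) (diag' y ny))))))

-- The twins do not see the pivoted vertices, or the pivot acts on S by two loops.
module RepEdge {n m} {g g' S : Mat n} {v T} {Y : Subset n} {c d} (r : Rep m g v T S Y) (hc : c ∈ Y) (hd : d ∈ Y) (E : IsEdge g c d g') where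
  open Rep r
  module E = IsEdge E
  c≢d = edge-≢ E
  λc = S c c
  λd = S d d
  gcd : S c d xor (λc ∧ λd) ≡ true
  gcd = trans (sym (YY c d hc hd c≢d)) E.bc

  -- The frame shared by both cases. Entries between `v` and the twins change by `λc ∧ λd` twice,
  -- that is, not at all; what concerns `Y` is left as equations for `S'`.
  build : ∀ {S'} → Sym S' → (∀ y → y ∈ Y → y ≢ c → y ≢ d → S' y y ≡ S y y xor ((λc ∧ g d y) xor (λd ∧ g c y))) → S' c c ≡ λd → S' d d ≡ λc →
    (∀ x y → x ∈ Y → y ∈ Y → x ≢ c → x ≢ d → y ≢ c → y ≢ d → x ≢ y → g x y xor ((g x c ∧ g d y) xor (g x d ∧ g c y)) ≡ S' x y xor (S' x x ∧ S' y y)) →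
    (∀ y → y ∈ Y → y ≢ c → y ≢ d → g d y ≡ S' c y xor (S' c c ∧ S' y y)) → (∀ y → y ∈ Y → y ≢ c → y ≢ d → g c y ≡ S' d y xor (S' d d ∧ S' y y)) →
    true ≡ S' c d xor (S' c c ∧ S' d d) → Rep m g' v T S' Y
  build {S'} sy' dg dc dd ff fc fd fcd = record
    { sy = sy' ; gs = E.msym ; v∉ = v∉ ; T∉ = T∉ ; vT = λ i → clique v (T i) v∉ (T∉ i) vY (TY i) (vT i)
    ; TT = λ i j ne → clique (T i) (T j) (T∉ i) (T∉ j) (TY i) (TY j) (TT i j ne) ; vY = twin v v∉ vY ; TY = λ i → twin (T i) (T∉ i) (TY i) ; YY = yy }
    where
    off≢ : ∀ {w y} → w ∉ Y → y ∈ Y → w ≢ y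
    off≢ nw h e = ∈∉ {A = Y} h nw (sym e)
    clique : ∀ w w' → w ∉ Y → w' ∉ Y → (∀ y → y ∈ Y → g w y ≡ S y y) → (∀ y → y ∈ Y → g w' y ≡ S y y) → g w w' ≡ true → g' w w' ≡ true
    clique w w' nw nw' wy wy' e = trans (E.off w w' (off≢ nw hc) (off≢ nw hd) (off≢ nw' hc) (off≢ nw' hd))
      (trans (cong₂ _xor_ e (trans (cong₂ _xor_ (cong₂ _∧_ (wy c hc) (trans (gs d w') (wy' d hd))) (cong₂ _∧_ (wy d hd) (trans (gs c w') (wy' c hc))))
        (trans (cong (λc ∧ λd xor_) (BP.∧-comm λd λc)) (BP.xor-same (λc ∧ λd))))) refl)
    twin : ∀ w → w ∉ Y → (∀ y → y ∈ Y → g w y ≡ S y y) → ∀ y → y ∈ Y → g' w y ≡ S' y y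
    twin w nw wy y h with eq? y c | eq? y d
    ... | inj₁ refl | _ = trans (E.msym w y) (trans (E.rowb w (off≢ nw hc) (off≢ nw hd)) (trans (gs d w) (trans (wy d hd) (sym dc))))
    ... | inj₂ _ | inj₁ refl = trans (E.msym w y) (trans (E.rowc w (off≢ nw hc) (off≢ nw hd)) (trans (gs c w) (trans (wy c hc) (sym dd))))
    ... | inj₂ nc | inj₂ nd = trans (E.off w y (off≢ nw hc) (off≢ nw hd) nc nd)
      (trans (cong₂ _xor_ (wy y h) (cong₂ _xor_ (cong (_∧ g d y) (wy c hc)) (cong (_∧ g c y) (wy d hd)))) (sym (dg y h nc nd)))
    yy : ∀ x y → x ∈ Y → y ∈ Y → x ≢ y → g' x y ≡ S' x y xor (S' x x ∧ S' y y)
    flip : ∀ x y → g' x y ≡ S' x y xor (S' x x ∧ S' y y) → g' y x ≡ S' y x xor (S' y y ∧ S' x x)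
    flip x y e = trans (E.msym y x) (trans e (cong₂ _xor_ (sy' x y) (BP.∧-comm (S' x x) (S' y y))))
    yy x y hx hy ne with eq? x c | eq? x d | eq? y c | eq? y d
    ... | inj₁ refl | _ | inj₁ refl | _ = ⊥-elim (ne refl)
    ... | inj₁ refl | _ | inj₂ _ | inj₁ refl = trans E.bc' fcd
    ... | inj₁ refl | _ | inj₂ p | inj₂ q = trans (E.rowb y p q) (fc y hy p q)
    ... | inj₂ _ | inj₁ refl | inj₁ refl | _ = flip y x (trans E.bc' fcd)
    ... | inj₂ _ | inj₁ refl | inj₂ _ | inj₁ refl = ⊥-elim (ne refl)
    ... | inj₂ _ | inj₁ refl | inj₂ p | inj₂ q = trans (E.rowc y p q) (fd y hy p q)
    ... | inj₂ p | inj₂ q | inj₁ refl | _ = flip y x (trans (E.rowb x p q) (fc x hx p q))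
    ... | inj₂ p | inj₂ q | inj₂ _ | inj₁ refl = flip y x (trans (E.rowc x p q) (fd x hx p q))
    ... | inj₂ p | inj₂ q | inj₂ p' | inj₂ q' = trans (E.off x y p q p' q') (ff x y hx hy p q p' q' ne)

  gyc : ∀ y → y ∈ Y → y ≢ c → g c y ≡ S c y xor (λc ∧ S y y)
  gyc y h ne = YY c y hc h (λ e → ne (sym e))
  gyd : ∀ y → y ∈ Y → y ≢ d → g d y ≡ S d y xor (λd ∧ S y y)
  gyd y h ne = YY d y hd h (λ e → ne (sym e))

  plain : ∀ {S'} → λc ≡ false → λd ≡ false → IsEdge S c d S' → Rep m g' v T S' Y
  plain {S'} lc ld F = build F.msym
      (λ y h p q → trans (diag y p q) (sym (xf (S y y) (cong₂ _xor_ (∧f' (g d y) lc) (∧f' (g c y) ld)))))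
      (trans F.bb' (sym ld)) (trans F.cc' (sym lc)) ff
      (λ y h p q → trans (gd y h q) (sym (trans (xf (S' c y) (∧f' (S' y y) F.bb')) (F.rowb y p q))))
      (λ y h p q → trans (gc y h p) (sym (trans (xf (S' d y) (∧f' (S' y y) F.cc')) (F.rowc y p q))))
      (sym (trans (xf (S' c d) (∧f' (S' d d) F.bb')) F.bc'))
    where
    module F = IsEdge F
    gc : ∀ y → y ∈ Y → y ≢ c → g c y ≡ S c y
    gc y h p = trans (gyc y h p) (xf (S c y) (∧f' (S y y) lc))
    gd : ∀ y → y ∈ Y → y ≢ d → g d y ≡ S d y
    gd y h p = trans (gyd y h p) (xf (S d y) (∧f' (S y y) ld))
    diag : ∀ y → y ≢ c → y ≢ d → S' y y ≡ S y y
    diag y p q = trans (F.off y y p q p q) (xf (S y y) (trans (cong₂ _xor_ (cong₂ _∧_ (sy y c) (sy d y)) refl)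
      (trans (cong (_xor (S y d ∧ S c y)) (BP.∧-comm (S c y) (S y d))) (BP.xor-same (S y d ∧ S c y)))))
    ff : ∀ x y → x ∈ Y → y ∈ Y → x ≢ c → x ≢ d → y ≢ c → y ≢ d → x ≢ y → g x y xor ((g x c ∧ g d y) xor (g x d ∧ g c y)) ≡ S' x y xor (S' x x ∧ S' y y)
    ff x y hx hy p q p' q' ne = trans (cong₂ _xor_ (YY x y hx hy ne) (cong₂ _xor_
        (cong₂ _∧_ (trans (gs x c) (trans (gc x hx p) (sy c x))) (gd y hy q')) (cong₂ _∧_ (trans (gs x d) (trans (gd x hx q) (sy d x))) (gc y hy p'))))
      (trans (taut 3 (λ { (a ∷ b ∷ c ∷ []) → (a xor b) xor c }) (λ { (a ∷ b ∷ c ∷ []) → (a xor c) xor b }) refl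
          (S x y ∷ (S x x ∧ S y y) ∷ ((S x c ∧ S d y) xor (S x d ∧ S c y)) ∷ []))
        (sym (cong₂ _xor_ (F.off x y p q p' q') (cong₂ _∧_ (diag x p q) (diag y p' q')))))

  looped : ∀ {S₁ S₂} → λc ≡ true → IsLoop S c S₁ → IsLoop S₁ d S₂ → Rep m g' v T S₂ Y
  looped {S₁} {S₂} lc F₁ F₂ = build F₂.msym
      (λ y h p q → trans (diag y p q) (trans
        (taut 4 (λ { (y ∷ ld ∷ dy ∷ cy ∷ []) → y xor (cy xor (dy xor (cy ∧ not ld))) }) (λ { (y ∷ ld ∷ dy ∷ cy ∷ []) → y xor ((true ∧ (dy xor (ld ∧ y))) xor (ld ∧ (cy xor (true ∧ y)))) }) refl
          (S y y ∷ λd ∷ S d y ∷ S c y ∷ []))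
        (cong (S y y xor_) (sym (cong₂ _xor_ (cong₂ _∧_ lc (gyd y h q)) (cong (λd ∧_) (gc y h p)))))))
      S₂cc (trans (F₂.row d) (trans S₁dd (sym lc))) ff fc fd
      (sym (trans (cong₂ _xor_ (trans (F₂.msym c d) (trans (F₂.row c) (trans (F₁.msym d c) (trans (F₁.row d) scd)))) (cong₂ _∧_ S₂cc (trans (F₂.row d) S₁dd)))
        (taut 1 (λ { (a ∷ []) → not a xor (a ∧ true) }) (λ _ → true) refl (λd ∷ []))))
    where
    module F₁ = IsLoop F₁
    module F₂ = IsLoop F₂
    d≢c : d ≢ c
    d≢c e = c≢d (sym e)
    scd : S c d ≡ not λd
    scd = trans (taut 2 (λ { (a ∷ b ∷ []) → a }) (λ { (a ∷ b ∷ []) → (a xor (true ∧ b)) xor b }) refl (S c d ∷ λd ∷ []))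
      (cong (_xor λd) (trans (cong (λ a → S c d xor (a ∧ λd)) (sym lc)) gcd))
    gc : ∀ y → y ∈ Y → y ≢ c → g c y ≡ S c y xor (true ∧ S y y)
    gc y h p = trans (gyc y h p) (cong (λ a → S c y xor (a ∧ S y y)) lc)
    S₁d : ∀ y → y ≢ c → S₁ d y ≡ S d y xor (not λd ∧ S c y)
    S₁d y p = trans (F₁.off d y d≢c p) (cong (λ a → S d y xor (a ∧ S c y)) (trans (sy d c) scd))
    S₁dd : S₁ d d ≡ true
    S₁dd = trans (S₁d d d≢c) (trans (cong (λ a → λd xor (not λd ∧ a)) scd) (taut 1 (λ { (a ∷ []) → a xor (not a ∧ not a) }) (λ _ → true) refl (λd ∷ [])))
    S₁cd : S₁ c d ≡ not λd
    S₁cd = trans (F₁.row d) scd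
    S₂cc : S₂ c c ≡ λd
    S₂cc = trans (F₂.off c c c≢d c≢d) (trans (cong₂ _xor_ (trans (F₁.row c) lc) (cong₂ _∧_ S₁cd (trans (F₁.msym d c) S₁cd)))
      (taut 1 (λ { (a ∷ []) → true xor (not a ∧ not a) }) (λ { (a ∷ []) → a }) refl (λd ∷ [])))
    S₂xy : ∀ x y → x ≢ c → x ≢ d → y ≢ c → y ≢ d → S₂ x y ≡ (S x y xor (S c x ∧ S c y)) xor ((S d x xor (not λd ∧ S c x)) ∧ (S d y xor (not λd ∧ S c y)))
    S₂xy x y p q p' q' = trans (F₂.off x y q q') (cong₂ _xor_ (trans (F₁.off x y p p') (cong (λ a → S x y xor (a ∧ S c y)) (sy x c)))
      (cong₂ _∧_ (trans (F₁.msym x d) (S₁d x p)) (S₁d y p')))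
    diag : ∀ y → y ≢ c → y ≢ d → S₂ y y ≡ S y y xor (S c y xor (S d y xor (S c y ∧ not λd)))
    diag y p q = trans (S₂xy y y p q p q) (taut 4 (λ { (y ∷ ld ∷ dy ∷ cy ∷ []) → (y xor (cy ∧ cy)) xor ((dy xor (not ld ∧ cy)) ∧ (dy xor (not ld ∧ cy))) })
      (λ { (y ∷ ld ∷ dy ∷ cy ∷ []) → y xor (cy xor (dy xor (cy ∧ not ld))) }) refl (S y y ∷ λd ∷ S d y ∷ S c y ∷ []))
    fc : ∀ y → y ∈ Y → y ≢ c → y ≢ d → g d y ≡ S₂ c y xor (S₂ c c ∧ S₂ y y)
    fc y h p q = trans (gyd y h q) (trans
      (taut 4 (λ { (y ∷ ld ∷ dy ∷ cy ∷ []) → dy xor (ld ∧ y) })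
        (λ { (y ∷ ld ∷ dy ∷ cy ∷ []) → (cy xor (not ld ∧ (dy xor (not ld ∧ cy)))) xor (ld ∧ (y xor (cy xor (dy xor (cy ∧ not ld))))) }) refl (S y y ∷ λd ∷ S d y ∷ S c y ∷ []))
      (sym (cong₂ _xor_ (trans (F₂.off c y c≢d q) (cong₂ _xor_ (F₁.row y) (cong₂ _∧_ S₁cd (S₁d y p)))) (cong₂ _∧_ S₂cc (diag y p q)))))
    fd : ∀ y → y ∈ Y → y ≢ c → y ≢ d → g c y ≡ S₂ d y xor (S₂ d d ∧ S₂ y y)
    fd y h p q = trans (gc y h p) (trans
      (taut 4 (λ { (y ∷ ld ∷ dy ∷ cy ∷ []) → cy xor (true ∧ y) })
        (λ { (y ∷ ld ∷ dy ∷ cy ∷ []) → (dy xor (not ld ∧ cy)) xor (true ∧ (y xor (cy xor (dy xor (cy ∧ not ld))))) }) refl (S y y ∷ λd ∷ S d y ∷ S c y ∷ []))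
      (sym (cong₂ _xor_ (trans (F₂.row y) (S₁d y p)) (cong₂ _∧_ (trans (F₂.row d) S₁dd) (diag y p q)))))
    ff : ∀ x y → x ∈ Y → y ∈ Y → x ≢ c → x ≢ d → y ≢ c → y ≢ d → x ≢ y → g x y xor ((g x c ∧ g d y) xor (g x d ∧ g c y)) ≡ S₂ x y xor (S₂ x x ∧ S₂ y y)
    ff x y hx hy p q p' q' ne = trans (cong₂ _xor_ (YY x y hx hy ne) (cong₂ _xor_
        (cong₂ _∧_ (trans (gs x c) (gc x hx p)) (gyd y hy q')) (cong₂ _∧_ (trans (gs x d) (gyd x hx q)) (gc y hy p'))))
      (trans (taut 8 (λ { (s ∷ x ∷ y ∷ ld ∷ dx ∷ cx ∷ dy ∷ cy ∷ []) → (s xor (x ∧ y)) xor (((cx xor (true ∧ x)) ∧ (dy xor (ld ∧ y))) xor ((dx xor (ld ∧ x)) ∧ (cy xor (true ∧ y)))) })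
          (λ { (s ∷ x ∷ y ∷ ld ∷ dx ∷ cx ∷ dy ∷ cy ∷ []) → ((s xor (cx ∧ cy)) xor ((dx xor (not ld ∧ cx)) ∧ (dy xor (not ld ∧ cy)))) xor
            ((x xor (cx xor (dx xor (cx ∧ not ld)))) ∧ (y xor (cy xor (dy xor (cy ∧ not ld))))) }) refl
          (S x y ∷ S x x ∷ S y y ∷ λd ∷ S d x ∷ S c x ∷ S d y ∷ S c y ∷ []))
        (sym (cong₂ _xor_ (S₂xy x y p q p' q') (cong₂ _∧_ (diag x p q) (diag y p' q')))))

  second : ∀ {S₁} → λc ≡ true → IsLoop S c S₁ → S₁ d d ≡ true
  second {S₁} lc F₁ = trans (IsLoop.off F₁ d d (λ e → c≢d (sym e)) (λ e → c≢d (sym e)))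
    (trans (cong (λ a → λd xor (a ∧ S c d)) (sy d c)) (trans (cong (λ a → λd xor a) (BP.∧-idem (S c d)))
      (trans (cong (λd xor_) (trans (taut 2 (λ { (a ∷ b ∷ []) → a }) (λ { (a ∷ b ∷ []) → (a xor (true ∧ b)) xor b }) refl (S c d ∷ λd ∷ []))
        (cong (_xor λd) (trans (cong (λ a → S c d xor (a ∧ λd)) (sym lc)) gcd)))) (taut 1 (λ { (a ∷ []) → a xor not a }) (λ _ → true) refl (λd ∷ [])))))

-- If `c` is looped, the pivot of `S` at `c` leaves a loop at `d` by `second`, and both loop pivots
-- together realise the pivot of `g` on the edge. A loop at `d` alone is treated by symmetry.
rep-pivot : ∀ {n m} {g g' S : Mat n} {v T} {Y B : Subset n} {c d} → Rep m g v T S Y → (∀ x → x ∈ B → x ∈ Y) → c ∈ B → d ∈ B → IsEdge g c d g' →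
  Σ (Mat n) λ S' → Steps B 2 S S' × Rep m g' v T S' Y
rep-pivot {S = S} {c = c} {d} r s hc hd E with bool (S c c) | bool (S d d)
... | inj₂ lc | inj₂ ld = _ , edge c d hc hd F nil , plain lc ld F
  where
  open RepEdge r (s c hc) (s d hd) E
  F = isEdge {S = S} {c} {d} (Rep.sy r) lc ld (trans (sym (trans (cong (λ a → S c d xor (a ∧ λd)) lc) (BP.xor-identityʳ (S c d)))) gcd)
... | inj₁ lc | _ = _ , loop c hc F₁ (loop d hd F₂ nil) , looped lc F₁ F₂
  where
  open RepEdge r (s c hc) (s d hd) E
  F₁ = isLoop {S = S} {c} (Rep.sy r) lc
  F₂ = isLoop {S = loopM S c} {d} (IsLoop.msym F₁) (second lc F₁)
... | inj₂ _ | inj₁ ld = _ , loop d hd F₁ (loop c hc F₂ nil) , looped ld F₁ F₂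
  where
  open RepEdge r (s d hd) (s c hc) (edge-swap (Rep.gs r) E)
  F₁ = isLoop {S = S} {d} (Rep.sy r) ld
  F₂ = isLoop {S = loopM S d} {c} (IsLoop.msym F₁) (second ld F₁)

rep-pivs : ∀ {n m} {G G' : Graph n} {S : Mat n} {v T} {Y B : Subset n} → (∀ x → x ∈ B → x ∈ Y) → PivIn B G G' → Rep m (adj G) v T S Y →
  Σ ℕ λ k → Σ (Mat n) λ S' → Steps B k S S' × Rep m (adj G') v T S' Y
rep-pivs s nil r = 0 , _ , nil , r
rep-pivs {G = G} s (step c d hc hd e p) r with rep-pivot r s hc hd (pivot-edge G c d e)
... | (S₁ , st , r₁) with rep-pivs s p r₁
...   | (k , S' , st' , r') = 2 + k , S' , steps-++ st st' , r'

-- Every loop spends the next twin and every edge is free. When the steps end early, the surplus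
-- twins are discarded, so that exactly `k` remain.
rep-steps : ∀ {n k} m {G : Graph n} {S S' : Mat n} {v} {T : Fin (m + k) → Fin n} {Y A B : Subset n} → (∀ x → x ∈ B → x ∈ Y) → (∀ x → x ∈ Y → x ∈ A) →
  (∀ i → T i ∈ A) → Rep (m + k) (adj G) v T S Y → Steps B m S S' →
  Σ (Graph n) λ G' → Σ (Fin k → Fin n) λ T' → PivIn A G G' × (∀ i → T' i ∈ A) × Rep k (adj G') v T' S' Y
rep-steps zero {G} s a t r nil = G , _ , nil , t , r
rep-steps {k = k} (suc m) s a t r nil =
  rep-steps m s a (λ i → t (suc i)) (record { sy = sy ; gs = gs ; v∉ = v∉ ; T∉ = λ i → T∉ (suc i) ; vT = λ i → vT (suc i)
    ; TT = λ i j ne → TT _ _ (λ { refl → ne refl }) ; vY = vY ; TY = λ i → TY (suc i) ; YY = YY }) nil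
  where open Rep r
rep-steps (suc m) {G} {S} {T = T} s a t r (loop b hb L st) =
  let tb = trans (Rep.TY r zero b (s b hb)) (IsLoop.lp L)
      (G' , T' , p , h , r') = rep-steps m s a (λ i → t (suc i)) (rep-loop r (s b hb) L (pivot-edge G (T zero) b tb)) st
  in G' , T' , step (T zero) b (t zero) (a b (s b hb)) tb p , h , r'
rep-steps m {G} {S} s a t r (edge b c hb hc F st) =
  let bc = trans (Rep.YY r b c (s b hb) (s c hc) (edge-≢ F)) (trans (xf (S b c) (∧f' (S c c) (IsEdge.ub F))) (IsEdge.bc F))
      E = pivot-edge G b c bc
      (G' , T' , p , h , r') = rep-steps m s a t (RepEdge.plain r (s b hb) (s c hc) E (IsEdge.ub F) (IsEdge.uc F) F) st
  in G' , T' , step b c (a b (s b hb)) (a c (s c hc)) bc p , h , r'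

-- Extracting the two target graphs

-- Vertices outside the image of `φ` are deleted one at a time; when none is left, `φ` is an
-- isomorphism.
embed : ∀ {n h} (G : Graph n) (H : Graph h) (φ : Fin h → Fin n) → (∀ i j → φ i ≡ φ j → i ≡ j) →
  (∀ i j → adj H i j ≡ adj G (φ i) (φ j)) → PivotMinor H G
embed {n} {h} G H φ inj pres with FP.any? (λ v → FP.all? (λ x → ¬? (φ x FP.≟ v)))
embed {n} {h} G H φ inj pres | no none = n , G , done , record { to = φ ; from = λ v → proj₁ (pre v) ; from∘to = λ x → inj _ _ (proj₂ (pre (φ x)))
    ; to∘from = λ v → proj₂ (pre v) ; preserves = pres }
  where
  pre : ∀ v → Σ (Fin h) λ x → φ x ≡ v
  pre v with FP.any? (λ x → φ x FP.≟ v)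
  ... | yes p = p
  ... | no p = ⊥-elim (none (v , λ x e → p (x , e)))
embed {suc n} {h} G H φ inj pres | yes (v , avoids) =
  let (k , G' , r , i) = embed (delete G v) H (λ x → punchOut (v≢ x)) (λ i j e → inj i j (FP.punchOut-injective (v≢ i) (v≢ j) e))
        (λ i j → trans (pres i j) (sym (cong₂ (adj G) (FP.punchIn-punchOut (v≢ i)) (FP.punchIn-punchOut (v≢ j)))))
  in k , G' , del v r , i
  where
  v≢ : ∀ x → v ≢ φ x
  v≢ x e = avoids x (sym e)

all-nth : ∀ {n} {P : Fin n → Set} {l} → All P l → ∀ i → P (DL.lookup l i)
all-nth (p ∷ ps) zero    = p
all-nth (p ∷ ps) (suc i) = all-nth ps i

path-adj : ∀ {n} (G : Graph n) l → Path (adj G) l → ∀ i j → adj G (DL.lookup l i) (DL.lookup l j) ≡ pathAdj i j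
path-adj G (x ∷ l) (k , p) zero zero = adj-irrefl G x
path-adj G (x ∷ y ∷ l) ((a , f , _) , p) zero (suc zero) = a
path-adj G (x ∷ y ∷ l) ((a , f , _) , p) zero (suc (suc j)) = all-nth f j
path-adj G (x ∷ y ∷ l) ((a , f , _) , p) (suc zero) zero = trans (adj-sym G y x) a
path-adj G (x ∷ y ∷ l) ((a , f , _) , p) (suc (suc j)) zero = trans (adj-sym G _ x) (all-nth f j)
path-adj G (x ∷ l) (k , p) (suc i) (suc j) = path-adj G l p i j

link-≢ : ∀ {n} {S : Mat n} {x} l → Link S x l → All (x ≢_) l
link-≢ [] _ = []
link-≢ (y ∷ l) (_ , _ , d) = d

path-inj : ∀ {n} {S : Mat n} l → Path S l → ∀ i j → DL.lookup l i ≡ DL.lookup l j → i ≡ j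
path-inj (x ∷ l) (k , p) zero zero e = refl
path-inj (x ∷ l) (k , p) zero (suc j) e = ⊥-elim (all-nth (link-≢ l k) j e)
path-inj (x ∷ l) (k , p) (suc i) zero e = ⊥-elim (all-nth (link-≢ l k) i (sym e))
path-inj (x ∷ l) (k , p) (suc i) (suc j) e = cong suc (path-inj l p i j e)

path-minor : ∀ {n t} (G : Graph n) l → Path (adj G) l → t ≤ length l → PivotMinor (path t) G
path-minor {n} {t} G l p t≤ = embed G (path t) (λ i → DL.lookup l (Fin.inject≤ i t≤))
  (λ i j e → FP.inject≤-injective t≤ t≤ i j (path-inj l p _ _ e))
  (λ i j → trans (cong₂ (λ a b → sucEq a b ∨ sucEq b a) (sym (FP.toℕ-inject≤ i t≤)) (sym (FP.toℕ-inject≤ j t≤))) (sym (path-adj G l p _ _)))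

half-minor : ∀ {n t} (G : Graph n) (u v : Fin t → Fin n) → (∀ i j → i ≢ j → adj G (u i) (u j) ≡ true) → (∀ i j → i ≢ j → adj G (v i) (v j) ≡ true) →
  (∀ i j → adj G (u i) (v j) ≡ does (j FP.≤? i)) → (∀ i j → u i ≢ v j) → PivotMinor (cliqueHalf t) G
half-minor {n} {t} G u v uu vv uv u≢v = embed G (cliqueHalf t) (λ x → φ (splitAt t x))
    (λ x y e → trans (sym (FP.join-splitAt t t x)) (trans (cong (Fin.join t t) (φ-inj (splitAt t x) (splitAt t y) e)) (FP.join-splitAt t t y)))
    (λ x y → pres (splitAt t x) (splitAt t y))
  where
  φ : Fin t ⊎ Fin t → Fin n
  φ (inj₁ i) = u i
  φ (inj₂ j) = v j
  inj : ∀ (w : Fin t → Fin n) → (∀ i j → i ≢ j → adj G (w i) (w j) ≡ true) → ∀ i j → w i ≡ w j → i ≡ j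
  inj w ww i j e with eq? i j
  ... | inj₁ q = q
  ... | inj₂ q = tf (ww i j q) (trans (cong (adj G (w i)) (sym e)) (adj-irrefl G (w i)))
  φ-inj : ∀ a b → φ a ≡ φ b → a ≡ b
  φ-inj (inj₁ i) (inj₁ j) e = cong inj₁ (inj u uu i j e)
  φ-inj (inj₂ i) (inj₂ j) e = cong inj₂ (inj v vv i j e)
  φ-inj (inj₁ i) (inj₂ j) e = ⊥-elim (u≢v i j e)
  φ-inj (inj₂ i) (inj₁ j) e = ⊥-elim (u≢v j i (sym e))
  same : ∀ (w : Fin t → Fin n) → (∀ i j → i ≢ j → adj G (w i) (w j) ≡ true) → ∀ i j → not (i == j) ≡ adj G (w i) (w j)
  same w ww i j with eq? i j
  ... | inj₁ refl = trans (cong not (==-refl i)) (sym (adj-irrefl G (w i)))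
  ... | inj₂ q = trans (cong not (==-f q)) (sym (ww i j q))
  pres : ∀ a b → halfAdj' a b ≡ adj G (φ a) (φ b)
  pres (inj₁ i) (inj₁ j) = same u uu i j
  pres (inj₂ i) (inj₂ j) = same v vv i j
  pres (inj₁ i) (inj₂ j) = sym (uv i j)
  pres (inj₂ j) (inj₁ i) = trans (sym (uv i j)) (adj-sym G (u i) (v j))

-- A looped path, cut in two; pivoting on a looped vertex removes it and switches the loops of its neighbours.
Cross : ∀ {n} → Mat n → List (Fin n) → List (Fin n) → Set
Cross S []      r = ⊤
Cross S (y ∷ l) r = Link S y r × All (λ a → All (λ b → S a b ≡ false × a ≢ b) r) l

Zip : ∀ {n} → Mat n → List (Fin n) → List (Fin n) → Set
Zip S l r = Path S l × Path S r × Cross S l r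

zip-push : ∀ {n} {S : Mat n} → Sym S → ∀ y l r → Zip S (y ∷ l) r → Zip S l (y ∷ r)
zip-push sy y [] r ((k , pl) , pr , (c , _)) = tt , (c , pr) , tt
zip-push sy y (x ∷ l) r (((a , f , d) , pl) , pr , (c , (fx ∷ fs))) = pl , (c , pr) ,
  (trans (sy x y) a , All.map proj₁ fx , (λ e → All.head d (sym e)) ∷ All.map proj₂ fx) ,
  All.zipWith (λ { {z} ((g , h) , h') → (trans (sy z y) g , λ e → h (sym e)) ∷ h' }) (All.zipWith id (f , All.tail d) , fs)

Switch : ∀ {n} → Mat n → Mat n → List (Fin n) → Set
Switch S S₁ []      = ⊤
Switch S S₁ (x ∷ l) = S₁ x x ≡ not (S x x) × All (λ z → S₁ z z ≡ S z z) l

link-switch : ∀ {n} {S S₁ : Mat n} {b} → Sym S → IsLoop S b S₁ → ∀ l → Link S b l → Switch S S₁ l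
link-switch sy i [] _ = tt
link-switch {S = S} {b = b} sy i (x ∷ l) (a , f , d) =
  trans (IsLoop.off i x x x≢b x≢b) (trans (cong₂ (λ u v → S x x xor (u ∧ v)) (trans (sy x b) a) a) (xor-true (S x x))) ,
  All.map (λ {z} q → loop-row sy i (trans (sy z b) q) z) f
  where
  x≢b : x ≢ b
  x≢b e = All.head d (sym e)

-- The heads of `l` and `r` are the neighbours of `b` there, so the pivot makes them adjacent and
-- keeps the other entries between distinct vertices: the path is contracted at `b`.
zip-drop : ∀ {n} {S S₁ : Mat n} → Sym S → ∀ b l r → IsLoop S b S₁ → Zip S (b ∷ l) r → Zip S₁ l r × Switch S S₁ l × Switch S S₁ r
zip-drop {n} {S} {S₁} sy b l r i ((k , pl) , pr , (c , fs)) = (side l k pl , side r c pr , cr l r k c fs) , link-switch sy i l k , link-switch sy i r c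
  where
  open IsLoop i using (off; msym)
  col : ∀ {z} x → S b z ≡ false → S₁ x z ≡ S x z
  col {z} x q = trans (msym x z) (trans (loop-row sy i (trans (sy z b) q) x) (sy z x))
  inner : ∀ l → All (λ z → S b z ≡ false) l → Path S l → Path S₁ l
  inner [] _ _ = tt
  inner (x ∷ l) (q ∷ qs) (k , p) = link-cong l (All.map (λ q → col x q) qs) k , inner l qs p
  side : ∀ l → Link S b l → Path S l → Path S₁ l
  side [] _ _ = tt
  side (x ∷ l) (a , f , d) (k , p) = link-cong l (All.map (λ q → col x q) f) k , inner l f p
  cr : ∀ l r → Link S b l → Link S b r → All (λ a → All (λ b → S a b ≡ false × a ≢ b) r) l → Cross S₁ l r
  cr [] r _ _ _ = tt
  cr (x ∷ l) [] _ _ (_ ∷ fs) = tt , All.map (λ _ → []) fs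
  cr (x ∷ l) (z ∷ r) (a , f , d) (a' , f' , d') (((g , x≢z) ∷ gs) ∷ fs) =
    ( trans (off x z (λ e → All.head d (sym e)) (λ e → All.head d' (sym e))) (cong₂ _xor_ g (cong₂ _∧_ (trans (sy x b) a) a'))
    , All.zipWith (λ { {w} (q , (p , _)) → trans (col x q) p }) (f' , gs) , x≢z ∷ All.map proj₂ gs) ,
    All.zipWith (λ { {y} (q , h) → All.map (λ { {w} (p , ne) → trans (loop-row sy i (trans (sy y b) q) w) p , ne }) h }) (f , fs)

Clean : ∀ {n} → Mat n → List (Fin n) → Set
Clean S = All (λ z → S z z ≡ false)

record Gained {n} (Y : Subset n) (S : Mat n) (m : ℕ) (l r : List (Fin n)) : Set where
  field
    S'    : Mat n
    steps : Steps Y m S S'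
    w     : Fin n
    w∈    : w ∈ Y
    zip   : Zip S' l (w ∷ r)
    clean : Clean S' (w ∷ r)

-- If the loops `y` and `y₂` are adjacent, the pivot at `y₂` clears `y`. Otherwise pivots at `y` and
-- at its neighbour `a` switch the vertex after `a`: a vertex of `u` becomes the next loop, and `y₂`
-- itself is cleared. The head of `r` is switched twice and stays unlooped.
gain : ∀ {n} {Y : Subset n} {S : Mat n} → Sym S → ∀ u {y y₂ l r} → Zip S (y ∷ u ++ y₂ ∷ l) r → All (_∈ Y) (y ∷ u ++ y₂ ∷ l) →
  S y y ≡ true → Clean S u → S y₂ y₂ ≡ true → Clean S r → Gained Y S (length u + 2) l r
gain {Y = Y} {S} sy [] {y} {y₂} {l} {r} z (hy ∷ h₂ ∷ _) ly _ l₂ cr with zip-drop sy y₂ l (y ∷ r) i (zip-push sy y (y₂ ∷ l) r z)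
  where i = isLoop {S = S} sy l₂
... | (z' , _ , (s , ss)) = record { S' = loopM S y₂ ; steps = loop y₂ h₂ (isLoop sy l₂) nil ; w = y ; w∈ = hy ; zip = z'
  ; clean = trans s (cong not ly) ∷ All.zipWith (λ (p , q) → trans p q) (ss , cr) }
gain {n} {Y} {S} sy (a ∷ u) {y} {y₂} {l} {r} z (hy ∷ ha ∷ hu) ly (la ∷ cu) l₂ cr = two u cu z hu
  where
  i₁ = isLoop {S = S} sy ly
  S₁ = loopM S y
  sy₁ = IsLoop.msym i₁
  both : ∀ (S₂ : Mat n) r → Switch S S₁ r → Switch S₁ S₂ r → Clean S r → Clean S₂ r
  both S₂ [] _ _ _ = []
  both S₂ (x ∷ r) (p , ps) (q , qs) (c ∷ cs) = trans q (cong not (trans p (cong not c))) ∷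
    All.zipWith (λ { (p , (q , c)) → trans q (trans p c) }) (ps , All.zipWith id (qs , cs))
  two : ∀ u → Clean S u → Zip S (y ∷ a ∷ u ++ y₂ ∷ l) r → All (_∈ Y) (u ++ y₂ ∷ l) → Gained Y S (suc (length u) + 2) l r
  two u cu z hu with zip-drop sy y (a ∷ u ++ y₂ ∷ l) r i₁ z
  ... | (z₁ , (sa , su) , sr) with trans sa (cong not la)
  ...   | la₁ with zip-drop sy₁ a (u ++ y₂ ∷ l) r (isLoop {S = S₁} sy₁ la₁) z₁
  two [] cu z (h₂ ∷ _) | (z₁ , (sa , su) , sr) | la₁ | (z₂ , (s₂ , _) , sr₂) = record
    { S' = loopM S₁ a ; steps = loop y hy i₁ (loop a ha (isLoop sy₁ la₁) nil) ; w = y₂ ; w∈ = h₂ ; zip = zip-push (IsLoop.msym (isLoop {S = S₁} sy₁ la₁)) y₂ l r z₂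
    ; clean = trans s₂ (cong not (trans (All.head su) l₂)) ∷ both _ r sr sr₂ cr }
  two (b ∷ u) (lb ∷ cu) z (hb ∷ hu) | (z₁ , (sa , su) , sr) | la₁ | (z₂ , (sb , su₂) , sr₂)
    with gain {Y = Y} (IsLoop.msym (isLoop {S = S₁} sy₁ la₁)) u z₂ (hb ∷ hu) (trans sb (cong not (trans (All.head su) lb)))
           (All.zipWith (λ { (p , (q , c)) → trans p (trans q c) }) (AllP.++⁻ˡ u su₂ , All.zipWith id (AllP.++⁻ˡ u (All.tail su) , cu)))
           (trans (All.head (AllP.++⁻ʳ u su₂)) (trans (All.head (AllP.++⁻ʳ u (All.tail su))) l₂)) (both _ r sr sr₂ cr)
  ... | g = record { S' = Gained.S' g ; steps = loop y hy i₁ (loop a ha (isLoop sy₁ la₁) (Gained.steps g)) ; w = Gained.w g ; w∈ = Gained.w∈ g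
      ; zip = Gained.zip g ; clean = Gained.clean g }

scan : ∀ {n} (S : Mat n) t l → t ≤ length l →
  (∃ λ pre → ∃ λ suf → l ≡ pre ++ suf × Clean S pre × length pre ≡ t) ⊎
  (∃ λ u → ∃ λ y → ∃ λ l' → l ≡ u ++ y ∷ l' × Clean S u × S y y ≡ true × length u < t)
scan S zero l p = inj₁ ([] , l , refl , [] , refl)
scan S (suc t) (x ∷ l) (s≤s p) with bool (S x x)
... | inj₁ q = inj₂ ([] , x , l , refl , [] , q , s≤s z≤n)
... | inj₂ q with scan S t l p
...   | inj₁ (pre , suf , e , c , h) = inj₁ (x ∷ pre , suf , cong (x ∷_) e , q ∷ c , cong suc h)
...   | inj₂ (u , y , l' , e , c , ly , h) = inj₂ (x ∷ u , y , l' , cong (x ∷_) e , q ∷ c , ly , s≤s h)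

path-prefix : ∀ {n} {S : Mat n} pre {suf} → Path S (pre ++ suf) → Path S pre
path-prefix [] _ = tt
path-prefix {S = S} (x ∷ pre) (k , p) = link-prefix pre k , path-prefix pre p
  where
  link-prefix : ∀ {x} pre {suf} → Link S x (pre ++ suf) → Link S x pre
  link-prefix [] _ = tt
  link-prefix (y ∷ pre) (a , f , d) = a , AllP.++⁻ˡ pre f , AllP.++⁻ˡ (y ∷ pre) d

record Cleaned {n} (Y : Subset n) (S : Mat n) (m t : ℕ) : Set where
  field
    S'    : Mat n
    steps : Steps Y m S S'
    zs    : List (Fin n)
    pth   : Path S' zs
    clean : Clean S' zs
    zs∈   : All (_∈ Y) zs
    long  : t ≤ length zs

-- The list `r` is finished and unlooped, `l` is still raw. A round adds one vertex to `r`, unless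
-- `t` consecutive unlooped vertices turn up; it takes at most `4 + t` vertices of `l` and at most
-- as many loop pivots.
word : ∀ t h {n} {Y : Subset n} {S : Mat n} → Sym S → ∀ l r → Zip S l r → All (_∈ Y) l → All (_∈ Y) r → Clean S r →
  h * (4 + t) ≤ length l → t ≤ h + length r → Cleaned Y S (h * (4 + t)) t
word t zero {S = S} sy l r (_ , pr , _) hl hr cr p q = record { S' = S ; steps = nil ; zs = r ; pth = pr ; clean = cr ; zs∈ = hr ; long = q }
word t (suc h) {S = S} sy (y ∷ l) r z (hy ∷ hl) hr cr (s≤s p) q with bool (S y y)
... | inj₂ f = let c = word t h sy l (y ∷ r) (zip-push sy y l r z) hl (hy ∷ hr) (f ∷ cr)
                        (NP.≤-trans (NP.m≤n+m (h * (4 + t)) (3 + t)) p) (NP.≤-trans q (NP.≤-reflexive (sym (NP.+-suc h (length r)))))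
               in record { S' = Cleaned.S' c ; steps = steps-weak (NP.m≤n+m (h * (4 + t)) (4 + t)) (Cleaned.steps c) ; zs = Cleaned.zs c
                 ; pth = Cleaned.pth c ; clean = Cleaned.clean c ; zs∈ = Cleaned.zs∈ c ; long = Cleaned.long c }
... | inj₁ ly with scan S t l (NP.≤-trans (NP.≤-trans (NP.m≤n+m t 3) (NP.m≤m+n (3 + t) (h * (4 + t)))) p)
...   | inj₁ (pre , suf , refl , c , e) = record { S' = S ; steps = nil ; zs = pre ; pth = path-prefix pre (proj₂ (proj₁ z)) ; clean = c
        ; zs∈ = AllP.++⁻ˡ pre hl ; long = NP.≤-reflexive (sym e) }
...   | inj₂ (u , y₂ , l' , refl , c , l₂ , u<t) =
        let g = gain sy u z (hy ∷ hl) ly c l₂ cr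
            rest : h * (4 + t) ≤ length l'
            rest = NP.+-cancelˡ-≤ (3 + t) (h * (4 + t)) (length l') (NP.≤-trans p (NP.≤-trans (NP.≤-reflexive (trans (LP.length-++ u) (NP.+-suc (length u) (length l'))))
              (NP.+-monoˡ-≤ (length l') (NP.≤-trans u<t (NP.m≤n+m t 3)))))
            d = word t h (steps-sym sy (Gained.steps g)) l' (Gained.w g ∷ r) (Gained.zip g) (All.tail (AllP.++⁻ʳ u hl)) (Gained.w∈ g ∷ hr) (Gained.clean g) rest
              (NP.≤-trans q (NP.≤-reflexive (sym (NP.+-suc h (length r)))))
        in record { S' = Cleaned.S' d ; steps = steps-++ (steps-weak (NP.≤-trans (NP.≤-reflexive (NP.+-comm (length u) 2))
              (s≤s (s≤s (NP.≤-trans (NP.<⇒≤ u<t) (NP.m≤n+m t 2))))) (Gained.steps g)) (Cleaned.steps d)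
            ; zs = Cleaned.zs d ; pth = Cleaned.pth d ; clean = Cleaned.clean d ; zs∈ = Cleaned.zs∈ d ; long = Cleaned.long d }

-- Growing handles of graphs

Goal : ∀ t {n} → Graph n → Set
Goal t G = PivotMinor (path t) G ⊎ PivotMinor (cliqueHalf t) G

goal-lift : ∀ t {n} {B : Subset n} {G G'} → PivIn B G G' → Goal t G' → Goal t G
goal-lift t p (inj₁ m) = inj₁ (piv-minor p m)
goal-lift t p (inj₂ m) = inj₂ (piv-minor p m)

record Lolli {n} (i k : ℕ) (G : Graph n) (A : Subset n) : Set where
  field
    w   : Fin n
    ps  : List (Fin n)
    R   : Subset n
    H   : Handle (adj G) w ps R
    jn  : Joined (adj G) (R ∪ ｛ w ｝)
    R⊆A : ∀ x → x ∈ R → x ∈ A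
    in-A : All (_∈ A) (w ∷ ps)
    len : i ≤ length (w ∷ ps)
    hi  : Hi k (adj G) R

Out : ∀ t i k {n} → Graph n → Subset n → Set
Out t i k {n} G A = Goal t G ⊎ Σ (Graph n) λ G' → PivIn A G G' × Lolli i k G' A

out-lift : ∀ t i k {n} {A B : Subset n} {G G'} → (∀ x → x ∈ B → x ∈ A) → PivIn A G G' → Out t i k G' B → Out t i k G A
out-lift t i k s p (inj₁ g) = inj₁ (goal-lift t p g)
out-lift t i k s p (inj₂ (G' , q , l)) = inj₂ (G' , piv-++ p (piv-⊆ s q) , record { w = w ; ps = ps ; R = R ; H = H ; jn = jn
  ; R⊆A = λ x h → s x (R⊆A x h) ; in-A = All.map (s _) in-A ; len = len ; hi = hi })
  where open Lolli l

-- All heights `k` are included, because nesting many handles demands that the bag of each one be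
-- high enough for the next.
Grows : ℕ → ℕ → Set
Grows t i = ∀ k → Σ ℕ λ k' → ∀ {n} (G : Graph n) (A : Subset n) → Hi k' (adj G) A → Out t i k G A

hi-≤ : ∀ {k k'} {n} {S : Mat n} {A} → k ≤ k' → Hi k' S A → Hi k S A
hi-≤ {k} {k'} p h = go (NP.≤⇒≤′ p) h
  where
  go : ∀ {k'} → k ≤′ k' → Hi k' _ _ → Hi k _ _
  go ≤′-refl h = h
  go (≤′-step q) h = go q (hi-weak _ h)

-- As `C` is connected, the component of `Z` in `C ⊝ v` must have an edge to `v`.
around : ∀ {n} {S : Mat n} → Sym S → ∀ {C Z v z₀} → Joined S C → v ∈ C → (∀ x → x ∈ Z → x ∈ (C ⊝ v)) → Joined S Z → z₀ ∈ Z →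
  Σ (Subset n) λ K → (∀ x → x ∈ Z → x ∈ K) × (∀ x → x ∈ K → x ∈ (C ⊝ v)) × Joined S (K ∪ ｛ v ｝)
around {n} {S} sy {C} {Z} {v} {z₀} jC hv s jZ hz = K , C⊆K , K⊆X , at-v (jC K z₀ v (∧-l (K⊆X z₀ (C⊆K z₀ hz))) (C⊆K z₀ hz) hv (≢true (λ q → ⊝-r {A = C} (K⊆X v q) refl)))
  where
  open Component (component sy (C ⊝ v) Z s jZ)
  at-v : (Σ (Fin n) λ x → Σ (Fin n) λ y → x ∈ C × x ∈ K × y ∈ C × y ∉ K × S x y ≡ true) → Joined S (K ∪ ｛ v ｝)
  at-v (x , y , _ , xK , hy , yK , q) with eq? y v
  ... | inj₁ refl = conn-add sy conn xK (trans (sy y x) q)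
  ... | inj₂ ne = tf q (closed x y xK (⊝-i {A = C} hy ne) yK)

grows-base : ∀ t → Grows t 0
grows-base t k = 3 + k , λ G A hi →
  let sy = adj-sym G
      (C , C⊆ , jC , hC) = hi-comp (2 + k) sy hi
      (v , hv) = hi-nonempty (2 + k) hC
      (Z , Z⊆ , jZ , hZ) = hi-comp k sy (hi-vertex (suc k) sy v hC)
      (K , Z⊆K , K⊆ , jK) = around sy jC hv Z⊆ jZ (proj₂ (hi-nonempty k hZ))
  in inj₂ (G , nil , record { w = v ; ps = [] ; R = K ; H = record { pth = tt , tt ; null = [] ; out = ≢true (λ q → ⊝-r {A = C} (K⊆ v q) refl) ∷ [] }
       ; jn = jK ; R⊆A = λ x h → C⊆ x (∧-l (K⊆ x h)) ; in-A = C⊆ v hv ∷ [] ; len = z≤n ; hi = hi-⊇ k Z⊆K hZ })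

record Main {n} (S : Mat n) (i : ℕ) (w : Fin n) (ps : List (Fin n)) (Reg : Subset n) : Set where
  field
    H   : Handle S w ps Reg
    jn  : Joined S (Reg ∪ ｛ w ｝)
    len : i ≤ length (w ∷ ps)
  w∉ : w ∉ Reg
  w∉ = All.head (Handle.out H)

main-steps : ∀ {n} {B : Subset n} {m i S S' w ps Reg} → Sym S → (∀ x → x ∈ B → x ∈ Reg) → Steps B m S S' → Main S i w ps Reg → Main S' i w ps Reg
main-steps {Reg = Reg} sy s st M = record { H = handle-steps sy s st H ; jn = steps-joined sy (λ x h → ∪-l Reg (s x h)) st jn ; len = len }
  where open Main M

main-grow : ∀ {n} {S : Mat n} {i w ps Reg Z z₀} → Sym S → Main S i w ps Reg → (∀ x → x ∈ Z → x ∈ Reg) → Joined S Z → z₀ ∈ Z →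
  (∀ z → z ∈ Z → S w z ≡ false) → Grown S w ps Reg Z
main-grow sy M s jZ hz van = grow sy (Main.H M) (Main.jn M) s jZ hz van

edge-unique : ∀ {n} {S S₀ S' S₀' : Mat n} {b c} → (∀ x y → S₀ x y ≡ S x y) → IsEdge S b c S' → IsEdge S₀ b c S₀' → ∀ x y → S₀' x y ≡ S' x y
edge-unique {S = S} {S₀} {S'} {S₀'} {b} {c} e E F x y = go (eq? x b) (eq? x c) (eq? y b) (eq? y c)
  where
  module E = IsEdge E
  module F = IsEdge F
  rows : ∀ y → (y ≡ b) ⊎ (y ≢ b) → (y ≡ c) ⊎ (y ≢ c) → (S₀' b y ≡ S' b y) × (S₀' c y ≡ S' c y)
  rows y (inj₁ refl) _ = trans F.bb' (sym E.bb') , trans (F.msym c y) (trans F.bc' (sym (trans (E.msym c y) E.bc')))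
  rows y (inj₂ _) (inj₁ refl) = trans F.bc' (sym E.bc') , trans F.cc' (sym E.cc')
  rows y (inj₂ p) (inj₂ q) = trans (F.rowb y p q) (trans (e c y) (sym (E.rowb y p q))) , trans (F.rowc y p q) (trans (e b y) (sym (E.rowc y p q)))
  go : (x ≡ b) ⊎ (x ≢ b) → (x ≡ c) ⊎ (x ≢ c) → (y ≡ b) ⊎ (y ≢ b) → (y ≡ c) ⊎ (y ≢ c) → S₀' x y ≡ S' x y
  go (inj₁ refl) _ p q = proj₁ (rows y p q)
  go (inj₂ _) (inj₁ refl) p q = proj₂ (rows y p q)
  go (inj₂ p) (inj₂ q) (inj₁ refl) _ = trans (F.msym x y) (trans (proj₁ (rows x (inj₂ p) (inj₂ q))) (E.msym y x))
  go (inj₂ p) (inj₂ q) (inj₂ _) (inj₁ refl) = trans (F.msym x y) (trans (proj₂ (rows x (inj₂ p) (inj₂ q))) (E.msym y x))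
  go (inj₂ p) (inj₂ q) (inj₂ p') (inj₂ q') = trans (F.off x y p q p' q') (trans
    (cong₂ _xor_ (e x y) (cong₂ _xor_ (cong₂ _∧_ (e x b) (e c y)) (cong₂ _∧_ (e x c) (e b y)))) (sym (E.off x y p q p' q')))

-- A graph has no loops, so all steps are edge steps; by `edge-unique` each of them is a graph pivot
-- up to pointwise equality.
steps-pivots : ∀ {n} {B : Subset n} {m S S'} (G : Graph n) → (∀ x y → adj G x y ≡ S x y) → Steps B m S S' →
  Σ (Graph n) λ G' → PivIn B G G' × (∀ x y → adj G' x y ≡ S' x y)
steps-pivots G e nil = G , nil , e
steps-pivots G e (loop b h i st) = tf (IsLoop.lp i) (trans (sym (e b b)) (adj-irrefl G b))
steps-pivots G e (edge b c h h' i st) =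
  let bc = trans (e b c) (IsEdge.bc i)
      (G' , p , q) = steps-pivots (pivot G b c) (edge-unique e i (pivot-edge G b c bc)) st
  in G' , step b c h h' bc p , q

handle-cong : ∀ {n} {S S' : Mat n} {w ps R} → (∀ x y → S' x y ≡ S x y) → Handle S w ps R → Handle S' w ps R
handle-cong {S = S} {S'} {w} {ps} e H = record { pth = go (w ∷ ps) pth ; null = All.map (λ f z h → trans (e _ z) (f z h)) null ; out = out }
  where
  open Handle H
  go : ∀ l → Path S l → Path S' l
  go [] _ = tt
  go (x ∷ l) (k , p) = link-cong l (All.tabulate (λ {z} _ → e x z)) k , go l p

better-out : ∀ t i kw {n m} {G : Graph n} {A : Subset n} {w ps B Z} → Better kw m (adj G) w ps B Z → (∀ x → x ∈ B → x ∈ A) → (∀ x → x ∈ Z → x ∈ B) →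
  All (_∈ A) (w ∷ ps) → i ≤ length (w ∷ ps) → Out t (suc i) kw G A
better-out t i kw {G = G} {A} b s z a l with steps-pivots G (λ x y → refl) (Better.steps b)
... | (G' , p , e) = inj₂ (G' , piv-⊆ s p , record { w = y ; ps = qs ; R = Z' ; H = handle-cong e handle ; jn = joined-cong (λ x y _ _ → e x y) conn
    ; R⊆A = λ x h → s x (z x (Z'⊆Z x h)) ; in-A = within A s a ; len = s≤s (NP.≤-trans l (suf-length suf))
    ; hi = hi-cong kw (λ x y _ _ → e x y) hi })
  where open Better b

grown-out : ∀ t i kw {n} {G : Graph n} {A : Subset n} {w ps R Z} → Grown (adj G) w ps R Z → (∀ x → x ∈ R → x ∈ A) → (∀ x → x ∈ Z → x ∈ R) →
  All (_∈ A) (w ∷ ps) → i ≤ length (w ∷ ps) → Hi kw (adj G) Z → Out t (suc i) kw G A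
grown-out t i kw {G = G} {A} {Z = Z} g s z a l hi = inj₂ (G , nil , record { w = y ; ps = qs ; R = Z ; H = handle ; jn = conn
    ; R⊆A = λ x h → s x (z x h) ; in-A = within A s a ; len = s≤s (NP.≤-trans l (suf-length suf)) ; hi = hi })
  where open Grown g

-- Handle j' lies in the bag of every handle j < j', and R in all bags.
record Nest {n} (i q k : ℕ) (G : Graph n) (A : Subset n) : Set where
  field
    w     : Fin q → Fin n
    ps    : Fin q → List (Fin n)
    Reg   : Fin q → Subset n
    main  : ∀ j → Main (adj G) i (w j) (ps j) (Reg j)
    in-A  : ∀ j → All (_∈ A) (w j ∷ ps j)
    Reg⊆  : ∀ j x → x ∈ Reg j → x ∈ A
    R     : Subset n
    R⊆    : ∀ j x → x ∈ R → x ∈ Reg j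
    R⊆A   : ∀ x → x ∈ R → x ∈ A
    later : ∀ j j' → j Fin.< j' → w j' ∈ Reg j
    hi    : Hi k (adj G) R

-- Each handle is sought in the bag of the one before. Later pivots stay inside that bag, and such
-- pivots preserve handles by `main-steps`.
nest : ∀ t i → Grows t i → ∀ q k → Σ ℕ λ k' → ∀ {n} (G : Graph n) (A : Subset n) → Hi k' (adj G) A →
  Goal t G ⊎ Σ (Graph n) λ G' → PivIn A G G' × Nest i q k G' A
nest t i L zero k = k , λ G A hi → inj₂ (G , nil , record { w = λ () ; ps = λ () ; Reg = λ () ; main = λ () ; in-A = λ () ; Reg⊆ = λ () ; R = A
  ; R⊆ = λ () ; R⊆A = λ x h → h ; later = λ () ; hi = hi })
nest t i L (suc q) k = let (k₁ , rec) = nest t i L q k ; (k' , l) = L k₁ in k' , λ G A hi → first rec G A (l G A hi)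
  where
  first : ∀ {k₁} → (∀ {n} (G : Graph n) (A : Subset n) → Hi k₁ (adj G) A → Goal t G ⊎ Σ (Graph n) λ G' → PivIn A G G' × Nest i q k G' A) →
    ∀ {n} (G : Graph n) A → Out t i k₁ G A → Goal t G ⊎ Σ (Graph n) λ G' → PivIn A G G' × Nest i (suc q) k G' A
  first rec G A (inj₁ g) = inj₁ g
  first rec G A (inj₂ (G₁ , p , l)) with rec G₁ (Lolli.R l) (Lolli.hi l)
  ... | inj₁ g = inj₁ (goal-lift t p g)
  ... | inj₂ (G₂ , p₂ , N) = inj₂ (G₂ , piv-++ p (piv-⊆ R⊆A p₂) , record
      { w = λ { zero → w ; (suc j) → N.w j } ; ps = λ { zero → ps ; (suc j) → N.ps j } ; Reg = λ { zero → R ; (suc j) → N.Reg j }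
      ; main = λ { zero → main-steps (adj-sym G₁) (λ x h → h) (piv-steps p₂) (record { H = H ; jn = jn ; len = len }) ; (suc j) → N.main j }
      ; in-A = λ { zero → in-A ; (suc j) → All.map (R⊆A _) (N.in-A j) } ; Reg⊆ = λ { zero → R⊆A ; (suc j) x h → R⊆A x (N.Reg⊆ j x h) }
      ; R = N.R ; R⊆ = λ { zero → N.R⊆A ; (suc j) → N.R⊆ j } ; R⊆A = λ x h → R⊆A x (N.R⊆A x h)
      ; later = λ { zero (suc j') _ → All.head (N.in-A j') ; (suc j) (suc j') (s≤s q) → N.later j j' q }
      ; hi = N.hi })
    where
    open Lolli l
    module N = Nest N

-- Handles in the matrix S seen through a supply of twins. Each handle of a chain lies in the bag D of the previous ones, contains a
-- looped vertex, and its length is at least the corresponding entry of σ.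
data Chain {n} (S : Mat n) (Y : Subset n) : Subset n → List ℕ → Set where
  nil  : Chain S Y Y []
  cons : ∀ {D σ} → Chain S Y D σ → ∀ {i w ps R} → Main S i w ps R → (∀ x → x ∈ R → x ∈ D) → All (_∈ D) (w ∷ ps) → Loopy S ps → Chain S Y R (i ∷ σ)

chain-⊆ : ∀ {n} {S : Mat n} {Y D σ} → Chain S Y D σ → ∀ x → x ∈ D → x ∈ Y
chain-⊆ nil x h = h
chain-⊆ (cons c _ s _ _) x h = chain-⊆ c x (s x h)

chain-steps : ∀ {n} {B : Subset n} {m S S' Y D σ} → Sym S → (∀ x → x ∈ B → x ∈ D) → Steps B m S S' → Chain S Y D σ → Chain S' Y D σ
chain-steps sy s st nil = nil
chain-steps sy s st (cons c M sD a l) = cons (chain-steps sy (λ x h → sD x (s x h)) st c) (main-steps sy s st M) sD a (loopy-steps sy s st (Main.H M) l)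

record Supplied {n} (i m : ℕ) (σ : List ℕ) (G : Graph n) (A : Subset n) : Set where
  field
    v     : Fin n
    ps    : List (Fin n)
    Reg   : Subset n
    main  : Main (adj G) i v ps Reg
    in-A  : All (_∈ A) (v ∷ ps)
    Reg⊆A : ∀ x → x ∈ Reg → x ∈ A
    T     : Fin m → Fin n
    T∈    : ∀ j → T j ∈ Reg
    S     : Mat n
    Y     : Subset n
    rep   : Rep m (adj G) v T S Y
    Y⊆    : ∀ x → x ∈ Y → x ∈ Reg
    D     : Subset n
    chain : Chain S Y D σ
    R     : Subset n
    R⊆D   : ∀ x → x ∈ R → x ∈ D
    jR    : Joined S R
  R⊆Y : ∀ x → x ∈ R → x ∈ Y
  R⊆Y x h = chain-⊆ chain x (R⊆D x h)
  R⊆Reg : ∀ x → x ∈ R → x ∈ Reg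
  R⊆Reg x h = Y⊆ x (R⊆Y x h)

-- Pivots of the graph inside `R` become steps on `S` by `rep-pivs`, and these stay inside the bags
-- of the chain. That `R` is the same set is returned explicitly, for callers to whom the new record
-- is opaque.
supplied-pivots : ∀ {n i m σ} {G G' : Graph n} {A} (s : Supplied i m σ G A) → PivIn (Supplied.R s) G G' →
  Σ (Supplied i m σ G' A) λ s' → (∀ x → Supplied.R s' x ≡ Supplied.R s x)
supplied-pivots {G = G} s p with rep-pivs (Supplied.R⊆Y s) p (Supplied.rep s)
... | (_ , S' , st , rep') = record { v = v ; ps = ps ; Reg = Reg ; main = main-steps (adj-sym G) R⊆Reg (piv-steps p) main ; in-A = in-A ; Reg⊆A = Reg⊆A
    ; T = T ; T∈ = T∈ ; S = S' ; Y = Y ; rep = rep' ; Y⊆ = Y⊆ ; D = D ; chain = chain-steps (Rep.sy rep) R⊆D st chain ; R = R ; R⊆D = R⊆D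
    ; jR = steps-joined (Rep.sy rep) (λ x h → h) st jR } , (λ x → refl)
  where open Supplied s

rep-flip : ∀ {n m g v T} {S : Mat n} {Y Z} → Rep m g v T S Y → (∀ x → x ∈ Z → x ∈ Y) → ∀ x y → x ∈ Z → y ∈ Z → x ≢ y → S x y ≡ g x y xor (S x x ∧ S y y)
rep-flip {S = S} r s x y hx hy ne = trans (taut 2 (λ { (a ∷ b ∷ []) → a }) (λ { (a ∷ b ∷ []) → (a xor b) xor b }) refl (S x y ∷ (S x x ∧ S y y) ∷ []))
  (cong (_xor (S x x ∧ S y y)) (sym (Rep.YY r x y (s x hx) (s y hy) ne)))

rep-hi : ∀ k {n m g v T} {S : Mat n} {Y Z} → Rep m g v T S Y → (∀ x → x ∈ Z → x ∈ Y) → Hi (suc k) S Z → Hi k g Z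
rep-hi k {S = S} r s = hi-flip k (λ x → S x x) (λ _ → false) (λ a _ b _ → a ∧ b) (rep-flip r s)

hi-rep : ∀ k {n m g v T} {S : Mat n} {Y Z} → Rep m g v T S Y → (∀ x → x ∈ Z → x ∈ Y) → Hi (suc k) g Z → Hi k S Z
hi-rep k {S = S} r s = hi-flip k (λ x → S x x) (λ _ → false) (λ a _ b _ → a ∧ b) (λ x y hx hy ne → Rep.YY r x y (s x hx) (s y hy) ne)

see : ∀ {n} → Mat n → Fin n → Maybe (Fin n) → Fin 2
see S w nothing  = zero
see S w (just c) = bitF (S w c)

all⊎ : ∀ {n} {X P : Fin n → Set} → (∀ i → X i ⊎ P i) → (Σ (Fin n) X) ⊎ (∀ i → P i)
all⊎ {zero}  f = inj₂ λ ()
all⊎ {suc n} f with f zero | all⊎ (f ∘ suc)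
... | inj₁ x | _ = inj₁ (zero , x)
... | inj₂ _ | inj₁ (i , x) = inj₁ (suc i , x)
... | inj₂ p | inj₂ q = inj₂ λ { zero → p ; (suc i) → q i }

-- Two nested handles with the same trace on Z are adjacent, or yield a longer handle.
pair : ∀ t i kw {n} {G : Graph n} {A : Subset n} {w ps B w' Z} → Main (adj G) i w ps B → (∀ x → x ∈ B → x ∈ A) → All (_∈ A) (w ∷ ps) →
  w' ∈ B → w' ∉ Z → (∀ x → x ∈ Z → x ∈ B) → Joined (adj G) Z → Hi (3 + kw) (adj G) Z → (∀ z → z ∈ Z → adj G w z ≡ adj G w' z) →
  Out t (suc i) kw G A ⊎ (adj G w w' ≡ true)
pair t i kw {G = G} {w = w} {w' = w'} {Z} M B⊆A a w'B w'Z Z⊆B jZ hi same with ∃? (λ z → Z z ∧ adj G w z)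
... | inj₂ none = inj₁ (grown-out t i kw (main-grow (adj-sym G) M Z⊆B jZ (proj₂ (hi-nonempty (3 + kw) hi)) (λ z h → ≢true (λ q → tf (∧-i h q) (none z))))
        B⊆A Z⊆B a (Main.len M) (hi-≤ (NP.m≤n+m kw 3) hi))
... | inj₁ (c , h) with bool (adj G w w')
...   | inj₁ q = inj₂ q
...   | inj₂ q = inj₁ (better-out t i kw (merge kw (twins (adj-sym G) (Main.H M) Z⊆B w'B w'Z same jZ (∧-l h) (∧-r {Z c} h))
          (trans q (sym (adj-irrefl G w'))) (∧-l h) (∧-r {Z c} h) hi) B⊆A Z⊆B a (Main.len M))

see-same : ∀ {n} {S : Mat n} {w w' z} {m} → m ≡ just z → see S w m ≡ see S w' m → S w z ≡ S w' z
see-same refl = bitF-inj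

-- Equal traces, and the stages of the chain construction

record Trace {n} (M : ℕ) {N} (κ : ℕ) (S : Mat n) (R : Subset n) (W : Fin N → Fin n) : Set where
  field
    e    : M ↪ N
    Z    : Subset n
    Z⊆R  : ∀ x → x ∈ Z → x ∈ R
    jZ   : Joined S Z
    hi   : Hi κ S Z
    same : ∀ a b z → z ∈ Z → S (W (at e a)) z ≡ S (W (at e b)) z
    own  : ∀ a b → S (W (at e a)) (W (at e a)) ≡ S (W (at e b)) (W (at e b))

Traces : (κ M N : ℕ) → Set
Traces κ M N = ∀ {n} {S : Mat n} → Sym S → ∀ R → Hi (suc κ) S R → (W : Fin N → Fin n) → Trace M κ S R W

-- Compactness replaces the bag by a high subset of bounded size, on which there are boundedly many
-- traces. One further colour fixes the diagonal entry, and one unit of height buys connectivity.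
traces : ∀ κ M → Σ ℕ (Traces κ M)
traces κ M = let (s , cmp) = compact (dbl (suc κ)) (suc κ) ; (N , pg) = pigeons (suc s) 2 M in
  N , λ {n} {S} sy R hi W → go sy W (pg) (cmp sy R hi)
  where
  colour : ∀ {n N s} (S : Mat n) (W : Fin N → Fin n) → (Fin s → Maybe (Fin n)) → Fin (suc s) → Fin N → Fin 2
  colour S W c zero    j = bitF (S (W j) (W j))
  colour S W c (suc x) j = see S (W j) (c x)
  go : ∀ {n N s} {S : Mat n} {R : Subset n} → Sym S → (W : Fin N → Fin n) →
    ((F : Fin (suc s) → Fin N → Fin 2) → Σ (M ↪ N) λ e → ∀ i → Const (F i ∘ at e)) →
    (Σ (Subset n) λ Z → (∀ x → x ∈ Z → x ∈ R) × Hi (suc κ) S Z × Cover s Z) → Trace M κ S R W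
  go {S = S} sy W pg (Z , Z⊆ , hZ , (c , cov)) with hi-comp κ sy hZ | pg (colour S W c)
  ... | (C , C⊆ , jC , hC) | (e , const) = record { e = e ; Z = C ; Z⊆R = λ x h → Z⊆ x (C⊆ x h) ; jZ = jC ; hi = hC
      ; same = λ a b z h → let (x , q) = cov z (C⊆ z h) in see-same {S = S} q (const (suc x) a b) ; own = λ a b → bitF-inj (const zero a b) }

-- Both `m` and `k` are arbitrary, since later stages spend twins and height. A longer handle of the
-- graph, or the goal itself, is an early exit.
Stage : (t i kw : ℕ) → List ℕ → Set
Stage t i kw σ = ∀ m k → Σ ℕ λ k' → ∀ {n} (G : Graph n) (A : Subset n) → Hi k' (adj G) A →
  Out t (suc i) kw G A ⊎ Σ (Graph n) λ G' → PivIn A G G' × Σ (Supplied i m σ G' A) λ s → Hi k (Supplied.S s) (Supplied.R s)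

stage-lift : ∀ t {i kw m σ k n} {G G' : Graph n} {A : Subset n} → PivIn A G G' →
  Out t (suc i) kw G' A ⊎ (Σ (Graph n) λ G'' → PivIn A G' G'' × Σ (Supplied i m σ G'' A) λ s → Hi k (Supplied.S s) (Supplied.R s)) →
  Out t (suc i) kw G A ⊎ Σ (Graph n) λ G'' → PivIn A G G'' × Σ (Supplied i m σ G'' A) λ s → Hi k (Supplied.S s) (Supplied.R s)
stage-lift t {i} {kw} p (inj₁ o) = inj₁ (out-lift t (suc i) kw (λ _ h → h) p o)
stage-lift t p (inj₂ (G'' , p' , s)) = inj₂ (G'' , piv-++ p p' , s)

-- Local complementation at `v`, with the neighbourhood of `v` written on the diagonal.
shear : ∀ {n} → Mat n → Fin n → Mat n
shear g v x y = if x == y then g v x else (g x y xor (g v x ∧ g v y))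

shear-diag : ∀ {n} (g : Mat n) v x → shear g v x x ≡ g v x
shear-diag g v x rewrite ==-refl x = refl

shear-off : ∀ {n} (g : Mat n) v {x y} → x ≢ y → shear g v x y ≡ g x y xor (g v x ∧ g v y)
shear-off g v h rewrite ==-f h = refl

shear-sym : ∀ {n} {g : Mat n} v → Sym g → Sym (shear g v)
shear-sym {g = g} v s x y with eq? x y
... | inj₁ refl = refl
... | inj₂ h = trans (shear-off g v h) (trans (cong₂ _xor_ (s x y) (BP.∧-comm (g v x) (g v y))) (sym (shear-off g v (λ e → h (sym e)))))

-- Nested ends with equal traces that do not merge are pairwise adjacent. The outermost becomes `v`,
-- the others its twins.
start : ∀ t i kw → Grows t i → Stage t i kw []
start t i kw L m k =
  -- This height dominates `3 + kw`, for `pair`, and `2 + k`, for the change to `S` and a connected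
  -- part.
  let κ = suc (suc (k + (3 + kw))) ; (N , tr) = traces κ (suc m) ; (k' , f) = nest t i L N (suc κ) in
  k' , λ G A hi → go κ (NP.m≤n+m (3 + kw) (2 + k)) (s≤s (s≤s (NP.m≤m+n k (3 + kw)))) tr G A (f G A hi)
  where
  Res : ∀ {n} → Graph n → Subset n → Set
  Res {n} G A = Out t (suc i) kw G A ⊎ Σ (Graph n) λ G' → PivIn A G G' × Σ (Supplied i m [] G' A) λ s → Hi k (Supplied.S s) (Supplied.R s)
  build : ∀ κ → 3 + kw ≤ κ → 2 + k ≤ κ → ∀ {n N} (G : Graph n) A (N : Nest i N (suc κ) G A) → Trace (suc m) κ (adj G) (Nest.R N) (Nest.w N) → Res G A
  build κ κ₁ κ₂ {n} G A nst tr = finish' (all⊎ (λ a → all⊎ (λ b → test a b (a FP.<? b))))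
    where
    open Nest nst
    open Trace tr using (e; same) renaming (Z to Z₁; Z⊆R to Z₁⊆R; jZ to jZ₁; hi to hZ₁)
    g = adj G
    sg = adj-sym G
    W : Fin (suc m) → Fin n
    W a = w (at e a)
    B : Fin (suc m) → Subset n
    B a = Reg (at e a)
    Z₁⊆B : ∀ a x → x ∈ Z₁ → x ∈ B a
    Z₁⊆B a x h = R⊆ (at e a) x (Z₁⊆R x h)
    W∉ : ∀ a → W a ∉ Z₁
    W∉ a = ≢true (λ h → tf (Z₁⊆B a _ h) (Main.w∉ (main (at e a))))
    test : ∀ a b → Dec (a Fin.< b) → Out t (suc i) kw G A ⊎ (a Fin.< b → g (W a) (W b) ≡ true)
    test a b (no q) = inj₂ (λ p → ⊥-elim (q p))
    test a b (yes p) with pair t i kw {G = G} {A} (main (at e a)) (Reg⊆ (at e a)) (in-A (at e a)) (later _ _ (mono e p)) (W∉ b) (Z₁⊆B a) jZ₁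
        (hi-≤ κ₁ hZ₁) (same a b)
    ... | inj₁ o = inj₁ o
    ... | inj₂ q = inj₂ (λ _ → q)
    finish' : _ ⊎ (∀ a b → a Fin.< b → g (W a) (W b) ≡ true) → Res G A
    finish' (inj₁ (_ , _ , o)) = inj₁ o
    finish' (inj₂ cl) = inj₂ (G , nil , sup , hC)
      where
      v = W zero
      T : Fin m → Fin n
      T j = W (suc j)
      S = shear g v
      clique : ∀ a b → a ≢ b → g (W a) (W b) ≡ true
      clique a b ne with NP.<-cmp (toℕ a) (toℕ b)
      ... | tri< p _ _ = cl a b p
      ... | tri≈ _ p _ = ⊥-elim (ne (FP.toℕ-injective p))
      ... | tri> _ _ p = trans (sg (W a) (W b)) (cl b a p)
      rep : Rep m g v T S Z₁
      rep = record { sy = shear-sym v sg ; gs = sg ; v∉ = W∉ zero ; T∉ = λ j → W∉ (suc j) ; vT = λ j → clique zero (suc j) (λ ())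
        ; TT = λ a b ne → clique (suc a) (suc b) (λ { refl → ne refl }) ; vY = λ y h → sym (shear-diag g v y)
        ; TY = λ j y h → trans (same (suc j) zero y h) (sym (shear-diag g v y))
        ; YY = λ x y hx hy ne → trans (taut 3 (λ { (a ∷ p ∷ q ∷ []) → a }) (λ { (a ∷ p ∷ q ∷ []) → (a xor (p ∧ q)) xor (p ∧ q) }) refl (g x y ∷ g v x ∷ g v y ∷ []))
            (sym (cong₂ _xor_ (shear-off g v ne) (cong₂ _∧_ (shear-diag g v x) (shear-diag g v y)))) }
      comp' = hi-comp k (shear-sym v sg) (hi-rep (suc k) rep (λ x h → h) (hi-≤ κ₂ hZ₁))
      C = proj₁ comp'
      hC = proj₂ (proj₂ (proj₂ comp'))
      sup : Supplied i m [] G A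
      sup = record { v = v ; ps = ps (at e zero) ; Reg = B zero ; main = main (at e zero) ; in-A = in-A (at e zero) ; Reg⊆A = Reg⊆ (at e zero)
        ; T = T ; T∈ = λ j → later _ _ (mono e (s≤s z≤n)) ; S = S ; Y = Z₁ ; rep = rep ; Y⊆ = Z₁⊆B zero ; D = Z₁ ; chain = nil
        ; R = C ; R⊆D = proj₁ (proj₂ comp') ; jR = proj₁ (proj₂ (proj₂ comp')) }
  go : ∀ κ → 3 + kw ≤ κ → 2 + k ≤ κ → ∀ {N} → Traces κ (suc m) N → ∀ {n} (G : Graph n) A →
    Goal t G ⊎ (Σ (Graph n) λ G' → PivIn A G G' × Nest i N (suc κ) G' A) → Res G A
  go κ κ₁ κ₂ tr G A (inj₁ x) = inj₁ (inj₁ x)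
  go κ κ₁ κ₂ tr G A (inj₂ (G' , p , nst)) =
    stage-lift t p (build κ κ₁ κ₂ G' A nst (tr (adj-sym G') (Nest.R nst) (Nest.hi nst) (Nest.w nst)))

supplied-⊆ : ∀ {n i m σ} {G : Graph n} {A A'} → (∀ x → x ∈ A' → x ∈ A) → Supplied i m σ G A' → Supplied i m σ G A
supplied-⊆ s x = record { v = v ; ps = ps ; Reg = Reg ; main = main ; in-A = All.map (s _) in-A ; Reg⊆A = λ x h → s x (Reg⊆A x h)
    ; T = T ; T∈ = T∈ ; S = S ; Y = Y ; rep = rep ; Y⊆ = Y⊆ ; D = D ; chain = chain ; R = R ; R⊆D = R⊆D ; jR = jR }
  where open Supplied x

record NestT {n} (i M m : ℕ) (σ : List ℕ) (k : ℕ) (G : Graph n) (A : Subset n) : Set where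
  field
    sup   : Fin M → Supplied i m σ G A
    R     : Subset n
    R⊆    : ∀ a x → x ∈ R → x ∈ Supplied.R (sup a)
    R⊆A   : ∀ x → x ∈ R → x ∈ A
    later : ∀ a b → a Fin.< b → Supplied.v (sup b) ∈ Supplied.R (sup a)
    hi    : Hi k (adj G) R

-- The next supply is sought inside the last bag of the previous one; the extra unit of height pays
-- for reading that bag in the graph instead of in `S`.
nestT : ∀ t i kw σ → Stage t i kw σ → ∀ M m k → Σ ℕ λ k' → ∀ {n} (G : Graph n) (A : Subset n) → Hi k' (adj G) A →
  Out t (suc i) kw G A ⊎ Σ (Graph n) λ G' → PivIn A G G' × NestT i M m σ k G' A
nestT t i kw σ st zero m k = k , λ G A hi → inj₂ (G , nil , record { sup = λ () ; R = A ; R⊆ = λ () ; R⊆A = λ x h → h ; later = λ () ; hi = hi })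
nestT t i kw σ st (suc M) m k = let (k₁ , rec) = nestT t i kw σ st M m k ; (k' , f) = st m (suc k₁) in k' , λ G A hi → first k₁ rec G A (f G A hi)
  where
  first : ∀ k₁ → (∀ {n} (G : Graph n) (A : Subset n) → Hi k₁ (adj G) A → Out t (suc i) kw G A ⊎ Σ (Graph n) λ G' → PivIn A G G' × NestT i M m σ k G' A) →
    ∀ {n} (G : Graph n) A → Out t (suc i) kw G A ⊎ (Σ (Graph n) λ G' → PivIn A G G' × Σ (Supplied i m σ G' A) λ s → Hi (suc k₁) (Supplied.S s) (Supplied.R s)) →
    Out t (suc i) kw G A ⊎ Σ (Graph n) λ G' → PivIn A G G' × NestT i (suc M) m σ k G' A
  first k₁ rec G A (inj₁ o) = inj₁ o
  first k₁ rec {n} G A (inj₂ (G₁ , p , s , h)) = second (rec G₁ (Supplied.R s) (rep-hi k₁ (Supplied.rep s) (Supplied.R⊆Y s) h))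
    where
    R⊆A' : ∀ x → x ∈ Supplied.R s → x ∈ A
    R⊆A' x q = Supplied.Reg⊆A s x (Supplied.R⊆Reg s x q)
    second : Out t (suc i) kw G₁ (Supplied.R s) ⊎ (Σ (Graph n) λ G' → PivIn (Supplied.R s) G₁ G' × NestT i M m σ k G' (Supplied.R s)) →
      Out t (suc i) kw G A ⊎ Σ (Graph n) λ G' → PivIn A G G' × NestT i (suc M) m σ k G' A
    second (inj₁ o) = inj₁ (out-lift t (suc i) kw R⊆A' p o)
    second (inj₂ (G₂ , p₂ , N)) with supplied-pivots s p₂
    ... | (s' , eR) = inj₂ (G₂ , piv-++ p (piv-⊆ R⊆A' p₂) , record
        { sup = λ { zero → s' ; (suc a) → supplied-⊆ R⊆A' (N.sup a) } ; R = N.R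
        ; R⊆ = λ { zero x q → trans (eR x) (N.R⊆A x q) ; (suc a) → N.R⊆ a } ; R⊆A = λ x q → R⊆A' x (N.R⊆A x q)
        ; later = λ { zero (suc b) _ → trans (eR _) (All.head (Supplied.in-A (N.sup b))) ; (suc a) (suc b) (s≤s q) → N.later a b q } ; hi = N.hi })
      where module N = NestT N

-- A later representative, adjacent to v with the same trace, is a looped vertex of S that vanishes on Z.
open-chain : ∀ t i kw σ → Stage t i kw σ → Stage t i kw (1 ∷ σ)
open-chain t i kw σ st m k =
  let κ = suc (suc (k + (3 + kw))) ; (N , tr) = traces κ 2 ; (k' , f) = nestT t i kw σ st N m (suc κ) in
  k' , λ G A hi → go κ (NP.m≤n+m (3 + kw) (2 + k)) (s≤s (s≤s (NP.m≤m+n k (3 + kw)))) tr G A (f G A hi)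
  where
  Res : ∀ {n} → Graph n → Subset n → Set
  Res {n} G A = Out t (suc i) kw G A ⊎ Σ (Graph n) λ G' → PivIn A G G' × Σ (Supplied i m (1 ∷ σ) G' A) λ s → Hi k (Supplied.S s) (Supplied.R s)
  build : ∀ κ → 3 + kw ≤ κ → 2 + k ≤ κ → ∀ {n N} (G : Graph n) A (N : NestT i N m σ (suc κ) G A) →
    Trace 2 κ (adj G) (NestT.R N) (λ j → Supplied.v (NestT.sup N j)) → Res G A
  build κ κ₁ κ₂ {n} G A nst tr = finish' (pair t i kw {G = G} {A} V.main V.Reg⊆A V.in-A (V.R⊆Reg _ ℓR) ℓZ₁ (λ x h → V.R⊆Reg x (Z₁⊆V x h)) jZ₁ (hi-≤ κ₁ hZ₁)
      (same zero (suc zero)))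
    where
    open NestT nst
    open Trace tr using (e; same) renaming (Z to Z₁; Z⊆R to Z₁⊆R; jZ to jZ₁; hi to hZ₁)
    g = adj G
    sg = adj-sym G
    module V = Supplied (sup (at e zero))
    module L = Supplied (sup (at e (suc zero)))
    ℓ = L.v
    Z₁⊆V : ∀ x → x ∈ Z₁ → x ∈ V.R
    Z₁⊆V x h = R⊆ (at e zero) x (Z₁⊆R x h)
    ℓR : ℓ ∈ V.R
    ℓR = later _ _ (mono e {zero} {suc zero} (s≤s z≤n))
    ℓZ₁ : ℓ ∉ Z₁
    ℓZ₁ = ≢true (λ h → tf (L.R⊆Reg _ (R⊆ (at e (suc zero)) _ (Z₁⊆R _ h))) (Main.w∉ L.main))
    finish' : Out t (suc i) kw G A ⊎ (g V.v ℓ ≡ true) → Res G A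
    finish' (inj₁ o) = inj₁ o
    finish' (inj₂ a) = inj₂ (G , nil , sup' , hZ₂)
      where
      sS = Rep.sy V.rep
      looped : V.S ℓ ℓ ≡ true
      looped = trans (sym (Rep.vY V.rep ℓ (V.R⊆Y ℓ ℓR))) a
      -- The row of `ℓ` in `S` is its row in the graph plus the diagonal of `S`, that is, plus the
      -- trace of `v`. The two traces are equal and cancel.
      van : ∀ z → z ∈ Z₁ → V.S ℓ z ≡ false
      van z h = xor-cancel (trans (cong (λ u → V.S ℓ z xor (u ∧ V.S z z)) (sym looped)) (trans (sym (Rep.YY V.rep ℓ z (V.R⊆Y ℓ ℓR) zY (λ q → tf (trans (cong Z₁ q) h) ℓZ₁)))
          (trans (sym (same zero (suc zero) z h)) (Rep.vY V.rep z zY))))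
        where
        zY = V.R⊆Y z (Z₁⊆V z h)
        xor-cancel : ∀ {a b} → a xor b ≡ b → a ≡ false
        xor-cancel {false} _ = refl
        xor-cancel {true} {true} ()
        xor-cancel {true} {false} ()
      comp' = hi-comp k sS (hi-rep (suc k) V.rep (λ x h → V.R⊆Y x (Z₁⊆V x h)) (hi-≤ κ₂ hZ₁))
      Z₂ = proj₁ comp'
      Z₂⊆ = proj₁ (proj₂ comp')
      jZ₂ = proj₁ (proj₂ (proj₂ comp'))
      hZ₂ = proj₂ (proj₂ (proj₂ comp'))
      z₀ = proj₂ (hi-nonempty k hZ₂)
      ar = around sS V.jR ℓR (λ x h → ⊝-i {A = V.R} (Z₁⊆V x (Z₂⊆ x h)) (∈∉ {A = Z₁} (Z₂⊆ x h) ℓZ₁)) jZ₂ z₀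
      K = proj₁ ar
      K⊆ : ∀ x → x ∈ K → x ∈ V.R
      K⊆ x h = ∧-l (proj₁ (proj₂ (proj₂ ar)) x h)
      ℓK : ℓ ∉ K
      ℓK = ≢true (λ h → ⊝-r {A = V.R} (proj₁ (proj₂ (proj₂ ar)) ℓ h) refl)
      start-at-ℓ : Handle V.S ℓ [] K
      start-at-ℓ = record { pth = tt , tt ; null = [] ; out = ℓK ∷ [] }
      -- As `ℓ` vanishes on `Z₂`, the path grown from `ℓ` has a new end, and `ℓ` is among the
      -- vertices behind it.
      module Gr = Grown (grow sS start-at-ℓ (proj₂ (proj₂ (proj₂ ar))) (proj₁ (proj₂ ar)) jZ₂ z₀ (λ z h → van z (Z₂⊆ z h)))
      sup' : Supplied i m (1 ∷ σ) G A
      sup' = record { v = V.v ; ps = V.ps ; Reg = V.Reg ; main = V.main ; in-A = V.in-A ; Reg⊆A = V.Reg⊆A ; T = V.T ; T∈ = V.T∈ ; S = V.S ; Y = V.Y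
        ; rep = V.rep ; Y⊆ = V.Y⊆ ; D = Z₂
        ; chain = cons V.chain (record { H = Gr.handle ; jn = Gr.conn ; len = s≤s z≤n }) (λ x h → V.R⊆D x (Z₁⊆V x (Z₂⊆ x h)))
            (Gr.within V.D (λ x h → V.R⊆D x (K⊆ x h)) (V.R⊆D ℓ ℓR ∷ [])) (loopy-suf Gr.suf (ℓ , hit looped))
        ; R = Z₂ ; R⊆D = λ x h → h ; jR = jZ₂ }
  go : ∀ κ → 3 + kw ≤ κ → 2 + k ≤ κ → ∀ {N} → Traces κ 2 N → ∀ {n} (G : Graph n) A →
    Out t (suc i) kw G A ⊎ (Σ (Graph n) λ G' → PivIn A G G' × NestT i N m σ (suc κ) G' A) → Res G A
  go κ κ₁ κ₂ tr G A (inj₁ o) = inj₁ o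
  go κ κ₁ κ₂ tr G A (inj₂ (G' , p , nst)) =
    stage-lift t p (build κ κ₁ κ₂ G' A nst (tr (adj-sym G') (NestT.R nst) (NestT.hi nst) (λ j → Supplied.v (NestT.sup nst j))))

record Rows {n} (q j : ℕ) (σ : List ℕ) (S : Mat n) (Y D : Subset n) : Set where
  field
    D₀     : Subset n
    base   : Chain S Y D₀ σ
    w      : Fin q → Fin n
    ps     : Fin q → List (Fin n)
    Rg     : Fin q → Subset n
    main   : ∀ a → Main S j (w a) (ps a) (Rg a)
    Rg⊆    : ∀ a x → x ∈ Rg a → x ∈ D₀
    in-D₀  : ∀ a → All (_∈ D₀) (w a ∷ ps a)
    loopy  : ∀ a → Loopy S (ps a)
    D⊆D₀   : ∀ x → x ∈ D → x ∈ D₀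
    D⊆Rg   : ∀ a x → x ∈ D → x ∈ Rg a
    nested : ∀ a b → a Fin.< b → All (_∈ Rg b) (w a ∷ ps a)

-- Index 0 is the innermost handle.
rows : ∀ q {j σ n} {S : Mat n} {Y D : Subset n} → Chain S Y D (replicate q j ++ σ) → Rows q j σ S Y D
rows zero c = record { D₀ = _ ; base = c ; w = λ () ; ps = λ () ; Rg = λ () ; main = λ () ; Rg⊆ = λ () ; in-D₀ = λ () ; loopy = λ ()
  ; D⊆D₀ = λ x h → h ; D⊆Rg = λ () ; nested = λ () }
rows (suc q) (cons {D} c {w = w} {ps} {R} M R⊆D a l) = record
  { D₀ = r.D₀ ; base = r.base ; w = λ { zero → w ; (suc a) → r.w a } ; ps = λ { zero → ps ; (suc a) → r.ps a } ; Rg = λ { zero → R ; (suc a) → r.Rg a }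
  ; main = λ { zero → M ; (suc a) → r.main a } ; Rg⊆ = λ { zero x h → r.D⊆D₀ x (R⊆D x h) ; (suc a) → r.Rg⊆ a }
  ; in-D₀ = λ { zero → All.map (r.D⊆D₀ _) a ; (suc a) → r.in-D₀ a } ; loopy = λ { zero → l ; (suc a) → r.loopy a } ; D⊆D₀ = λ x h → r.D⊆D₀ x (R⊆D x h)
  ; D⊆Rg = λ { zero x h → h ; (suc a) x h → r.D⊆Rg a x (R⊆D x h) }
  ; nested = λ { zero (suc b) _ → All.map (r.D⊆Rg b _) a ; (suc a) (suc b) (s≤s p) → r.nested a b p } }
  where module r = Rows (rows q c)

repeated : ∀ t i kw σ j → (∀ σ → Stage t i kw σ → Stage t i kw (j ∷ σ)) → ∀ q → Stage t i kw σ → Stage t i kw (replicate q j ++ σ)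
repeated t i kw σ j f zero    st = st
repeated t i kw σ j f (suc q) st = f (replicate q j ++ σ) (repeated t i kw σ j f q st)

combine-even-odd : ∀ {t} (i j : Fin t) → j Fin.≤ i → combine {t} {2} j zero Fin.< combine i (suc zero)
combine-even-odd {t} i j p with NP.m≤n⇒m<n∨m≡n p
... | inj₁ q = FP.combine-monoˡ-< {m = t} {n = 2} zero (suc zero) q
... | inj₂ q with FP.toℕ-injective q
...   | refl = NP.≤-trans (NP.≤-reflexive (cong suc (FP.toℕ-combine {t} {2} j zero)))
               (NP.≤-trans (NP.≤-reflexive (trans (cong suc (NP.+-identityʳ _)) (sym (NP.+-comm _ 1)))) (NP.≤-reflexive (sym (FP.toℕ-combine {t} {2} j (suc zero)))))

-- The hypotheses leave open which of `x a` and `y a` with the same index are adjacent. Odd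
-- positions on one side and even ones on the other avoid these pairs and turn `j ≤ i` into
-- `2j < 2i + 1`; hence `t * 2` vertices on each side.
order-half : ∀ t {n} (G : Graph n) (x y : Fin (t * 2) → Fin n) → (∀ a b → a ≢ b → adj G (x a) (x b) ≡ true) → (∀ a b → a ≢ b → adj G (y a) (y b) ≡ true) →
  (∀ a b → a Fin.< b → adj G (x b) (y a) ≡ true) → (∀ a b → b Fin.< a → adj G (x b) (y a) ≡ false) → (∀ a b → a ≢ b → x b ≢ y a) →
  PivotMinor (cliqueHalf t) G
order-half t G x y xx yy lo hi ne = half-minor G (λ i → x (combine i (suc zero))) (λ j → y (combine j zero))
    (λ i j p → xx _ _ (λ e → p (proj₁ (FP.combine-injective i (suc zero) j (suc zero) e))))
    (λ i j p → yy _ _ (λ e → p (proj₁ (FP.combine-injective i zero j zero e))))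
    uv (λ i j → ne _ _ (λ e → odd j i (proj₂ (FP.combine-injective j zero i (suc zero) e))))
  where
  odd : ∀ {t} (i j : Fin t) → zero ≢ Fin.suc {1} zero
  odd i j ()
  uv : ∀ i j → adj G (x (combine i (suc zero))) (y (combine j zero)) ≡ does (j FP.≤? i)
  uv i j with bool (does (j FP.≤? i))
  ... | inj₁ p = trans (lo _ _ (combine-even-odd i j (does-yes (j FP.≤? i) p))) (sym p)
  ... | inj₂ p = trans (hi _ _ (FP.combine-monoˡ-< {m = t} {n = 2} (suc zero) zero (NP.≰⇒> (does-no (j FP.≤? i) p)))) (sym p)

better-grown : ∀ {k n} {S : Mat n} {w ps B Z} → Grown S w ps B Z → Joined S Z → Hi k S Z → Better k 4 S w ps B Z
better-grown {S = S} {Z = Z} g j hi = record { S' = S ; steps = nil ; y = y ; qs = qs ; Z' = Z ; Z'⊆Z = λ x h → h ; handle = handle ; conn = conn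
    ; joined = j ; hi = hi ; suf = suf ; within = within }
  where open Grown g

-- All pairs of handles failing to merge means that the w's and the first loops of the handles induce a half graph.
all-bad : ∀ t {n m j} (G : Graph n) {v} {T : Fin m → Fin n} {S : Mat n} {Y : Subset n} → Rep m (adj G) v T S Y →
  (w : Fin (t * 2) → Fin n) (ps : Fin (t * 2) → List (Fin n)) (Rg : Fin (t * 2) → Subset n) (ℓ : Fin (t * 2) → Fin n) →
  (∀ a → Main S j (w a) (ps a) (Rg a)) → (∀ a → All (_∈ Y) (w a ∷ ps a)) → (∀ a → FirstLoop S (ps a) (ℓ a)) →
  (∀ a b → a Fin.< b → All (_∈ Rg b) (w a ∷ ps a)) → (∀ a b → S (w a) (w a) ≡ S (w b) (w b)) →
  (∀ a b → a Fin.< b → (S (w b) (w a) ≡ not (S (w a) (w a))) × (S (w b) (ℓ a) ≡ true)) → PivotMinor (cliqueHalf t) G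
all-bad t {n} {j = j} G {S = S} {Y} rep w ps Rg ℓ main inY fl nested own bad = go (∃? (λ a → S (w a) (w a)))
  where
  open Rep rep using (sy; YY)
  ∈ps : ∀ {Q : Fin n → Set} {l q} → All Q l → FirstLoop S l q → Q q
  ∈ps (h ∷ _) (hit _) = h
  ∈ps (_ ∷ a) (miss _ r) = ∈ps a r
  lp : ∀ {l q} → FirstLoop S l q → S q q ≡ true
  lp (hit h) = h
  lp (miss _ r) = lp r
  far : ∀ a b → a Fin.< b → S (w a) (ℓ b) ≡ false
  far a b p = trans (sy (w a) (ℓ b)) (∈ps (Handle.null (Main.H (main b))) (fl b) (w a) (All.head (nested a b p)))
  w≢ℓ : ∀ a b → a ≢ b → w a ≢ ℓ b
  w≢ℓ a b ne with NP.<-cmp (toℕ a) (toℕ b)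
  ... | tri< p _ _ = ∈∉ {A = Rg b} (All.head (nested a b p)) (∈ps (All.tail (Handle.out (Main.H (main b)))) (fl b))
  ... | tri≈ _ p _ = ⊥-elim (ne (FP.toℕ-injective p))
  ... | tri> _ _ p = λ e → ∈∉ {A = Rg a} (∈ps (All.tail (nested b a p)) (fl b)) (All.head (Handle.out (Main.H (main a)))) (sym e)
  wℓ : ∀ a b → a ≢ b → adj G (w a) (ℓ b) ≡ S (w a) (ℓ b) xor S (w a) (w a)
  wℓ a b ne = trans (YY (w a) (ℓ b) (All.head (inY a)) (∈ps (All.tail (inY b)) (fl b)) (w≢ℓ a b ne))
    (cong (S (w a) (ℓ b) xor_) (trans (cong (S (w a) (w a) ∧_) (lp (fl b))) (BP.∧-identityʳ _)))
  sides : ∀ {x : Fin (t * 2) → Fin n} → (∀ a b → a Fin.< b → adj G (x b) (x a) ≡ true) → ∀ a b → a ≢ b → adj G (x a) (x b) ≡ true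
  sides {x} f a b ne with NP.<-cmp (toℕ a) (toℕ b)
  ... | tri< p _ _ = trans (adj-sym G (x a) (x b)) (f a b p)
  ... | tri≈ _ p _ = ⊥-elim (ne (FP.toℕ-injective p))
  ... | tri> _ _ p = f b a p
  ww : ∀ a b → a ≢ b → adj G (w a) (w b) ≡ true
  ww = sides (λ a b p → trans (YY (w b) (w a) (All.head (inY b)) (All.head (inY a)) (λ e → ∈∉ {A = Rg b} (All.head (nested a b p)) (Main.w∉ (main b)) (sym e)))
    (trans (cong₂ (λ u v → u xor (v ∧ S (w a) (w a))) (proj₁ (bad a b p)) (own b a)) (taut 1 (λ { (u ∷ []) → not u xor (u ∧ u) }) (λ _ → true) refl (S (w a) (w a) ∷ []))))
  ℓℓ : ∀ a b → a ≢ b → adj G (ℓ a) (ℓ b) ≡ true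
  ℓℓ = sides (λ a b p → trans (YY (ℓ b) (ℓ a) (∈ps (All.tail (inY b)) (fl b)) (∈ps (All.tail (inY a)) (fl a))
      (λ e → ∈∉ {A = Rg b} (∈ps (All.tail (nested a b p)) (fl a)) (∈ps (All.tail (Handle.out (Main.H (main b)))) (fl b)) (sym e)))
    (cong₂ _xor_ (∈ps (Handle.null (Main.H (main b))) (fl b) (ℓ a) (∈ps (All.tail (nested a b p)) (fl a))) (cong₂ _∧_ (lp (fl b)) (lp (fl a)))))
  -- If the vertices `w` are looped, passing from `S` to the graph complements the entries between
  -- the two sides, so the sides exchange their roles.
  go : (Σ (Fin (t * 2)) λ a → S (w a) (w a) ≡ true) ⊎ (∀ a → S (w a) (w a) ≡ false) → PivotMinor (cliqueHalf t) G
  go (inj₁ (a₀ , λt)) = order-half t G ℓ w ℓℓ ww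
    (λ a b p → trans (adj-sym G (ℓ b) (w a)) (trans (wℓ a b (λ e → NP.<-irrefl (cong toℕ e) p)) (cong₂ _xor_ (far a b p) (trans (own a a₀) λt))))
    (λ a b p → trans (adj-sym G (ℓ b) (w a)) (trans (wℓ a b (λ e → NP.<-irrefl (cong toℕ (sym e)) p)) (cong₂ _xor_ (proj₂ (bad b a p)) (trans (own a a₀) λt))))
    (λ a b p e → w≢ℓ a b p (sym e))
  go (inj₂ λf) = order-half t G w ℓ ww ℓℓ
    (λ a b p → trans (wℓ b a (λ e → NP.<-irrefl (cong toℕ (sym e)) p)) (cong₂ _xor_ (proj₂ (bad a b p)) (λf b)))
    (λ a b p → trans (wℓ b a (λ e → NP.<-irrefl (cong toℕ e) p)) (cong₂ _xor_ (far b a p) (λf b)))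
    (λ a b p → w≢ℓ b a (λ e → p (sym e)))

-- Among many nested handles of length `j` some pair merges, or `all-bad` applies. The merged handle
-- replaces all of them on top of `σ`. Four more twins are prepared, because a merger takes at most
-- four loop pivots.
lengthen : ∀ t i kw j → (∀ σ → Stage t i kw σ → Stage t i kw (j ∷ σ)) → ∀ σ → Stage t i kw σ → Stage t i kw (suc j ∷ σ)
lengthen t i kw j f σ st m k =
  -- The height required by `fix`.
  let κ = 4 + k ; (N , tr) = traces κ (t * 2) ; (k' , h) = repeated t i kw σ j f N st (4 + m) (suc κ) in
  k' , λ G A hi → go tr G A (h G A hi)
  where
  Res : ∀ {n} → Graph n → Subset n → Set
  Res {n} G A = Out t (suc i) kw G A ⊎ Σ (Graph n) λ G' → PivIn A G G' × Σ (Supplied i m (suc j ∷ σ) G' A) λ s → Hi k (Supplied.S s) (Supplied.R s)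
  build : ∀ {n N} (G : Graph n) A (s : Supplied i (4 + m) (replicate N j ++ σ) G A) (r : Rows N j σ (Supplied.S s) (Supplied.Y s) (Supplied.D s)) →
    Trace (t * 2) (4 + k) (Supplied.S s) (Supplied.R s) (Rows.w r) → Res G A
  build {n} G A s r tr = finish' (all⊎ (λ a → all⊎ (λ b → test a b (a FP.<? b))))
    where
    open Supplied s
    module r = Rows r
    open Trace tr using (e; same; own) renaming (Z to Z₁; Z⊆R to Z₁⊆R; jZ to jZ₁; hi to hZ₁)
    sS = Rep.sy rep
    M = t * 2
    W : Fin M → Fin n
    W a = r.w (at e a)
    P : Fin M → List (Fin n)
    P a = r.ps (at e a)
    B : Fin M → Subset n
    B a = r.Rg (at e a)
    main' : ∀ a → Main S j (W a) (P a) (B a)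
    main' a = r.main (at e a)
    Z⊆B : ∀ a x → x ∈ Z₁ → x ∈ B a
    Z⊆B a x h = r.D⊆Rg (at e a) x (R⊆D x (Z₁⊆R x h))
    nested : ∀ a b → a Fin.< b → All (_∈ B b) (W a ∷ P a)
    nested a b p = r.nested _ _ (mono e p)
    Good : Set
    Good = Σ (Fin M) λ b → Better k 4 S (W b) (P b) (B b) Z₁
    Bad : Fin M → Fin M → Set
    Bad a b = (S (W b) (W a) ≡ not (S (W a) (W a))) × (S (W b) (proj₁ (r.loopy (at e a))) ≡ true)
    test : ∀ a b → Dec (a Fin.< b) → Good ⊎ (a Fin.< b → Bad a b)
    test a b (no q) = inj₂ (λ p → ⊥-elim (q p))
    test a b (yes p) with ∃? (λ z → Z₁ z ∧ S (W b) z)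
    ... | inj₂ none = inj₁ (b , better-grown (main-grow sS (main' b) (Z⊆B b) jZ₁ (proj₂ (hi-nonempty (4 + k) hZ₁)) (λ z h → ≢true (λ q → tf (∧-i h q) (none z))))
            jZ₁ (hi-≤ (NP.m≤n+m k 4) hZ₁))
    ... | inj₁ (c , h) = parity (S (W b) (W a) BP.≟ S (W a) (W a))
      where
      cZ = ∧-l h
      wc = ∧-r {Z₁ c} h
      wZ : W a ∉ Z₁
      wZ = ≢true (λ q → tf (Z⊆B a _ q) (Main.w∉ (main' a)))
      parity : Dec (S (W b) (W a) ≡ S (W a) (W a)) → Good ⊎ (a Fin.< b → Bad a b)
      parity (yes good) = inj₁ (b , better-weak (s≤s (s≤s z≤n)) (merge k (twins sS (Main.H (main' b)) (Z⊆B b) (All.head (nested a b p)) wZ (same b a) jZ₁ cZ wc)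
        good cZ wc (hi-≤ (NP.n≤1+n (3 + k)) hZ₁)))
      parity (no bad) with fix k (P a) (record { sy = sS ; H₁ = Main.H (main' b) ; H₂ = handle-⊆ (Z⊆B a) (Main.H (main' a)) ; Z⊆B = Z⊆B b
          ; w₂B = All.head (nested a b p) ; ps₂B = All.tail (nested a b p) ; jZ = jZ₁ ; c = c ; cZ = cZ ; w₁c = wc ; same = same b a
          ; bad = BP.¬-not bad ; hi = hZ₁ }) (proj₂ (r.loopy (at e a)))
      ... | inj₁ g = inj₁ (b , g)
      ... | inj₂ q = inj₂ (λ _ → BP.¬-not bad , q)
    finish' : (Σ (Fin M) λ _ → Σ (Fin M) λ _ → Good) ⊎ (∀ a b → a Fin.< b → Bad a b) → Res G A
    finish' (inj₂ bad) = inj₁ (inj₁ (inj₂ (all-bad t G rep W P B (λ a → proj₁ (r.loopy (at e a))) main'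
      (λ a → All.map (chain-⊆ r.base _) (r.in-D₀ (at e a))) (λ a → proj₂ (r.loopy (at e a))) nested own bad)))
    finish' (inj₁ (_ , _ , b , g)) = realise (rep-steps {k = m} 4 {A = Reg} {B = B b} (λ x h → chain-⊆ r.base x (r.Rg⊆ (at e b) x h)) Y⊆ T∈ rep steps)
      where
      module g = Better g
      open g using (steps)
      b' = at e b
      realise : (Σ (Graph n) λ G' → Σ (Fin m → Fin n) λ T' → PivIn Reg G G' × (∀ x → T' x ∈ Reg) × Rep m (adj G') v T' g.S' Y) → Res G A
      realise (G' , T' , p , T'∈ , rep') = inj₂ (G' , piv-⊆ Reg⊆A p , record { v = v ; ps = ps ; Reg = Reg
          ; main = main-steps (adj-sym G) (λ x h → h) (piv-steps p) main ; in-A = in-A ; Reg⊆A = Reg⊆A ; T = T' ; T∈ = T'∈ ; S = g.S' ; Y = Y ; rep = rep' ; Y⊆ = Y⊆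
          ; D = g.Z'
          ; chain = cons (chain-steps sS (r.Rg⊆ b') steps r.base)
              (record { H = g.handle ; jn = g.conn ; len = s≤s (NP.≤-trans (Main.len (main' b)) (suf-length g.suf)) })
              (λ x h → r.Rg⊆ b' x (Z⊆B b x (g.Z'⊆Z x h))) (g.within r.D₀ (r.Rg⊆ b') (r.in-D₀ b'))
              (loopy-suf g.suf (loopy-cons (W b) (loopy-steps sS (λ x h → h) steps (Main.H (main' b)) (r.loopy b'))))
          ; R = g.Z' ; R⊆D = λ x h → h ; jR = g.joined } , g.hi)
  go : ∀ {N} → Traces (4 + k) (t * 2) N → ∀ {n} (G : Graph n) A →
    Out t (suc i) kw G A ⊎ (Σ (Graph n) λ G' → PivIn A G G' × Σ (Supplied i (4 + m) (replicate N j ++ σ) G' A) λ s → Hi (5 + k) (Supplied.S s) (Supplied.R s)) → Res G A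
  go tr G A (inj₁ o) = inj₁ o
  go tr G A (inj₂ (G' , p , s , h)) = let r = rows _ (Supplied.chain s) in
    stage-lift t p (build G' A s r (tr (Rep.sy (Supplied.rep s)) (Supplied.R s) h (Rows.w r)))

stages : ∀ t i kw j σ → Stage t i kw σ → Stage t i kw (suc j ∷ σ)
stages t i kw zero    = open-chain t i kw
stages t i kw (suc j) = lengthen t i kw (suc j) (stages t i kw j)

-- A long handle in S becomes an unlooped path of length t by O(t²) loop moves, each paid for by one twin.
grows-suc : ∀ t i → Grows t i → Grows t (suc i)
-- The summand 0 in the number of twins is what `rep-steps` leaves over.
grows-suc t i L kw = let (k' , f) = stages t i kw (t * (4 + t)) [] (start t i kw L) (t * (4 + t) + 0) 0 in k' , λ G A hi → go G A (f G A hi)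
  where
  go : ∀ {n} (G : Graph n) A → Out t (suc i) kw G A ⊎ (Σ (Graph n) λ G' → PivIn A G G' ×
    Σ (Supplied i (t * (4 + t) + 0) (suc (t * (4 + t)) ∷ []) G' A) λ s → Hi 0 (Supplied.S s) (Supplied.R s)) → Out t (suc i) kw G A
  go G A (inj₁ o) = o
  go {n} G A (inj₂ (G' , p , s , _)) = out-lift t (suc i) kw (λ x h → h) p (inj₁ (read chain))
    where
    open Supplied s
    read : ∀ {D} → Chain S Y D (suc (t * (4 + t)) ∷ []) → Goal t G'
    read (cons nil {w = w} {ps} M _ inY _) = realise (rep-steps {k = 0} (t * (4 + t)) {A = Reg} {B = Y} (λ x h → h) Y⊆ T∈ rep c.steps)
      where
      cross : ∀ {S : Mat n} l → Cross S l []
      cross [] = tt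
      cross (x ∷ l) = tt , All.tabulate (λ _ → [])
      module c = Cleaned (word t t (Rep.sy rep) (w ∷ ps) [] (Handle.pth (Main.H M) , tt , cross (w ∷ ps)) inY [] [] (NP.<⇒≤ (Main.len M)) (NP.m≤m+n t 0))
      realise : (Σ (Graph n) λ G₁ → Σ (Fin 0 → Fin n) λ T' → PivIn Reg G' G₁ × (∀ x → T' x ∈ Reg) × Rep 0 (adj G₁) v T' c.S' Y) → Goal t G'
      realise (G₁ , _ , q , _ , rep') = goal-lift t q (inj₁ (path-minor G₁ c.zs (plain c.zs c.zs∈ c.clean c.pth) c.long))
        where
        plain : ∀ l → All (_∈ Y) l → Clean c.S' l → Path c.S' l → Path (adj G₁) l
        plain [] _ _ _ = tt
        plain (x ∷ l) (hx ∷ hl) (cx ∷ cl) (k , p) = link-cong l (All.zipWith (λ { {z} (hz , ne) →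
          trans (Rep.YY rep' x z hx hz ne) (xf (c.S' x z) (∧f' (c.S' z z) cx)) }) (hl , link-≢ l k)) k , plain l hl cl p

grows : ∀ t i → Grows t i
grows t zero    = grows-base t
grows t (suc i) = grows-suc t i (grows t i)

high-goal : ∀ t → Σ ℕ λ k → ∀ {n} (G : Graph n) → Hi k (adj G) (λ _ → true) → Goal t G
high-goal t = let (k , f) = grows t t 0 in k , λ G hi → go G (f G (λ _ → true) hi)
  where
  go : ∀ {n} (G : Graph n) → Out t t 0 G (λ _ → true) → Goal t G
  go G (inj₁ g) = g
  go G (inj₂ (G' , p , l)) = goal-lift t p (inj₁ (path-minor G' (Lolli.w l ∷ Lolli.ps l) (Handle.pth (Lolli.H l)) (Lolli.len l)))

-- Low matrices have small rank-depth

-- The model is unfolded into equivalence relations, one for each level and finer with growing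
-- level, so that the decomposition tree can be defined on all levels at once. The `code` of a
-- vertex collects its labels of all levels.
record Flat {n} (D K : ℕ) (S : Mat n) (A : Subset n) : Set where
  field
    same    : ℕ → Fin n → Fin n → Bool
    code    : Fin n → Fin K
    s-refl  : ∀ e x → same e x x ≡ true
    s-sym   : ∀ e x y → same e x y ≡ true → same e y x ≡ true
    s-trans : ∀ e x y z → same e x y ≡ true → same e y z ≡ true → same e x z ≡ true
    s-0     : ∀ x y → same 0 x y ≡ true
    s-up    : ∀ e x y → same (suc e) x y ≡ true → same e x y ≡ true
    s-D     : ∀ x y → x ∈ A → y ∈ A → same D x y ≡ true → x ≡ y
    split-eq : ∀ e x y x' y' → x ∈ A → y ∈ A → x' ∈ A → y' ∈ A → same e x y ≡ true → same e x' y' ≡ true → same e x x' ≡ true →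
      same (suc e) x y ≡ false → same (suc e) x' y' ≡ false → code x ≡ code x' → code y ≡ code y' → S x y ≡ S x' y'

codes : ℕ → ℕ → ℕ
codes ℓ zero    = 1
codes ℓ (suc d) = 2 ^ ℓ * codes ℓ d

flat : ∀ ℓ d {n} {S : Mat n} {A : Subset n} → TM ℓ d S A → Flat d (codes ℓ d) S A
flat ℓ zero t = record { same = λ _ _ _ → true ; code = λ _ → zero ; s-refl = λ _ _ → refl ; s-sym = λ _ _ _ h → h ; s-trans = λ _ _ _ _ h _ → h
  ; s-0 = λ _ _ → refl ; s-up = λ _ _ _ h → h ; s-D = λ x y a b _ → t x y a b ; split-eq = λ _ _ _ _ _ _ _ _ _ _ _ _ () }
flat ℓ (suc d) {n} {S} {A} (p , lab , co , ch) = record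
  { same = same ; code = λ x → combine (lab x) (F.code (p x) x)
  ; s-refl = λ { zero x → refl ; (suc e) x → ∧-i (==-refl (p x)) (F.s-refl (p x) e x) }
  ; s-sym = λ { zero x y h → refl ; (suc e) x y h → let (q , s) = un e x y h in
      ∧-i (==-t (sym q)) (subst (λ c → F.same c e y x ≡ true) q (F.s-sym (p x) e x y s)) }
  ; s-trans = λ { zero x y z h h' → refl ; (suc e) x y z h h' → let (q , s) = un e x y h ; (q' , s') = un e y z h' in
      ∧-i (==-t (trans q q')) (F.s-trans (p x) e x y z s (subst (λ c → F.same c e y z ≡ true) (sym q) s')) }
  ; s-0 = λ _ _ → refl
  ; s-up = λ { zero x y h → refl ; (suc e) x y h → let (q , s) = un (suc e) x y h in ∧-i (==-t q) (F.s-up (p x) e x y s) }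
  ; s-D = λ x y a b h → let (q , s) = un d x y h in F.s-D (p x) x y (∧-i a (==-refl (p x))) (∧-i b (==-t (sym q))) s
  ; split-eq = eq }
  where
  module F c = Flat (flat ℓ d (ch c))
  same : ℕ → Fin n → Fin n → Bool
  same zero    x y = true
  same (suc e) x y = (p x == p y) ∧ F.same (p x) e x y
  un : ∀ e x y → same (suc e) x y ≡ true → p x ≡ p y × F.same (p x) e x y ≡ true
  un e x y h = ==-yes (∧-l h) , ∧-r {p x == p y} h
  uncode : ∀ x x' → combine (lab x) (F.code (p x) x) ≡ combine (lab x') (F.code (p x') x') → lab x ≡ lab x' × F.code (p x) x ≡ F.code (p x') x'
  uncode x x' = FP.combine-injective (lab x) _ (lab x') _
  apart : ∀ x y → same 1 x y ≡ false → p x ≢ p y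
  apart x y h q = tf (∧-i (==-t q) (F.s-0 (p x) x y)) h
  eq : ∀ e x y x' y' → x ∈ A → y ∈ A → x' ∈ A → y' ∈ A → same e x y ≡ true → same e x' y' ≡ true → same e x x' ≡ true →
    same (suc e) x y ≡ false → same (suc e) x' y' ≡ false → combine (lab x) (F.code (p x) x) ≡ combine (lab x') (F.code (p x') x') →
    combine (lab y) (F.code (p y) y) ≡ combine (lab y') (F.code (p y') y') → S x y ≡ S x' y'
  eq zero x y x' y' a b a' b' _ _ _ n n' c c' =
    co x y x' y' a b a' b' (apart x y n) (apart x' y' n') (proj₁ (uncode x x' c)) (proj₁ (uncode y y' c'))
  eq (suc e) x y x' y' a b a' b' h h' h'' n n' c c' with un e x y h | un e x' y' h' | un e x x' h''
  ... | (q , s) | (q' , s') | (q'' , s'') = F.split-eq (p x) e x y x' y' (∧-i a (==-refl (p x))) (∧-i b (==-t (sym q))) (∧-i a' (==-t (sym q'')))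
      (∧-i b' (==-t (sym (trans q'' q')))) s (subst (λ c → F.same c e x' y' ≡ true) (sym q'') s') s''
      (≢true (λ t → tf (∧-i (==-t q) t) n)) (≢true (λ t → tf (∧-i (==-t q') (subst (λ c → F.same c (suc e) x' y' ≡ true) q'' t)) n'))
      (trans (proj₂ (uncode x x' c)) (cong (λ c → F.code c x') (sym q'')))
      (trans (cong (λ c → F.code c y) q) (trans (proj₂ (uncode y y' c')) (cong (λ c → F.code c y') (sym (trans q'' q')))))

-- The top partition can be made proper by moving trivial levels to the bottom.
proper : ∀ ℓ d {n} {S : Mat n} {A : Subset n} → TM ℓ (suc d) S A → ∀ {a b} → a ∈ A → b ∈ A → a ≢ b →
  Σ (TM ℓ (suc d) S A) λ t → Σ (Fin n) λ x → Σ (Fin n) λ y → x ∈ A × y ∈ A × proj₁ t x ≢ proj₁ t y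
proper ℓ d {n} {S} {A} t@(p , lab , co , ch) {a} {b} ha hb ne
  with any₂? (λ x y → x ∈ A × y ∈ A × p x ≢ p y) (λ x y → (A x BP.≟ true) ×-dec (A y BP.≟ true) ×-dec ¬? (p x FP.≟ p y))
... | inj₁ (x , y , hx , hy , q) = t , x , y , hx , hy , q
... | inj₂ none = down d (TM-⊆ ℓ d (λ x h → ∧-i h (const x h)) (ch (p a)))
  where
  const : ∀ x → x ∈ A → (p x == p a) ≡ true
  const x h with bool (p x == p a)
  ... | inj₁ q = q
  ... | inj₂ q = ⊥-elim (none x a (h , ha , ==-no q))
  down : ∀ d → TM ℓ d S A → Σ (TM ℓ (suc d) S A) λ t → Σ (Fin n) λ x → Σ (Fin n) λ y → x ∈ A × y ∈ A × proj₁ t x ≢ proj₁ t y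
  down zero    t = ⊥-elim (ne (t a b ha hb))
  down (suc d) t with proper ℓ d t ha hb ne
  ... | ((p , lab , co , ch) , x , y , hx , hy , q) = (p , lab , co , λ c → TM-suc ℓ d (ch c)) , x , y , hx , hy , q

-- Trees given by a parent function

conn-++ : ∀ {N} {T : Graph N} {P : Fin N → Set} {x y z} → Conn T P x y → Conn T P y z → Conn T P x z
conn-++ (here _) d = d
conn-++ (there p a c) d = there p a (conn-++ c d)

conn-sym : ∀ {N} {T : Graph N} {P : Fin N → Set} {x y} → Conn T P x y → Conn T P y x
conn-sym (here p) = here p
conn-sym {T = T} (there {x} {z} p a c) = conn-++ (conn-sym c) (there (conn-start c) (trans (adj-sym T z x) a) (here p))
  where
  conn-start : ∀ {N} {T : Graph N} {P : Fin N → Set} {x y} → Conn T P x y → P x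
  conn-start (here p) = p
  conn-start (there p _ _) = p

within-refl : ∀ {N} {T : Graph N} k {x} → Within T k x x
within-refl zero    = refl
within-refl (suc k) = inj₁ refl

within-snoc : ∀ {N} {T : Graph N} k {x y z} → Within T k x y → adj T y z ≡ true → Within T (suc k) x z
within-snoc zero refl a = inj₂ (_ , a , refl)
within-snoc (suc k) (inj₁ refl) a = inj₂ (_ , a , inj₁ refl)
within-snoc (suc k) (inj₂ (u , b , w)) a = inj₂ (u , b , within-snoc k w a)

within-≤ : ∀ {N} {T : Graph N} {k k'} → k ≤ k' → ∀ {x y} → Within T k x y → Within T k' x y
within-≤ {k' = k'} z≤n refl = within-refl k'
within-≤ (s≤s p) (inj₁ e) = inj₁ e
within-≤ (s≤s p) (inj₂ (u , b , w)) = inj₂ (u , b , within-≤ p w)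

-- Parents have smaller indices: descent to the root gives connectivity, and the largest index on a
-- would-be cycle gives acyclicity.
module Parent {N} (root : Fin N) (par : Fin N → Fin N) (par-root : par root ≡ root) (par-< : ∀ v → v ≢ root → par v Fin.< v) where

  link : Fin N → Fin N → Bool
  link u v = not (u == v) ∧ ((par v == u) ∨ (par u == v))

  T : Graph N
  T = record { adj = link ; adj-sym = λ u v → cong₂ _∧_ (cong not (==-sym u v)) (BP.∨-comm (par v == u) (par u == v))
             ; adj-irrefl = λ u → cong (λ b → not b ∧ ((par u == u) ∨ (par u == u))) (==-refl u) }

  to-parent : ∀ v → v ≢ root → link v (par v) ≡ true
  to-parent v h = ∧-i (not-i (==-f (λ e → NP.<-irrefl (cong toℕ (sym e)) (par-< v h)))) (∨-r {par (par v) == v} (==-refl (par v)))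

  link-e : ∀ u v → link u v ≡ true → (par v ≡ u × v ≢ root) ⊎ (par u ≡ v × u ≢ root)
  link-e u v h with ∨-e (∧-r {not (u == v)} h)
  ... | inj₁ e = inj₁ (==-yes e , λ { refl → ==-no (not-e (∧-l h)) (trans (sym (==-yes e)) par-root) })
  ... | inj₂ e = inj₂ (==-yes e , λ { refl → ==-no (not-e (∧-l h)) (trans (sym par-root) (==-yes e)) })

  to-root : ∀ {P : Fin N → Set} → (∀ v → P v) → ∀ v → Conn T P v root
  to-root {P} all v = go (toℕ v) v NP.≤-refl
    where
    go : ∀ k v → toℕ v ≤ k → Conn T P v root
    go k v p with eq? v root
    ... | inj₁ refl = here (all v)
    go zero v p    | inj₂ ne = ⊥-elim (NP.n≮0 (NP.<-≤-trans (par-< v ne) p))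
    go (suc k) v p | inj₂ ne = there (all v) (to-parent v ne) (go k (par v) (NP.≤-pred (NP.<-≤-trans (par-< v ne) p)))

  lower : ∀ u v → link u v ≡ true → toℕ v ≤ toℕ u → v ≡ par u
  lower u v h p with link-e u v h
  ... | inj₂ (e , _) = sym e
  ... | inj₁ (refl , ne) = ⊥-elim (NP.<⇒≱ (par-< v ne) p)

  maximum : ∀ m (f : Fin (suc m) → ℕ) → Σ (Fin (suc m)) λ i → ∀ j → f j ≤ f i
  maximum zero f = zero , λ { zero → NP.≤-refl }
  maximum (suc m) f with maximum m (f ∘ suc)
  ... | (i , h) with NP.≤-total (f zero) (f (suc i))
  ...   | inj₁ p = suc i , λ { zero → p ; (suc j) → h j }
  ...   | inj₂ p = zero , λ { zero → NP.≤-refl ; (suc j) → NP.≤-trans (h j) p }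

  -- Both neighbours of the vertex of largest index on a cycle would be its parent.
  acyclic : ¬ Cycle T
  acyclic C with maximum _ (toℕ ∘ Cycle.c C)
  ... | (i , mx) = top i mx
    where
    open Cycle C
    both : ∀ i j k → (∀ j → toℕ (c j) ≤ toℕ (c i)) → link (c i) (c j) ≡ true → link (c i) (c k) ≡ true → j ≡ k
    both i j k mx a b = inj j k (trans (lower _ _ a (mx j)) (sym (lower _ _ b (mx k))))
    back : ∀ i → link (c (suc i)) (c (inject₁ i)) ≡ true
    back i = trans (adj-sym T (c (suc i)) (c (inject₁ i))) (edges i)
    last? : ∀ {m} (i : Fin (suc m)) → (i ≡ fromℕ m) ⊎ Σ (Fin m) λ j → i ≡ inject₁ j
    last? {zero} zero = inj₁ refl
    last? {suc m} zero = inj₂ (zero , refl)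
    last? {suc m} (suc i) with last? i
    ... | inj₁ e = inj₁ (cong suc e)
    ... | inj₂ (j , e) = inj₂ (suc j , cong suc e)
    top : ∀ i → (∀ j → toℕ (c j) ≤ toℕ (c i)) → ⊥
    top zero mx with both zero (suc zero) (fromℕ _) mx (edges zero) (trans (adj-sym T _ _) close)
    ... | ()
    top (suc i) mx with last? i
    ... | inj₁ refl with both (suc i) (inject₁ i) zero mx (back i) close
    ...   | ()
    top (suc i) mx | inj₂ (j , refl) with cong toℕ (both (suc i) (inject₁ i) (suc (suc j)) mx (back i) (edges (suc j)))
    ...   | e = NP.<-irrefl (trans (sym (FP.toℕ-inject₁ (inject₁ j))) (trans e refl)) (s≤s (NP.≤-trans (NP.≤-reflexive (FP.toℕ-inject₁ j)) (NP.n≤1+n _)))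

-- Cut-rank bounds by counting distinct rows

xorSum-cong : ∀ {m} {f g : Fin m → Bool} → (∀ i → f i ≡ g i) → xorSum f ≡ xorSum g
xorSum-cong {zero} h = refl
xorSum-cong {suc m} h = cong₂ _xor_ (h zero) (xorSum-cong (h ∘ suc))

xorSum-false : ∀ m → xorSum {m} (λ _ → false) ≡ false
xorSum-false zero = refl
xorSum-false (suc m) = xorSum-false m

xorSum-xor : ∀ {m} (f g : Fin m → Bool) → xorSum (λ i → f i xor g i) ≡ xorSum f xor xorSum g
xorSum-xor {zero} f g = refl
xorSum-xor {suc m} f g = trans (cong ((f zero xor g zero) xor_) (xorSum-xor (f ∘ suc) (g ∘ suc)))
  (taut 4 (λ { (a ∷ b ∷ c ∷ d ∷ []) → (a xor b) xor (c xor d) }) (λ { (a ∷ b ∷ c ∷ d ∷ []) → (a xor c) xor (b xor d) }) refl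
    (f zero ∷ g zero ∷ xorSum (f ∘ suc) ∷ xorSum (g ∘ suc) ∷ []))

xorSum-at : ∀ {m} (i : Fin m) (f : Fin m → Bool) → xorSum (λ j → (j == i) ∧ f j) ≡ f i
xorSum-at {suc m} zero f = trans (cong (f zero xor_) (trans (xorSum-cong {f = λ j → (suc j == zero) ∧ f (suc j)} {g = λ _ → false}
  (λ j → cong (_∧ f (suc j)) (==-f {x = suc j} {zero} (λ ())))) (xorSum-false m))) (BP.xor-identityʳ (f zero))
xorSum-at {suc m} (suc i) f = xorSum-at i (f ∘ suc)

-- Two of the `suc k` rows share a key, and the sum of these two vanishes outside `S`.
few-rows : ∀ {n k} (G : Graph n) (S : Subset n) (key : Fin n → Fin k) →
  (∀ x y → x ∈ S → y ∈ S → key x ≡ key y → ∀ z → z ∉ S → adj G x z ≡ adj G y z) → CutRankLe G S k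
few-rows {n} {k} G S key same r r∈ with FP.pigeonhole (NP.n<1+n k) (key ∘ r)
... | (i , j , i<j , e) = c , (i , trans (cong₂ _xor_ (==-refl i) (==-f (λ q → NP.<-irrefl (cong toℕ q) i<j))) refl) , zero-sum
  where
  c : Fin (suc k) → Bool
  c m = (m == i) xor (m == j)
  zero-sum : ∀ y → S y ≡ false → xorSum (λ m → c m ∧ adj G (r m) y) ≡ false
  zero-sum y h = trans (xorSum-cong {g = λ m → ((m == i) ∧ a m) xor ((m == j) ∧ a m)} (λ m → BP.∧-distribʳ-xor (a m) (m == i) (m == j)))
      (trans (xorSum-xor (λ m → (m == i) ∧ a m) (λ m → (m == j) ∧ a m))
        (trans (cong₂ _xor_ (xorSum-at i a) (xorSum-at j a)) (trans (cong (_xor a j) (same (r i) (r j) (r∈ i) (r∈ j) e y h)) (BP.xor-same (a j)))))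
    where
    a : Fin (suc k) → Bool
    a m = adj G (r m) y

-- Rows of S inside C depend on their code, rows outside C on their values at the codes occurring in C.
module Coded {n K : ℕ} (G : Graph n) (C S : Subset n) (code : Fin n → Fin K) (outside : ∀ y y' → y ∉ C → y' ∉ C → S y ≡ S y')
  (across : ∀ y y' z → y ∈ C → y' ∈ C → z ∉ C → code y ≡ code y' → adj G y z ≡ adj G y' z)
  (among : ∀ y y' z → y ∈ C → y' ∈ C → z ∈ C → y ∈ S → y' ∈ S → z ∉ S → code y ≡ code y' → adj G y z ≡ adj G y' z) where

  val : Fin n → Fin K → Bool
  val y c with ∃? (λ z → C z ∧ (code z == c))
  ... | inj₁ (z , _) = adj G z y
  ... | inj₂ _ = false

  val-eq : ∀ {y z} → y ∉ C → z ∈ C → val y (code z) ≡ adj G z y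
  val-eq {y} {z} h hz with ∃? (λ z' → C z' ∧ (code z' == code z))
  ... | inj₁ (z' , q) = across z' z y (∧-l q) hz h (==-yes (∧-r {C z'} q))
  ... | inj₂ none = tf (∧-i hz (==-refl (code z))) (none z)

  key : Fin n → Fin (K + 2 ^ K)
  key y = if C y then code y ↑ˡ 2 ^ K else K ↑ʳ Fin.funToFin (bitF ∘ val y)

  key-in : ∀ {y} → y ∈ C → key y ≡ code y ↑ˡ 2 ^ K
  key-in h rewrite h = refl

  key-out : ∀ {y} → y ∉ C → key y ≡ K ↑ʳ Fin.funToFin (bitF ∘ val y)
  key-out h rewrite h = refl

  mixed : ∀ {y y'} → y ∈ C → y' ∉ C → key y ≢ key y'
  mixed {y} {y'} h h' q with trans (sym (FP.splitAt-↑ˡ K (code y) (2 ^ K))) (trans (cong (splitAt K) (trans (sym (key-in h)) (trans q (key-out h')))) (FP.splitAt-↑ʳ K (2 ^ K) _))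
  ... | ()

  same-rows : ∀ y y' → y ∈ S → y' ∈ S → key y ≡ key y' → ∀ z → z ∉ S → adj G y z ≡ adj G y' z
  same-rows y y' ys ys' q z zs with bool (C y) | bool (C y')
  ... | inj₁ h | inj₂ h' = ⊥-elim (mixed h h' q)
  ... | inj₂ h | inj₁ h' = ⊥-elim (mixed h' h (sym q))
  ... | inj₂ h | inj₂ h' = trans (adj-sym G y z) (trans (sym (val-eq h hz)) (trans vals (trans (val-eq h' hz) (adj-sym G z y'))))
    where
    hz : z ∈ C
    hz = ≢false (λ nz → tf (trans (outside z y nz h) ys) zs)
    bits : Fin.funToFin (bitF ∘ val y) ≡ Fin.funToFin (bitF ∘ val y')
    bits = FP.↑ʳ-injective K _ _ (trans (sym (key-out h)) (trans q (key-out h')))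
    vals : val y (code z) ≡ val y' (code z)
    vals = bitF-inj (trans (sym (FP.finToFun-funToFin (bitF ∘ val y) (code z))) (trans (cong (λ f → Fin.finToFun f (code z)) bits) (FP.finToFun-funToFin (bitF ∘ val y') (code z))))
  ... | inj₁ h | inj₁ h' with bool (C z) | FP.↑ˡ-injective (2 ^ K) (code y) (code y') (trans (sym (key-in h)) (trans q (key-in h')))
  ...   | inj₂ nz | c = across y y' z h h' nz c
  ...   | inj₁ hz | c = among y y' z h h' hz ys ys' zs c

-- The summand `R` is slack: a single number has to bound width and radius.
coded-rows : ∀ {n K R} (G : Graph n) (C S : Subset n) (code : Fin n → Fin K) → (∀ y y' → y ∉ C → y' ∉ C → S y ≡ S y') →
  (∀ y y' z → y ∈ C → y' ∈ C → z ∉ C → code y ≡ code y' → adj G y z ≡ adj G y' z) →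
  (∀ y y' z → y ∈ C → y' ∈ C → z ∈ C → y ∈ S → y' ∈ S → z ∉ S → code y ≡ code y' → adj G y z ≡ adj G y' z) → CutRankLe G S ((K + 2 ^ K) + R)
coded-rows {R = R} G C S code o a m = few-rows G S (λ y → key y ↑ˡ R) (λ y y' h h' q → same-rows y y' h h' (FP.↑ˡ-injective R (key y) (key y') q))
  where open Coded G C S code o a m

clamp : ∀ D → ℕ → Fin (suc D)
clamp D       zero    = zero
clamp zero    (suc a) = zero
clamp (suc D) (suc a) = suc (clamp D a)

toℕ-clamp : ∀ {D a} → a ≤ D → toℕ (clamp D a) ≡ a
toℕ-clamp {D} z≤n = refl
toℕ-clamp (s≤s p) = cong suc (toℕ-clamp p)

clamp-toℕ : ∀ {D} (i : Fin (suc D)) → clamp D (toℕ i) ≡ i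
clamp-toℕ zero = refl
clamp-toℕ {suc D} (suc i) = cong suc (clamp-toℕ i)

-- The vertex x at level a represents its class there if r a x ≡ x. The levels of x below the first such level j x subdivide
-- the edge from its class at level j x to the class one level up.
module Levels {n' K D' : ℕ} (G : Graph (suc n')) (F : Flat (suc D') K (adj G) (λ _ → true)) (z₁ : Fin (suc n')) (nc : Flat.same F 1 zero z₁ ≡ false) where
  open Flat F
  n = suc n'
  D = suc D'
  N = n * suc D

  same-≤ : ∀ {e e'} → e ≤ e' → ∀ {x y} → same e' x y ≡ true → same e x y ≡ true
  same-≤ {e} p {x} {y} h = go (NP.≤⇒≤′ p) h
    where
    go : ∀ {e'} → e ≤′ e' → same e' x y ≡ true → same e x y ≡ true
    go ≤′-refl h = h
    go (≤′-step q) h = go q (s-up _ x y h)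

  -- The representative of a class is its least vertex, which is why parents precede their children
  -- in the order of nodes.
  r : ℕ → Fin n → Fin n
  r e x = proj₁ (least (same e x) (x , s-refl e x))

  r-same : ∀ e x → same e x (r e x) ≡ true
  r-same e x = proj₁ (proj₂ (least (same e x) (x , s-refl e x)))

  r-least : ∀ e x y → same e x y ≡ true → toℕ (r e x) ≤ toℕ y
  r-least e x y h = NP.≮⇒≥ (λ p → tf h (proj₂ (proj₂ (least (same e x) (x , s-refl e x))) y p))

  r-cong : ∀ e {x y} → same e x y ≡ true → r e x ≡ r e y
  r-cong e {x} {y} h = FP.toℕ-injective (NP.≤-antisym (r-least e x (r e y) (s-trans e x y (r e y) h (r-same e y)))
    (r-least e y (r e x) (s-trans e y x (r e x) (s-sym e x y h) (r-same e x))))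

  r-idem : ∀ e x → r e (r e x) ≡ r e x
  r-idem e x = sym (r-cong e (r-same e x))

  r-≤ : ∀ e x → toℕ (r e x) ≤ toℕ x
  r-≤ e x = r-least e x x (s-refl e x)

  r-mono : ∀ {e e'} → e ≤ e' → ∀ {x} → r e x ≡ x → r e' x ≡ x
  r-mono {e} {e'} p {x} h = FP.toℕ-injective (NP.≤-antisym (r-≤ e' x)
    (NP.≤-trans (NP.≤-reflexive (cong toℕ (sym h))) (r-least e x (r e' x) (same-≤ p (r-same e' x)))))

  r-0 : ∀ x → r 0 x ≡ zero
  r-0 x = FP.toℕ-injective (NP.n≤0⇒n≡0 (r-least 0 x zero (s-0 x zero)))

  r-D : ∀ x → r D x ≡ x
  r-D x = sym (s-D x (r D x) refl refl (r-same D x))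

  jF : ∀ x → Σ (Fin (suc D)) λ i → (r (toℕ i) x == x) ≡ true × (∀ i' → i' Fin.< i → (r (toℕ i') x == x) ≡ false)
  jF x = least (λ i → r (toℕ i) x == x) (fromℕ D , ==-t (trans (cong (λ e → r e x) (FP.toℕ-fromℕ D)) (r-D x)))

  j : Fin n → ℕ
  j x = toℕ (proj₁ (jF x))

  j-≤D : ∀ x → j x ≤ D
  j-≤D x = NP.≤-pred (FP.toℕ<n (proj₁ (jF x)))

  j-rep : ∀ x → r (j x) x ≡ x
  j-rep x = ==-yes (proj₁ (proj₂ (jF x)))

  j-least : ∀ {e x} → r e x ≡ x → j x ≤ e
  j-least {e} {x} h = NP.≮⇒≥ (λ p → let e≤D = NP.≤-trans (NP.<⇒≤ p) (j-≤D x) in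
    ==-no (proj₂ (proj₂ (jF x)) (clamp D e) (subst (λ a → suc a ≤ j x) (sym (toℕ-clamp e≤D)) p)) (trans (cong (λ a → r a x) (toℕ-clamp e≤D)) h))

  -- Every pair of a vertex and a level is a node, ordered by the vertex first; levels beyond `D`
  -- are clamped.
  node : Fin n → ℕ → Fin N
  node x a = combine x (clamp D a)

  vx : Fin N → Fin n
  vx u = proj₁ (remQuot {n} (suc D) u)

  lv : Fin N → ℕ
  lv u = toℕ (proj₂ (remQuot {n} (suc D) u))

  lv-≤ : ∀ u → lv u ≤ D
  lv-≤ u = NP.≤-pred (FP.toℕ<n (proj₂ (remQuot {n} (suc D) u)))

  vx-node : ∀ x a → vx (node x a) ≡ x
  vx-node x a = cong proj₁ (FP.remQuot-combine {n} {suc D} x (clamp D a))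

  lv-node : ∀ x {a} → a ≤ D → lv (node x a) ≡ a
  lv-node x {a} p = trans (cong (toℕ ∘ proj₂) (FP.remQuot-combine {n} {suc D} x (clamp D a))) (toℕ-clamp p)

  node-eta : ∀ u → node (vx u) (lv u) ≡ u
  node-eta u = trans (cong (combine (vx u)) (clamp-toℕ (proj₂ (remQuot {n} (suc D) u)))) (FP.combine-remQuot {n} (suc D) u)

  node-inj : ∀ {x a y b} → a ≤ D → b ≤ D → node x a ≡ node y b → x ≡ y × a ≡ b
  node-inj {x} {a} {y} {b} p q e = trans (sym (vx-node x a)) (trans (cong vx e) (vx-node y b)) , trans (sym (lv-node x p)) (trans (cong lv e) (lv-node y q))

  node-<ˡ : ∀ {x y} a b → x Fin.< y → node x a Fin.< node y b
  node-<ˡ a b p = FP.combine-monoˡ-< (clamp D a) (clamp D b) p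

  node-<ʳ : ∀ x {a b} → a < b → b ≤ D → node x a Fin.< node x b
  node-<ʳ x {a} {b} p q = subst₂ _<_ (sym (FP.toℕ-combine x (clamp D a))) (sym (FP.toℕ-combine x (clamp D b)))
    (NP.+-monoʳ-< (suc D * toℕ x) (subst₂ _<_ (sym (toℕ-clamp (NP.≤-trans (NP.<⇒≤ p) q))) (sym (toℕ-clamp q)) p))

  root : Fin N
  root = node zero 0

  above : ℕ → Fin n → Fin N
  above zero    x = node x 0
  above (suc e) x = node (r e x) e

  parent : Fin n → ℕ → Fin N
  parent x zero    = above (j x) x
  parent x (suc a) = node x a

  par : Fin N → Fin N
  par u = parent (vx u) (lv u)

  par-node : ∀ x {a} → a ≤ D → par (node x a) ≡ parent x a
  par-node x {a} p = cong₂ parent (vx-node x a) (lv-node x p)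

  j-0 : ∀ {x} → j x ≡ 0 → x ≡ zero
  j-0 {x} e = trans (sym (trans (cong (λ a → r a x) (sym e)) (j-rep x))) (r-0 x)

  j-zero : j zero ≡ 0
  j-zero = NP.n≤0⇒n≡0 (j-least (r-0 zero))

  below-j : ∀ {x e} → j x ≡ suc e → r e x ≢ x
  below-j q h = NP.<-irrefl refl (NP.≤-trans (NP.≤-reflexive (sym q)) (j-least h))

  parent-root : parent zero 0 ≡ root
  parent-root = cong (λ a → above a zero) j-zero

  parent-< : ∀ x {a} → a ≤ D → node x a ≢ root → parent x a Fin.< node x a
  parent-< x {suc a} p h = node-<ʳ x NP.≤-refl p
  parent-< x {zero} p h = go (j x) refl
    where
    go : ∀ e → j x ≡ e → above e x Fin.< node x 0
    go zero    q = ⊥-elim (h (cong (λ x → node x 0) (j-0 q)))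
    go (suc e) q = node-<ˡ e 0 (NP.≤∧≢⇒< (r-≤ e x) (λ s → below-j q (FP.toℕ-injective s)))

  par-< : ∀ v → v ≢ root → par v Fin.< v
  par-< v h = subst (par v Fin.<_) (node-eta v) (parent-< (vx v) (lv-≤ v) (λ e → h (trans (sym (node-eta v)) e)))

  open Parent root par (trans (par-node zero z≤n) parent-root) par-<

  adj-level : ∀ x {a} → suc a ≤ D → link (node x (suc a)) (node x a) ≡ true
  adj-level x {a} p = subst (λ u → link (node x (suc a)) u ≡ true) (par-node x p) (to-parent (node x (suc a)) (λ e → NP.1+n≢0 (proj₂ (node-inj {x} {suc a} {zero} {0} p z≤n e))))

  adj-class : ∀ {x e} → j x ≡ suc e → link (node x 0) (node (r e x) e) ≡ true
  adj-class {x} {e} q = subst (λ u → link (node x 0) u ≡ true) (trans (par-node x z≤n) (cong (λ a → above a x) q))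
    (to-parent (node x 0) (λ e → NP.1+n≢0 (trans (sym q) (trans (cong j (proj₁ (node-inj {x} {0} {zero} {0} z≤n z≤n e))) j-zero))))

  σ : Fin n → Fin N
  σ x = node x D

  σ-inj : ∀ x y → σ x ≡ σ y → x ≡ y
  σ-inj x y e = proj₁ (node-inj {x} {D} {y} {D} NP.≤-refl NP.≤-refl e)

  parent-level : ∀ x a → a ≤ D → parent x a ≡ root ⊎ lv (parent x a) < D
  parent-level x (suc a) p = inj₂ (subst (_< D) (sym (lv-node x (NP.≤-trans (NP.n≤1+n a) p))) p)
  parent-level x zero p = go (j x) refl
    where
    go : ∀ e → j x ≡ e → above e x ≡ root ⊎ lv (above e x) < D
    go zero    q = inj₁ (cong (λ x → node x 0) (j-0 q))
    go (suc e) q = let e<D = NP.≤-trans (NP.≤-reflexive (sym q)) (j-≤D x) in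
      inj₂ (subst (_< D) (sym (lv-node (r e x) (NP.≤-trans (NP.n≤1+n e) e<D))) e<D)

  par-level : ∀ u → lv (par u) < D
  par-level u with parent-level (vx u) (lv u) (lv-≤ u)
  ... | inj₂ h = h
  ... | inj₁ e = subst (_< D) (sym (trans (cong lv e) (lv-node zero {0} z≤n))) (s≤s z≤n)

  σ-leaf : ∀ x → IsLeaf T (σ x)
  σ-leaf x = node x D' , adj-level x NP.≤-refl , only
    where
    only : ∀ u → link (σ x) u ≡ true → u ≡ node x D'
    only u h with link-e (σ x) u h
    ... | inj₁ (e , _) = ⊥-elim (NP.<-irrefl (lv-node x {D} NP.≤-refl) (subst (λ u → lv u < D) e (par-level u)))
    ... | inj₂ (e , _) = trans (sym e) (par-node x {D} NP.≤-refl)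

  -- The root has a second child: the representative of another class of level 1.
  second-child : Σ (Fin n) λ z → z ≢ zero × j z ≡ 1
  second-child = z , z≢ , NP.≤-antisym (j-least (r-idem 1 z₁)) (NP.≮⇒≥ (λ p → z≢ (j-0 (NP.n≤0⇒n≡0 (NP.≤-pred p)))))
    where
    z = r 1 z₁
    z≢ : z ≢ zero
    z≢ e = tf (s-sym 1 z₁ zero (subst (λ y → same 1 z₁ y ≡ true) e (r-same 1 z₁))) nc

  -- A node below level `D` has at least two neighbours: the next node of the same vertex and its
  -- parent, or, for the root, the second child.
  leaf-level : ∀ u → IsLeaf T u → lv u ≡ D
  leaf-level u (u' , _ , only) with NP.m≤n⇒m<n∨m≡n (lv-≤ u)
  ... | inj₂ e = e
  ... | inj₁ p = ⊥-elim (go (eq? u root))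
    where
    x = vx u
    a = lv u
    child : link u (node x (suc a)) ≡ true
    child = trans (adj-sym T u (node x (suc a))) (subst (λ v → link (node x (suc a)) v ≡ true) (node-eta u) (adj-level x p))
    go : (u ≡ root) ⊎ (u ≢ root) → ⊥
    go (inj₂ ne) = NP.<-asym (par-< u ne) (subst₂ Fin._<_ (node-eta u) (trans (only _ child) (sym (only _ (to-parent u ne)))) (node-<ʳ x NP.≤-refl p))
    go (inj₁ e) = z≢ (trans (proj₁ (node-inj {z} {0} {x} {suc a} z≤n p (trans (only _ other) (sym (only _ child))))) (trans (cong vx e) (vx-node zero 0)))
      where
      z = proj₁ second-child
      z≢ = proj₁ (proj₂ second-child)
      other : link u (node z 0) ≡ true
      other = trans (adj-sym T u (node z 0)) (subst (λ v → link (node z 0) v ≡ true) (trans (cong (λ y → node y 0) (r-0 z)) (sym e)) (adj-class (proj₂ (proj₂ second-child))))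

  σ-onto : ∀ v → IsLeaf T v → Σ (Fin n) λ x → σ x ≡ v
  σ-onto v l = vx v , trans (cong (node (vx v)) (sym (leaf-level v l))) (node-eta v)

  isTree : IsTree T
  isTree = (λ u v → conn-++ (to-root (λ _ → tt) u) (conn-sym (to-root (λ _ → tt) v))) , acyclic

  within-level : ∀ x {k} a → a ≤ D → Within T k root (node x 0) → Within T (k + a) root (node x a)
  within-level x {k} zero p w = subst (λ k → Within T k root (node x 0)) (sym (NP.+-identityʳ k)) w
  within-level x {k} (suc a) p w = subst (λ k → Within T k root (node x (suc a))) (sym (NP.+-suc k a))
    (within-snoc (k + a) (within-level x a (NP.≤-trans (NP.n≤1+n a) p) w) (trans (adj-sym T (node x a) (node x (suc a))) (adj-level x p)))

  within-class : ∀ J x → j x ≤ J → Within T (J * suc D) root (node x 0)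
  within-class zero x p = cong (λ x → node x 0) (sym (j-0 (NP.n≤0⇒n≡0 p)))
  within-class (suc J) x p = go (j x) refl p
    where
    go : ∀ e → j x ≡ e → e ≤ suc J → Within T (suc J * suc D) root (node x 0)
    go zero    q _ = within-≤ z≤n {root} {node x 0} (cong (λ x → node x 0) (sym (j-0 q)))
    go (suc e) q (s≤s e≤J) = within-≤ {k = suc (J * suc D + e)} (s≤s (NP.≤-trans (NP.+-monoʳ-≤ (J * suc D) e≤D) (NP.≤-reflexive (NP.+-comm (J * suc D) D)))) {root} {node x 0}
        (within-snoc (J * suc D + e) (within-level (r e x) e e≤D (within-class J (r e x) (NP.≤-trans (j-least (r-idem e x)) e≤J)))
          (trans (adj-sym T (node (r e x) e) (node x 0)) (adj-class q)))
      where
      e≤D : e ≤ D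
      e≤D = NP.≤-trans (NP.n≤1+n e) (NP.≤-trans (NP.≤-reflexive (sym q)) (j-≤D x))

  -- At most `D` changes of representative, each over at most `suc D` edges, and finally at most `D`
  -- levels along one vertex.
  radius : RadiusLe T (D * suc D + D)
  radius = root , λ u → subst (Within T (D * suc D + D) root) (node-eta u)
    (within-≤ (NP.+-monoʳ-≤ (D * suc D) (lv-≤ u)) (within-level (vx u) (lv u) (lv-≤ u) (within-class D (vx u) (j-≤D (vx u)))))

  down : ∀ {Q : Fin N → Set} z a → a ≤ D → (∀ b → b ≤ a → Q (node z b)) → Conn T Q (node z a) (node z 0)
  down z zero p q = here (q 0 z≤n)
  down z (suc a) p q = there (q (suc a) NP.≤-refl) (adj-level z p) (down z a (NP.≤-trans (NP.n≤1+n a) p) (λ b h → q b (NP.≤-trans h (NP.n≤1+n a))))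

  -- From level `suc f` to level `f` the representative either stays, which is one edge, or changes,
  -- and then the walk runs through the subdivision nodes down to level 0 before it enters the
  -- larger class. The premises on `Q` name the nodes met in the two cases.
  climb : ∀ {Q : Fin N → Set} y f gap → f + gap ≡ D → (∀ g → f ≤ g → g ≤ D → Q (node (r g y) g)) →
    (∀ g a → f ≤ g → suc g ≤ D → r g (r (suc g) y) ≢ r (suc g) y → a ≤ suc g → Q (node (r (suc g) y) a)) → Conn T Q (σ y) (node (r f y) f)
  climb {Q} y f zero e q₁ q₂ = subst (λ x → Conn T Q (σ y) x) (cong₂ node (sym (trans (cong (λ e → r e y) f≡D) (r-D y))) (sym f≡D))
      (here (subst Q (cong₂ node (trans (cong (λ e → r e y) f≡D) (r-D y)) f≡D) (q₁ f NP.≤-refl (NP.≤-reflexive f≡D))))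
    where
    f≡D : f ≡ D
    f≡D = trans (sym (NP.+-identityʳ f)) e
  climb {Q} y f (suc gap) e q₁ q₂ = conn-++ (climb y (suc f) gap (trans (sym (NP.+-suc f gap)) e) (λ g p → q₁ g (NP.≤-trans (NP.n≤1+n f) p))
      (λ g a p → q₂ g a (NP.≤-trans (NP.n≤1+n f) p))) (link-up (eq? (r f z) z))
    where
    z = r (suc f) y
    f<D : suc f ≤ D
    f<D = NP.≤-trans (NP.m≤m+n (suc f) gap) (NP.≤-reflexive (trans (sym (NP.+-suc f gap)) e))
    rz : r f z ≡ r f y
    rz = sym (r-cong f (s-up f y z (r-same (suc f) y)))
    target : Q (node (r f y) f)
    target = q₁ f NP.≤-refl (NP.≤-trans (NP.n≤1+n f) f<D)
    link-up : (r f z ≡ z) ⊎ (r f z ≢ z) → Conn T Q (node z (suc f)) (node (r f y) f)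
    link-up (inj₁ q) = there (q₁ (suc f) (NP.n≤1+n f) f<D) (subst (λ x → link (node z (suc f)) (node x f) ≡ true) (trans (sym q) rz) (adj-level z f<D)) (here target)
    link-up (inj₂ q) = conn-++ (down z (suc f) f<D (λ b p → q₂ f b NP.≤-refl f<D q p))
      (there (q₂ f 0 NP.≤-refl f<D q z≤n) (subst (λ x → link (node z 0) (node x f) ≡ true) rz (adj-class jz)) (here target))
      where
      jz : j z ≡ suc f
      jz = NP.≤-antisym (j-least (r-idem (suc f) y)) (NP.≰⇒> (λ p → q (r-mono p (j-rep z))))

  -- Removing v splits the vertices into those outside a class C, and the classes one level below C.
  module Width (v : Fin N) (lv<D : lv v < D) (S : Subset n) (const : ∀ x y → Conn T (_≢ v) (σ x) (σ y) → S x ≡ S y) where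
    x = vx v
    e = lv v
    -- If `e` is at least `j x`, the node `v` is the class of `x` at level `e`. Otherwise it
    -- subdivides the edge above the class at level `j x`, and its removal cuts this class off
    -- inside the class of level `pred (j x)`.
    es = e ⊔ pred (j x)

    es<D : es < D
    es<D = s≤s (NP.⊔-lub (NP.≤-pred lv<D) (NP.pred-mono-≤ (j-≤D x)))

    C : Subset n
    C = same es x

    on-v : ∀ {y a} → a ≤ D → node y a ≡ v → y ≡ x × a ≡ e
    on-v {y} {a} p q = trans (sym (vx-node y a)) (cong vx q) , trans (sym (lv-node y p)) (cong lv q)

    outside : ∀ y y' → y ∉ C → y' ∉ C → S y ≡ S y'
    outside y y' h h' = const y y' (conn-++ (subst (λ u → Conn T (_≢ v) (σ y) (node u 0)) (r-cong 0 (s-0 y y')) (up y h)) (conn-sym (up y' h')))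
      where
      off-v : ∀ y → y ∉ C → ∀ g a → g ≤ D → a ≤ g → node (r g y) a ≢ v
      off-v y h g a g≤D a≤g q with on-v (NP.≤-trans a≤g g≤D) q
      ... | (ry , refl) = tf (same-≤ (NP.⊔-lub a≤g (NP.≤-trans NP.pred[n]≤n (j-least (trans (cong (r g) (sym ry)) (trans (r-idem g y) ry)))))
              (s-sym g y x (subst (λ u → same g y u ≡ true) ry (r-same g y)))) h
      up : ∀ y → y ∉ C → Conn T (_≢ v) (σ y) (node (r 0 y) 0)
      up y h = climb y 0 D refl (λ g _ p → off-v y h g g p NP.≤-refl) (λ g a _ p _ q → off-v y h (suc g) a p q)

    inside : ∀ y y' → same (suc es) y y' ≡ true → S y ≡ S y'
    inside y y' h = const y y' (conn-++ (subst (λ u → Conn T (_≢ v) (σ y) (node u (suc es))) (r-cong (suc es) h) (up y)) (conn-sym (up y')))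
      where
      up : ∀ y → Conn T (_≢ v) (σ y) (node (r (suc es) y) (suc es))
      up y = climb y (suc es) (D ∸ suc es) (NP.m+[n∸m]≡n es<D)
        (λ g p g≤D q → NP.<-irrefl (sym (proj₂ (on-v {r g y} {g} g≤D q))) (NP.≤-trans (s≤s (NP.m≤m⊔n e _)) p))
        (λ g a p g<D ne a≤ q → let ry = proj₁ (on-v {r (suc g) y} {a} (NP.≤-trans a≤ g<D) q) in
          NP.<-irrefl refl (NP.≤-trans (s≤s (NP.≤-trans (NP.<⇒≤pred (NP.≰⇒> (λ s → ne (trans (cong (r g) ry) (trans (r-mono s (j-rep x)) (sym ry)))))) (NP.m≤n⊔m e _))) p))

    level : ∀ {y z} f → same f y z ≡ false → Σ ℕ λ g → g < f × same g y z ≡ true × same (suc g) y z ≡ false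
    level {y} {z} zero h = tf (s-0 y z) h
    level {y} {z} (suc f) h with bool (same f y z)
    ... | inj₁ t = f , NP.≤-refl , t , h
    ... | inj₂ t = let (g , p , q) = level f t in g , NP.m≤n⇒m≤1+n p , q

    apart : ∀ {f y y' z} → same f y y' ≡ true → same f y z ≡ false → same f y' z ≡ false
    apart {f} {y} {y'} {z} h h' = ≢true (λ t → tf (s-trans f y y' z h t) h')

    C-same : ∀ {y y'} → y ∈ C → y' ∈ C → same es y y' ≡ true
    C-same {y} {y'} h h' = s-trans es y x y' (s-sym es x y h) h'

    across : ∀ y y' z → y ∈ C → y' ∈ C → z ∉ C → code y ≡ code y' → adj G y z ≡ adj G y' z
    across y y' z h h' nz q with level es (apart {es} {x} {y} {z} h nz)
    ... | (g , p , s , ns) = split-eq g y z y' z refl refl refl refl s (s-trans g y' y z (s-sym g y y' yy) s) yy ns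
            (apart {suc g} {y} {y'} {z} (same-≤ p (C-same h h')) ns) q refl
      where
      yy = same-≤ (NP.<⇒≤ p) (C-same h h')

    among : ∀ y y' z → y ∈ C → y' ∈ C → z ∈ C → y ∈ S → y' ∈ S → z ∉ S → code y ≡ code y' → adj G y z ≡ adj G y' z
    among y y' z h h' hz ys ys' zs c = split-eq es y z y' z refl refl refl refl (C-same h hz) (C-same h' hz) (C-same h h') (ne y ys) (ne y' ys') c refl
      where
      ne : ∀ y → y ∈ S → same (suc es) y z ≡ false
      ne y ys = ≢true (λ t → tf (trans (sym (inside y z t)) ys) zs)

    cut-rank : CutRankLe G S ((K + 2 ^ K) + (D * suc D + D))
    cut-rank = coded-rows G C S code outside across among

  rank-depth : RankDepthLe G ((K + 2 ^ K) + (D * suc D + D))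
  rank-depth = inj₂ (record { N = N ; T = T ; isTree = isTree ; σ = σ ; σ-inj = σ-inj ; σ-leaf = σ-leaf ; σ-onto = σ-onto } ,
      (λ v nl S const → Width.cut-rank v (NP.≤∧≢⇒< (lv-≤ v) (λ e → nl (leaf e))) S const) ,
      proj₁ radius , λ u → within-≤ (NP.m≤n+m (D * suc D + D) (K + 2 ^ K)) (proj₂ radius u))
    where
    leaf : ∀ {v} → lv v ≡ D → IsLeaf T v
    leaf {v} e = subst (IsLeaf T) (trans (cong (node (vx v)) (sym e)) (node-eta v)) (σ-leaf (vx v))

-- The bound on rank-depth and the conclusion

depth-bound : ℕ → ℕ → ℕ
depth-bound ℓ d = let K = codes ℓ (suc d) in (K + 2 ^ K) + (suc d * suc (suc d) + suc d)

-- The root needs a second child, hence a vertex outside the top part of vertex `zero`. Of two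
-- vertices in different parts, one is such a vertex.
low-rank-depth : ∀ ℓ d {n} (G : Graph n) → TM ℓ d (adj G) (λ _ → true) → RankDepthLe G (depth-bound ℓ d)
low-rank-depth ℓ d {zero} G t = inj₁ z≤n
low-rank-depth ℓ d {suc zero} G t = inj₁ (s≤s z≤n)
low-rank-depth ℓ d {suc (suc n)} G t with proper ℓ d (TM-suc ℓ d t) {zero} {suc zero} refl refl (λ ())
... | (t'@(p , _) , x , y , _ , _ , q) = go (eq? (p zero) (p x))
  where
  F = flat ℓ (suc d) t'
  go : (p zero ≡ p x) ⊎ (p zero ≢ p x) → RankDepthLe G (depth-bound ℓ d)
  go (inj₁ e) = Levels.rank-depth G F y (∧f' _ (==-f {x = p zero} {p y} (λ e' → q (trans (sym e) e'))))
  go (inj₂ e) = Levels.rank-depth G F x (∧f' _ (==-f {x = p zero} {p x} e))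

theorem1p5 : Σ (ℕ → ℕ) λ f → ∀ (t : ℕ) {n : ℕ} (G : Graph n) →
  RankDepthGe G (f t) → PivotMinor (path t) G ⊎ PivotMinor (cliqueHalf t) G
-- Rank-depth at least `suc b` is what refutes rank-depth at most `b`, hence the successor.
theorem1p5 = (λ t → suc (bound t)) , λ t G deep → proj₂ (high-goal t) G (λ low → deep (bound t) NP.≤-refl (low-rank-depth _ _ G low))
  where
  bound : ℕ → ℕ
  bound t = let k = proj₁ (high-goal t) in depth-bound (dbl k) k
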